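{- For all integers $r \geq 3$ and $t \geq r+3$, $$tn + \Omega\left(e'_{r,t}[n+o(n)]\right) \leq \mathrm{tsat}(n,K_r,t) \leq tn + O\left(e'_{r,t}[n+o(n)]\right),$$ i.e. there exist functions $a(n)=n+o(n)$ and $b(n)=n+o(n)$ and constants $c,C>0$ (depending on $r,t$) such that for all sufficiently large $n$, $tn + c\, e'_{r,t}(a(n)) \leq \mathrm{tsat}(n,K_r,t) \leq tn + C\, e'_{r,t}(b(n))$.
   Context: All graphs are finite and simple; $\delta(G)$ is the minimum degree. Two distinct vertices are twins if they have the same neighbourhood. A graph is $K_r$-saturated if it contains no $K_r$ but adding any missing edge creates a $K_r$. For $r\ge3$, $t\ge r-2$ and large $n$, $\mathrm{tsat}(n,K_r,t)$ is the minimum number of edges in a $K_r$-saturated graph $G$ on $n$ vertices with $\delta(G)\ge t$ in which every pair of twins has a common neighbour of degree exactly $t$. An $r$-system is a pair $(H,\mathcal{F})$ with $H$ a graph and $\mathcal{F}$ a family of subsets of $V(H)$ such that: (i) $H$ has no $K_r$; (ii) each $S\in\mathcal{F}$ is maximally $K_{r-1}$-free ($H[S]$ has no $K_{r-1}$ but $H[S\cup\{v\}]$ has a $K_{r-1}$ for every $v\notin S$); (iii) $H[S\cap T]$ contains a $K_{r-2}$ for distinct $S,T\in\mathcal{F}$. It is maximal if for every non-edge $e$ of $H$, either $H+e$ contains $K_r$ or $(H+e)[S]$ contains $K_{r-1}$ for some $S\in\mathcal{F}$. A maximal $(r,t)$-system is a maximal $r$-system in which $\mathcal{F}$ has no repeated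 elements and all its sets have size $t$. For $t\ge r$, $e'_{r,t}(s)$ is the minimum number of edges of $H$ over maximal $(r,t)$-systems $(H,\mathcal{F})$ with $|\mathcal{F}|=s$. -}

module Defs where

open import Data.Nat using (ℕ; zero; suc; _+_; _*_; _∸_; _≤_; _<_; ∣_-_∣)
open import Data.Bool using (Bool; true; false; _∧_; _∨_)
open import Data.Fin using (Fin; _≟_; _<?_)
open import Data.Fin.Subset using (Subset; _∈_; _∉_; _∪_; _∩_; ⁅_⁆; ∣_∣)
open import Data.Vec using (tabulate)
open import Data.List using (List; length; map; allFin)
open import Data.Nat.ListAction using (sum)
import Data.List.Membership.Propositional as LM
open import Data.List.Relation.Unary.All using (All)
open import Data.List.Relation.Unary.Unique.Propositional using (Unique)
open import Data.Product using (Σ; ∃; _×_; _,_)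
open import Data.Sum using (_⊎_)
open import Relation.Nullary using (¬_; Dec)
open import Relation.Nullary.Decidable using (⌊_⌋)
open import Relation.Binary.PropositionalEquality using (_≡_; _≢_)

record Graph (n : ℕ) : Set where
  field
    adj  : Fin n → Fin n → Bool
    sym  : ∀ i j → adj i j ≡ adj j i
    irr  : ∀ i → adj i i ≡ false
open Graph public

addEdge : {n : ℕ} → (Fin n → Fin n → Bool) → Fin n → Fin n → (Fin n → Fin n → Bool)
addEdge A u v i j = A i j ∨ ((⌊ i ≟ u ⌋ ∧ ⌊ j ≟ v ⌋) ∨ (⌊ i ≟ v ⌋ ∧ ⌊ j ≟ u ⌋))

CliqueIn : {n : ℕ} → (Fin n → Fin n → Bool) → Subset n → ℕ → Set
CliqueIn {n} A S k =
  Σ (Fin k → Fin n) λ f →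
    (∀ i j → f i ≡ f j → i ≡ j) ×
    (∀ i → f i ∈ S) ×
    (∀ i j → i ≢ j → A (f i) (f j) ≡ true)

full : {n : ℕ} → Subset n
full = tabulate (λ _ → true)

HasClique : {n : ℕ} → (Fin n → Fin n → Bool) → ℕ → Set
HasClique A k = CliqueIn A full k

nbhd : {n : ℕ} → Graph n → Fin n → Subset n
nbhd G i = tabulate (adj G i)

deg : {n : ℕ} → Graph n → Fin n → ℕ
deg G i = ∣ nbhd G i ∣

edges : {n : ℕ} → Graph n → ℕ
edges {n} G = sum (map (λ i → ∣ tabulate (λ j → adj G i j ∧ ⌊ i <? j ⌋) ∣) (allFin n))

Saturated : {n : ℕ} → ℕ → Graph n → Set
Saturated r G =
  ¬ HasClique (adj G) r ×
  (∀ u v → u ≢ v → adj G u v ≡ false → HasClique (addEdge (adj G) u v) r)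

MinDegGe : {n : ℕ} → ℕ → Graph n → Set
MinDegGe t G = ∀ i → t ≤ deg G i

Twins : {n : ℕ} → Graph n → Fin n → Fin n → Set
Twins G u v = u ≢ v × (∀ w → adj G u w ≡ adj G v w)

TwinCondition : {n : ℕ} → ℕ → Graph n → Set
TwinCondition t G = ∀ u v → Twins G u v →
  ∃ λ w → adj G u w ≡ true × adj G v w ≡ true × deg G w ≡ t

TsatAdmissible : {n : ℕ} → ℕ → ℕ → Graph n → Set
TsatAdmissible r t G = Saturated r G × MinDegGe t G × TwinCondition t G

IsMin : (ℕ → Set) → ℕ → Set
IsMin P m = P m × (∀ k → P k → m ≤ k)

IsTsat : ℕ → ℕ → ℕ → ℕ → Set
IsTsat n r t = IsMin (λ m → Σ (Graph n) λ G → TsatAdmissible r t G × edges G ≡ m)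

IsRSystem : ℕ → {v : ℕ} → Graph v → List (Subset v) → Set
IsRSystem r H F =
  ¬ HasClique (adj H) r ×
  (∀ S → S LM.∈ F →
     ¬ CliqueIn (adj H) S (r ∸ 1) ×
     (∀ x → x ∉ S → CliqueIn (adj H) (S ∪ ⁅ x ⁆) (r ∸ 1))) ×
  (∀ S T → S LM.∈ F → T LM.∈ F → S ≢ T → CliqueIn (adj H) (S ∩ T) (r ∸ 2))

IsMaximalRSystem : ℕ → {v : ℕ} → Graph v → List (Subset v) → Set
IsMaximalRSystem r H F =
  IsRSystem r H F ×
  (∀ u w → u ≢ w → adj H u w ≡ false →
     HasClique (addEdge (adj H) u w) r ⊎
     (∃ λ S → S LM.∈ F × CliqueIn (addEdge (adj H) u w) S (r ∸ 1)))

IsMaximalRTSystem : ℕ → ℕ → {v : ℕ} → Graph v → List (Subset v) → Set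
IsMaximalRTSystem r t H F =
  IsMaximalRSystem r H F × Unique F × All (λ S → ∣ S ∣ ≡ t) F

IsE' : ℕ → ℕ → ℕ → ℕ → Set
IsE' r t s = IsMin (λ m → Σ ℕ λ v → Σ (Graph v) λ H → Σ (List (Subset v)) λ F →
  IsMaximalRTSystem r t H F × length F ≡ s × edges H ≡ m)

IsNPlusLittleO : (ℕ → ℕ) → Set
IsNPlusLittleO a = ∀ k → 1 ≤ k → ∃ λ N → ∀ n → N ≤ n → k * ∣ a n - n ∣ ≤ n

{-# OPTIONS --safe #-}
module Submission where

-- Joining a new vertex to each set of a maximal (r,t)-system gives a K_r-saturated graph in which the
-- new vertices are independent and have degree t; conversely, deleting an independent set of degree-t
-- vertices with distinct neighbourhoods from a K_r-saturated graph leaves a maximal (r,t)-system.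
--
-- Upper bound: deleting a vertex of bounded degree leaves only boundedly many pairs unsaturated, so from
-- an optimal system one can remove core vertices violating the degree or twin condition, and then sets,
-- until exactly n vertices remain, at a cost of O(1) edges each; the core has at most t + 2e vertices.
--
-- Lower bound: in an admissible graph, all vertices but O(e(G) - tn) have degree t and all their
-- neighbours in the set of vertices of large degree, and these form the independent set.  The vertices
-- that could spoil the count are boundedly many by a skew version of Bollobás's two families theorem.
--
-- An explicit system built from crowns shows that e'(s) = o(s), which makes all errors o(n).

open import Defs hiding (sym; irr)
open import Data.Nat using (ℕ; zero; suc; _+_; _*_; _∸_; _^_; _≤_; _<_; z≤n; s≤s; s≤s⁻¹; _≤?_; _<?_; ∣_-_∣; >-nonZero)
import Data.Nat.Properties as ℕ
open import Data.Nat.Properties using (≤-trans; ≤-reflexive; ≤-refl; +-mono-≤; m≤m+n; *-monoʳ-≤; +-identityʳ; m≤n+m; +-monoʳ-≤; *-monoˡ-≤; +-monoˡ-≤; <⇒≤; ≰⇒>; ≮⇒≥; n≤1+n; +-suc; *-identityʳ; *-mono-≤; <⇒≱)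
open import Data.Nat.DivMod using (_/_; _%_; m≡m%n+[m/n]*n; m%n<n)
open import Data.Nat.ListAction using (sum)
open import Data.Nat.Tactic.RingSolver using (solve-∀)
open import Data.Bool using (Bool; true; false; not; _∧_; _∨_)
import Data.Bool.Properties as 𝔹
open import Data.Fin using (Fin; zero; suc; toℕ; fromℕ<; combine)
import Data.Fin as Fin
import Data.Fin.Properties as Fin
open import Data.Fin.Subset using (Subset; _∈_; _∉_; _∪_; _∩_; ⁅_⁆; ∣_∣)
import Data.Fin.Subset.Properties as Sub
import Data.Vec as Vec
import Data.Vec.Properties as Vec
open import Data.List using (List; []; _∷_; _++_; length; map; filter; lookup; allFin; concatMap; cartesianProduct)
import Data.List as List
import Data.List.Properties as List
open import Data.List.Membership.Propositional using (find; lose) renaming (_∈_ to _∈ₗ_)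
import Data.List.Membership.Propositional.Properties as Mem
import Data.List.Membership.DecPropositional as DecMem
open import Data.List.Relation.Unary.All using (All; []; _∷_)
import Data.List.Relation.Unary.All as All
import Data.List.Relation.Unary.All.Properties as All
open import Data.List.Relation.Unary.Any using (Any; here; there)
import Data.List.Relation.Unary.Any as Any
import Data.List.Relation.Unary.Any.Properties as Any
open import Data.List.Relation.Unary.AllPairs using (AllPairs; []; _∷_)
import Data.List.Relation.Unary.AllPairs as AllPairs
import Data.List.Relation.Unary.AllPairs.Properties as AllPairs
open import Data.List.Relation.Unary.Unique.Propositional using (Unique)
import Data.List.Relation.Unary.Unique.Propositional.Properties as Uniq
open import Data.Product using (Σ; ∃; _×_; _,_; proj₁; proj₂; map₁; map₂)
import Data.Product.Properties as ×
open import Data.Sum using (_⊎_; inj₁; inj₂; [_,_]′)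
import Data.Sum as Sum
import Data.Sum.Properties as Sum
open import Data.Empty using (⊥; ⊥-elim)
open import Data.Unit using (⊤; tt)
open import Data.Maybe using (Maybe; just; nothing)
import Data.Maybe.Properties as Maybe
open import Function using (_∘_; id; case_of_)
open import Relation.Nullary using (¬_; Dec; yes; no; contradiction; ¬?; _×-dec_; _⊎-dec_; _→-dec_)
open import Relation.Nullary.Decidable using (⌊_⌋; decidable-stable)
import Relation.Nullary.Decidable as Dec
open import Relation.Binary using (DecidableEquality)
open import Relation.Binary.PropositionalEquality using (_≡_; _≢_; refl; sym; trans; cong; cong₂; subst; subst₂; module ≡-Reasoning)

-- Two obstacles shape the argument. The lower bound speaks of e′ at a(n) = n - h, where h is the
-- number of vertices outside the independent set, and nothing in it alone makes h small. It gives h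
-- = O(m - tn) for the minimum m, and only the upper bound for m turns this into O(e′(b(n))), which
-- is o(n). Degrees are unbounded, so edges between a vertex of large degree and one of small degree
-- are charged entirely to the small end. A vertex of small degree with at least t large neighbours
-- then receives at least 2t, with equality only in the independent set. Where such charging fails,
-- saturation on the one hand and the absence of K_r on the other produce cross-intersecting
-- families of cliques, so that there are only boundedly many failures. In the example for r = 3
-- every set has one vertex isolated in the core, two vertices for one index and three for a pair of
-- indices, so the least size is 6. Each cone raises r and t by one. This is the origin of the
-- condition t ≥ r + 3.

variable
  V W : Set

-- Indicators and finite sums over lists

_≟ᵇ_ : (a b : Bool) → Dec (a ≡ b)
_≟ᵇ_ = 𝔹._≟_

𝟙 : Bool → ℕ
𝟙 false = 0
𝟙 true  = 1

𝟙≤1 : ∀ b → 𝟙 b ≤ 1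
𝟙≤1 false = z≤n
𝟙≤1 true  = s≤s z≤n

𝟙-∨ : ∀ a b → 𝟙 (a ∨ b) ≤ 𝟙 a + 𝟙 b
𝟙-∨ true  b = s≤s z≤n
𝟙-∨ false b = ≤-refl

⌊⌋-true : {P : Set} {P? : Dec P} → ⌊ P? ⌋ ≡ true → P
⌊⌋-true {P? = yes p} _ = p

⌊⌋-false : {P : Set} {P? : Dec P} → ⌊ P? ⌋ ≡ false → ¬ P
⌊⌋-false {P? = no ¬p} _ = ¬p

true-⌊⌋ : {P : Set} {P? : Dec P} → P → ⌊ P? ⌋ ≡ true
true-⌊⌋ {P? = yes _} _ = refl
true-⌊⌋ {P? = no ¬p} p = contradiction p ¬p

∧-true : ∀ {a b} → a ∧ b ≡ true → a ≡ true × b ≡ true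
∧-true {true} {true} _ = refl , refl

∑ : List V → (V → ℕ) → ℕ
∑ []       f = 0
∑ (x ∷ xs) f = f x + ∑ xs f

∑-cong : {f g : V → ℕ} (xs : List V) → (∀ x → x ∈ₗ xs → f x ≡ g x) → ∑ xs f ≡ ∑ xs g
∑-cong []       eq = refl
∑-cong (x ∷ xs) eq = cong₂ _+_ (eq x (here refl)) (∑-cong xs (λ y y∈ → eq y (there y∈)))

∑-mono : {f g : V → ℕ} (xs : List V) → (∀ x → x ∈ₗ xs → f x ≤ g x) → ∑ xs f ≤ ∑ xs g
∑-mono []       le = z≤n
∑-mono (x ∷ xs) le = +-mono-≤ (le x (here refl)) (∑-mono xs (λ y y∈ → le y (there y∈)))

+-interchange : ∀ a b c d → (a + b) + (c + d) ≡ (a + c) + (b + d)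
+-interchange = solve-∀

∑-+ : (f g : V → ℕ) (xs : List V) → ∑ xs (λ x → f x + g x) ≡ ∑ xs f + ∑ xs g
∑-+ f g []       = refl
∑-+ f g (x ∷ xs) rewrite ∑-+ f g xs = +-interchange (f x) (g x) (∑ xs f) (∑ xs g)

∑-* : (k : ℕ) (f : V → ℕ) (xs : List V) → ∑ xs (λ x → k * f x) ≡ k * ∑ xs f
∑-* k f []       = sym (ℕ.*-zeroʳ k)
∑-* k f (x ∷ xs) rewrite ∑-* k f xs = sym (ℕ.*-distribˡ-+ k (f x) (∑ xs f))

∑-const : (k : ℕ) (xs : List V) → ∑ xs (λ _ → k) ≡ length xs * k
∑-const k []       = refl
∑-const k (x ∷ xs) = cong (k +_) (∑-const k xs)

∑-bound : {f : V → ℕ} {k : ℕ} (xs : List V) → (∀ x → x ∈ₗ xs → f x ≤ k) → ∑ xs f ≤ length xs * k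
∑-bound {k = k} xs le = ≤-trans (∑-mono xs le) (≤-reflexive (∑-const k xs))

∑-zero : (xs : List V) → ∑ xs (λ _ → 0) ≡ 0
∑-zero xs = trans (∑-const 0 xs) (ℕ.*-zeroʳ (length xs))

∑-swap : (f : V → W → ℕ) (xs : List V) (ys : List W) →
  ∑ xs (λ x → ∑ ys (f x)) ≡ ∑ ys (λ y → ∑ xs (λ x → f x y))
∑-swap f []       ys = sym (∑-zero ys)
∑-swap f (x ∷ xs) ys rewrite ∑-swap f xs ys = sym (∑-+ (f x) (λ y → ∑ xs (λ x′ → f x′ y)) ys)

∑-++ : (f : V → ℕ) (xs ys : List V) → ∑ (xs ++ ys) f ≡ ∑ xs f + ∑ ys f
∑-++ f []       ys = refl
∑-++ f (x ∷ xs) ys rewrite ∑-++ f xs ys = sym (ℕ.+-assoc (f x) _ _)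

∑-map : (f : W → ℕ) (g : V → W) (xs : List V) → ∑ (map g xs) f ≡ ∑ xs (f ∘ g)
∑-map f g []       = refl
∑-map f g (x ∷ xs) = cong (f (g x) +_) (∑-map f g xs)

∑-∈ : (f : V → ℕ) {x : V} {xs : List V} → x ∈ₗ xs → f x ≤ ∑ xs f
∑-∈ f (here refl)            = m≤m+n _ _
∑-∈ f (there {x = y} x∈) = ≤-trans (∑-∈ f x∈) (m≤n+m _ (f y))

sel : (V → Bool) → List V → List V
sel p = filter (λ x → p x ≟ᵇ true)

∈-sel⁺ : {p : V → Bool} {x : V} {xs : List V} → x ∈ₗ xs → p x ≡ true → x ∈ₗ sel p xs
∈-sel⁺ {p = p} = Mem.∈-filter⁺ (λ x → p x ≟ᵇ true)

∈-sel⁻ : {p : V → Bool} {x : V} {xs : List V} → x ∈ₗ sel p xs → x ∈ₗ xs × p x ≡ true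
∈-sel⁻ {p = p} = Mem.∈-filter⁻ (λ x → p x ≟ᵇ true)

sel-unique : (p : V → Bool) {xs : List V} → Unique xs → Unique (sel p xs)
sel-unique p = Uniq.filter⁺ (λ x → p x ≟ᵇ true)

∑-sel : (p : V → Bool) (f : V → ℕ) (xs : List V) → ∑ (sel p xs) f ≡ ∑ xs (λ x → 𝟙 (p x) * f x)
∑-sel p f []       = refl
∑-sel p f (x ∷ xs) with p x
... | true  = cong₂ _+_ (sym (+-identityʳ (f x))) (∑-sel p f xs)
... | false = ∑-sel p f xs

length-sel : (p : V → Bool) (xs : List V) → length (sel p xs) ≡ ∑ xs (𝟙 ∘ p)
length-sel p []       = refl
length-sel p (x ∷ xs) with p x
... | true  = cong suc (length-sel p xs)
... | false = length-sel p xs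

length-sel-not : (p : V → Bool) (xs : List V) →
  length (sel p xs) + length (sel (not ∘ p) xs) ≡ length xs
length-sel-not p []       = refl
length-sel-not p (x ∷ xs) with p x
... | true  = cong suc (length-sel-not p xs)
... | false = trans (+-suc _ _) (cong suc (length-sel-not p xs))

count≡0⇒false : {p : V → Bool} {xs : List V} → ∑ xs (𝟙 ∘ p) ≡ 0 → ∀ x → x ∈ₗ xs → p x ≡ false
count≡0⇒false {p = p} {xs} eq x x∈ with p x in px
... | false = refl
... | true  = contradiction (≤-trans (≤-reflexive (cong 𝟙 (sym px))) (≤-trans (∑-∈ (𝟙 ∘ p) x∈) (≤-reflexive eq))) λ ()

count>0⇒∃ : (p : V → Bool) (xs : List V) → 1 ≤ ∑ xs (𝟙 ∘ p) → ∃ λ x → x ∈ₗ xs × p x ≡ true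
count>0⇒∃ p (x ∷ xs) pos with p x in px
... | true  = x , here refl , px
... | false = let y , y∈ , py = count>0⇒∃ p xs pos in y , there y∈ , py

length-∑ : (xs : List V) → length xs ≡ ∑ xs (λ _ → 1)
length-∑ xs = sym (trans (∑-const 1 xs) (*-identityʳ _))

module _ (_≟_ : DecidableEquality V) where

  del : V → List V → List V
  del y = filter (λ x → ¬? (x ≟ y))

  ∈-del⁺ : ∀ {x y xs} → x ∈ₗ xs → x ≢ y → x ∈ₗ del y xs
  ∈-del⁺ {y = y} = Mem.∈-filter⁺ (λ x → ¬? (x ≟ y))

  ∈-del⁻ : ∀ {x y xs} → x ∈ₗ del y xs → x ∈ₗ xs × x ≢ y
  ∈-del⁻ {y = y} = Mem.∈-filter⁻ (λ x → ¬? (x ≟ y))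

  del-unique : ∀ y {xs} → Unique xs → Unique (del y xs)
  del-unique y = Uniq.filter⁺ (λ x → ¬? (x ≟ y))

  del-∉ : ∀ y xs → ¬ (y ∈ₗ xs) → del y xs ≡ xs
  del-∉ y xs y∉ = List.filter-all (λ x → ¬? (x ≟ y)) (All.tabulate (λ x∈ x≡y → y∉ (subst (_∈ₗ xs) x≡y x∈)))

  ∑-del : (f : V → ℕ) {y : V} {xs : List V} → Unique xs → y ∈ₗ xs → ∑ xs f ≡ f y + ∑ (del y xs) f
  ∑-del f {y} {x ∷ xs} (x∉ ∷ u) y∈ with x ≟ y
  ∑-del f {y} {x ∷ xs} (x∉ ∷ u) y∈ | yes refl =
    cong (λ zs → f x + ∑ zs f) (sym (del-∉ x xs (λ x∈ → All.lookup x∉ x∈ refl)))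
  ∑-del f {y} {x ∷ xs} (x∉ ∷ u) (here y≡x) | no x≢y = contradiction (sym y≡x) x≢y
  ∑-del f {y} {x ∷ xs} (x∉ ∷ u) (there y∈) | no x≢y rewrite ∑-del f u y∈ = lem (f x) (f y) _
    where
    lem : ∀ a b c → a + (b + c) ≡ b + (a + c)
    lem = solve-∀

  length-del : {y : V} {xs : List V} → Unique xs → y ∈ₗ xs → length xs ≡ suc (length (del y xs))
  length-del {y} {xs} u y∈ =
    trans (length-∑ xs) (trans (∑-del (λ _ → 1) u y∈) (cong suc (sym (length-∑ (del y xs)))))

  ∑-δ : (u : V) (f : V → ℕ) {xs : List V} → Unique xs → ∑ xs (λ x → 𝟙 ⌊ x ≟ u ⌋ * f x) ≤ f u
  ∑-δ u f {[]}     []       = z≤n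
  ∑-δ u f {x ∷ xs} (x∉ ∷ q) with x ≟ u
  ... | no  _    = ∑-δ u f q
  ... | yes refl = ≤-reflexive (trans (cong (f x + 0 +_) (trans (∑-cong xs vanish) (∑-zero xs))) (trans (+-identityʳ _) (+-identityʳ _)))
    where
    vanish : ∀ y → y ∈ₗ xs → 𝟙 ⌊ y ≟ x ⌋ * f y ≡ 0
    vanish y y∈ with y ≟ x
    ... | yes refl = contradiction refl (All.lookup x∉ y∈)
    ... | no _     = refl

-- Cliques

-- A clique chosen vertex by vertex, the predicate shrinking to the neighbourhood of each choice.
-- For irreflexive `A` the vertices are automatically distinct, and cliques can be restricted or
-- transported by induction on their size.
K : (V → V → Bool) → (V → Set) → ℕ → Set
K A P zero    = ⊤
K A P (suc k) = ∃ λ x → P x × K A (λ y → P y × A x y ≡ true) k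

Sym : (V → V → Bool) → Set
Sym A = ∀ x y → A x y ≡ A y x

Irr : (V → V → Bool) → Set
Irr A = ∀ x → A x x ≡ false

true≢false : {b : Bool} → b ≡ true → b ≡ false → ⊥
true≢false refl ()

K-mono : {A : V → V → Bool} {P Q : V → Set} (k : ℕ) → (∀ x → P x → Q x) → K A P k → K A Q k
K-mono zero    P⊆Q _            = tt
K-mono (suc k) P⊆Q (x , px , h) = x , P⊆Q x px , K-mono k (λ y → map₁ (P⊆Q y)) h

K-monoA : {A B : V → V → Bool} {P : V → Set} (k : ℕ) → (∀ x y → A x y ≡ true → B x y ≡ true) →
  K A P k → K B P k
K-monoA zero    A⊆B _            = tt
K-monoA (suc k) A⊆B (x , px , h) = x , px , K-mono k (λ y → map₂ (A⊆B x y)) (K-monoA k A⊆B h)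

K-image : {A : V → V → Bool} {B : W → W → Bool} {P : V → Set} {Q : W → Set} (e : V → W) →
  (∀ x y → A x y ≡ true → B (e x) (e y) ≡ true) → (k : ℕ) → (∀ x → P x → Q (e x)) → K A P k → K B Q k
K-image e h zero    P⊆Q _            = tt
K-image e h (suc k) P⊆Q (x , px , c) =
  e x , P⊆Q x px , K-image e h k (λ y (py , axy) → P⊆Q y py , h x y axy) c

K-preimage : {B : W → W → Bool} {Q : W → Set} (e : V → W) (k : ℕ) → (∀ y → Q y → ∃ λ x → e x ≡ y) →
  K B Q k → K (λ x y → B (e x) (e y)) (Q ∘ e) k
K-preimage e zero    onto _            = tt
K-preimage {B = B} {Q} e (suc k) onto (y , qy , c) with onto y qy
... | x , refl = x , qy , K-preimage e k (λ z → onto z ∘ proj₁) c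

-- With k = r - 2 and `u`, `v` non-adjacent, this is what it means in a K_r-free graph that adding
-- the edge between them creates a K_r.
Common : (V → V → Bool) → (V → Set) → ℕ → V → V → Set
Common A P k u v = K A (λ z → P z × A u z ≡ true × A v z ≡ true) k

Common-sym : {A : V → V → Bool} {P : V → Set} {u v : V} (k : ℕ) → Common A P k u v → Common A P k v u
Common-sym k = K-mono k (λ z (p , a , b) → p , b , a)

Common⇒K : {A : V → V → Bool} → Sym A → Irr A → {P : V → Set} {u v : V} → P u → P v → A u v ≡ true →
  (k : ℕ) → Common A P k u v → K A P (2 + k)
Common⇒K sA iA {u = u} {v} pu pv auv k h =
  u , pu , v , (pv , auv) , K-mono k (λ z (p , a , b) → (p , a) , b) h

-- The trace in `A` of a k-clique that contains an added edge between `u` and `v`.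
UsesBoth : (V → V → Bool) → V → V → (V → Set) → ℕ → Set
UsesBoth A u v P k = P u × P v × ∃ λ j → k ≡ 2 + j × Common A P j u v

module _ (_≟_ : DecidableEquality V) where

  K-split : {A : V → V → Bool} → Sym A → Irr A → {P : V → Set} (y : V) (k : ℕ) → K A P (suc k) →
    K A (λ x → P x × x ≢ y) (suc k) ⊎ (P y × K A (λ x → P x × A y x ≡ true) k)
  K-split {A} sA iA {P} y k (x , px , h) with x ≟ y
  ... | yes refl = inj₂ (px , h)
  K-split sA iA y zero    (x , px , h) | no x≢y = inj₁ (x , (px , x≢y) , tt)
  K-split {A} sA iA {P} y (suc k) (x , px , h) | no x≢y with K-split sA iA y k h
  ... | inj₁ h′ = inj₁ (x , (px , x≢y) , K-mono (suc k) (λ z ((pz , a) , z≢y) → (pz , z≢y) , a) h′)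
  ... | inj₂ ((py , axy) , h′) =
    inj₂ (py , x , (px , trans (sA y x) axy) , K-mono k (λ z ((pz , a) , b) → (pz , b) , a) h′)

  K? : (A : V → V → Bool) {P : V → Set} (ws : List V) → (∀ x → P x → x ∈ₗ ws) → (∀ x → Dec (P x)) →
    (k : ℕ) → Dec (K A P k)
  K? A ws P⊆ws P? zero    = yes tt
  K? A {P} ws P⊆ws P? (suc k) =
    Dec.map′ (λ a → let x , _ , h = find a in x , h)
             (λ (x , px , h) → lose (P⊆ws x px) (px , h))
             (Any.any? (λ x → P? x ×-dec K? A ws (λ y → P⊆ws y ∘ proj₁) (λ y → P? y ×-dec (A x y ≟ᵇ true)) k) ws)

  -- At `Fin n` this unfolds to `addEdge`, so the lemmas about it apply directly to saturation as it
  -- is defined there.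
  addE : (V → V → Bool) → V → V → V → V → Bool
  addE A u v i j = A i j ∨ ((⌊ i ≟ u ⌋ ∧ ⌊ j ≟ v ⌋) ∨ (⌊ i ≟ v ⌋ ∧ ⌊ j ≟ u ⌋))

  addE-⊇ : ∀ A u v x y → A x y ≡ true → addE A u v x y ≡ true
  addE-⊇ A u v x y eq rewrite eq = refl

  addE-new : ∀ A u v → addE A u v u v ≡ true
  addE-new A u v with u ≟ u | v ≟ v
  ... | yes _ | yes _ = 𝔹.∨-zeroʳ (A u v)
  ... | no ¬p | _     = contradiction refl ¬p
  ... | yes _ | no ¬p = contradiction refl ¬p

  addE-case : ∀ A u v x y → addE A u v x y ≡ true →
    A x y ≡ true ⊎ (x ≡ u × y ≡ v) ⊎ (x ≡ v × y ≡ u)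
  addE-case A u v x y eq with A x y
  ... | true  = inj₁ refl
  ... | false with x ≟ u | y ≟ v | x ≟ v | y ≟ u
  ...   | yes p | yes q | _     | _     = inj₂ (inj₁ (p , q))
  ...   | yes _ | no _  | yes p | yes q = inj₂ (inj₂ (p , q))
  ...   | no _  | yes _ | yes p | yes q = inj₂ (inj₂ (p , q))
  ...   | no _  | no _  | yes p | yes q = inj₂ (inj₂ (p , q))
  addE-case A u v x y () | false | yes _ | no _  | yes _ | no _
  addE-case A u v x y () | false | yes _ | no _  | no _  | _
  addE-case A u v x y () | false | no _  | _     | yes _ | no _
  addE-case A u v x y () | false | no _  | _     | no _  | _

  addE-sym : ∀ {A} → Sym A → ∀ u v → Sym (addE A u v)
  addE-sym {A} sA u v x y rewrite sA x y with ⌊ x ≟ u ⌋ | ⌊ y ≟ v ⌋ | ⌊ x ≟ v ⌋ | ⌊ y ≟ u ⌋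
  ... | a | b | c | d = cong (A y x ∨_) (trans (𝔹.∨-comm (a ∧ b) (c ∧ d)) (cong₂ _∨_ (𝔹.∧-comm c d) (𝔹.∧-comm a b)))

  addE-irr : ∀ {A} → Irr A → ∀ {u v} → u ≢ v → Irr (addE A u v)
  addE-irr {A} iA {u} {v} u≢v x with addE A u v x x in eq
  ... | false = refl
  ... | true with addE-case A u v x x eq
  ...   | inj₁ a               = contradiction (iA x) (true≢false a)
  ...   | inj₂ (inj₁ (p , q)) = contradiction (trans (sym p) q) u≢v
  ...   | inj₂ (inj₂ (p , q)) = contradiction (trans (sym q) p) u≢v

  Common⇒K-addE : ∀ {A} → Sym A → Irr A → {P : V → Set} {u v : V} → P u → P v →
    (k : ℕ) → Common A P k u v → K (addE A u v) P (2 + k)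
  Common⇒K-addE {A} sA iA {P} {u} {v} pu pv k h =
    u , pu , v , (pv , addE-new A u v) ,
    K-mono k (λ z (p , a , b) → (p , addE-⊇ A u v u z a) , addE-⊇ A u v v z b) (K-monoA k (addE-⊇ A u v) h)

  addE-old : ∀ A u v x z → ¬ (x ≡ u × z ≡ v) → ¬ (x ≡ v × z ≡ u) → addE A u v x z ≡ true → A x z ≡ true
  addE-old A u v x z ¬p ¬q e with addE-case A u v x z e
  ... | inj₁ a        = a
  ... | inj₂ (inj₁ p) = contradiction p ¬p
  ... | inj₂ (inj₂ q) = contradiction q ¬q

  private
    -- The clique without its first vertex `x` already lies in `A`, so a new edge can occur only at
    -- `x`. If `x` is one end of it, the question is whether the rest contains the other end.
    K-addE-first : ∀ {A} → Sym A → Irr A → ∀ {u v} → u ≢ v → {P : V → Set} (k : ℕ) (x : V) →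
      Dec (x ≡ u) → Dec (x ≡ v) → P x →
      K A (λ y → P y × addE A u v x y ≡ true) k → K A P (suc k) ⊎ UsesBoth A u v P (suc k)
    K-addE-first sA iA u≢v zero x _ _ px c = inj₁ (x , px , tt)
    K-addE-first sA iA u≢v (suc k) x (yes refl) (yes refl) px c = contradiction refl u≢v
    K-addE-first {A} sA iA {u} {v} u≢v (suc k) x (no nu) (no nv) px c =
      inj₁ (x , px , K-mono (suc k) (λ z → map₂ (addE-old A u v x z (nu ∘ proj₁) (nv ∘ proj₁))) c)
    K-addE-first {A} sA iA {u} {v} u≢v (suc k) x (yes refl) (no nv) px c with K-split sA iA v k c
    ... | inj₁ c′ = inj₁ (x , px ,
            K-mono (suc k) (λ z ((pz , e) , z≢v) → pz , addE-old A u v x z (z≢v ∘ proj₂) (nv ∘ proj₁) e) c′)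
    ... | inj₂ ((pv , _) , c′) = inj₂ (px , pv , k , refl , K-mono k (λ z ((pz , e) , a) →
            pz , addE-old A u v x z (λ (_ , q) → true≢false (subst (λ y → A v y ≡ true) q a) (iA v)) (nv ∘ proj₁) e , a) c′)
    K-addE-first {A} sA iA {u} {v} u≢v (suc k) x (no nu) (yes refl) px c with K-split sA iA u k c
    ... | inj₁ c′ = inj₁ (x , px ,
            K-mono (suc k) (λ z ((pz , e) , z≢u) → pz , addE-old A u v x z (nu ∘ proj₁) (z≢u ∘ proj₂) e) c′)
    ... | inj₂ ((pu , _) , c′) = inj₂ (pu , px , k , refl , K-mono k (λ z ((pz , e) , a) →
            pz , a , addE-old A u v x z (nu ∘ proj₁) (λ (_ , q) → true≢false (subst (λ y → A u y ≡ true) q a) (iA u)) e) c′)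

  K-addE : ∀ {A} → Sym A → Irr A → ∀ {u v} → u ≢ v → {P : V → Set} (k : ℕ) → K (addE A u v) P k →
    K A P k ⊎ UsesBoth A u v P k
  K-addE sA iA u≢v zero _ = inj₁ tt
  K-addE {A} sA iA {u} {v} u≢v {P} (suc k) (x , px , h) with K-addE sA iA u≢v k h
  ... | inj₁ c = K-addE-first sA iA u≢v k x (x ≟ u) (x ≟ v) px c
  ... | inj₂ ((pu , xu) , (pv , xv) , j , refl , c) =
    -- The vertex `x` is joined to both ends of the new edge. As `addE` has no loops, it differs
    -- from both, and all its edges are old.
    inj₂ (pu , pv , suc j , refl , x , (px , trans (sA u x) (old xu) , trans (sA v x) (old xv)) ,
          K-mono j (λ z ((pz , xz) , uz , vz) → (pz , uz , vz) , old xz) c)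
    where
    loop : ∀ {y} → addE A u v x y ≡ true → x ≢ y
    loop e refl = true≢false e (addE-irr {A} iA u≢v x)
    old : ∀ {z} → addE A u v x z ≡ true → A x z ≡ true
    old {z} = addE-old A u v x z (loop xu ∘ proj₁) (loop xv ∘ proj₁)

-- Twice the number of edges of A on zs.
E : List V → (V → V → Bool) → ℕ
E zs A = ∑ zs (λ x → ∑ zs (λ y → 𝟙 (A x y)))

-- The outcome of repairing saturation inside `P`, at a cost controlled by a list `Ps` of pairs that
-- may have lost it. Since `change` confines new edges to `Ps`, rows of vertices outside `Ps` stay
-- intact. The factor 2 in `E≤` reflects that `E` counts ordered pairs.
record Resaturation (c : ℕ) (P : V → Set) (Ps : List (V × V)) (A : V → V → Bool) : Set where
  field
    A′     : V → V → Bool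
    sym′   : Sym A′
    irr′   : Irr A′
    noK′   : ¬ K A′ P (2 + c)
    sat′   : ∀ {x y} → P x → P y → x ≢ y → A′ x y ≡ false → Common A′ P c x y
    ⊇A     : ∀ x y → A x y ≡ true → A′ x y ≡ true
    change : ∀ x y → A′ x y ≡ A x y ⊎ (x , y) ∈ₗ Ps ⊎ (y , x) ∈ₗ Ps
    E≤     : ∀ {zs} → Unique zs → E zs A′ ≤ E zs A + 2 * length Ps

module _ (_≟_ : DecidableEquality V) where

  E-addE : ∀ A u v {zs} → Unique zs → E zs (addE _≟_ A u v) ≤ E zs A + 2
  E-addE A u v {zs} uq = begin
    E zs (addE _≟_ A u v)
      ≤⟨ ∑-mono zs (λ x _ → ∑-mono zs (λ y _ → 𝟙-addE (A x y) ⌊ x ≟ u ⌋ ⌊ y ≟ v ⌋ ⌊ x ≟ v ⌋ ⌊ y ≟ u ⌋)) ⟩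
    ∑ zs (λ x → ∑ zs (λ y → 𝟙 (A x y) + (𝟙 ⌊ x ≟ u ⌋ * 𝟙 ⌊ y ≟ v ⌋ + 𝟙 ⌊ x ≟ v ⌋ * 𝟙 ⌊ y ≟ u ⌋)))
      ≡⟨ ∑-cong zs (λ x _ → trans (∑-+ _ _ zs) (cong (∑ zs (λ y → 𝟙 (A x y)) +_) (∑-+ _ _ zs))) ⟩
    ∑ zs (λ x → ∑ zs (λ y → 𝟙 (A x y)) + (point u v x + point v u x))
      ≡⟨ trans (∑-+ _ _ zs) (cong (E zs A +_) (∑-+ _ _ zs)) ⟩
    E zs A + (∑ zs (point u v) + ∑ zs (point v u))
      ≤⟨ +-monoʳ-≤ (E zs A) (+-mono-≤ (point≤1 u v) (point≤1 v u)) ⟩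
    E zs A + 2 ∎
    where
    open ℕ.≤-Reasoning
    𝟙-∧ : ∀ a b → 𝟙 (a ∧ b) ≤ 𝟙 a * 𝟙 b
    𝟙-∧ true  b = ≤-reflexive (sym (+-identityʳ _))
    𝟙-∧ false b = z≤n
    𝟙-addE : ∀ a b c d e → 𝟙 (a ∨ ((b ∧ c) ∨ (d ∧ e))) ≤ 𝟙 a + (𝟙 b * 𝟙 c + 𝟙 d * 𝟙 e)
    𝟙-addE a b c d e = ≤-trans (𝟙-∨ a _) (+-monoʳ-≤ (𝟙 a)
      (≤-trans (𝟙-∨ (b ∧ c) _) (+-mono-≤ (𝟙-∧ b c) (𝟙-∧ d e))))
    point : V → V → V → ℕ
    point p q x = ∑ zs (λ y → 𝟙 ⌊ x ≟ p ⌋ * 𝟙 ⌊ y ≟ q ⌋)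
    row≤1 : ∀ q → ∑ zs (λ y → 𝟙 ⌊ y ≟ q ⌋) ≤ 1
    row≤1 q = ≤-trans (≤-reflexive (∑-cong zs (λ y _ → sym (*-identityʳ _)))) (∑-δ _≟_ q (λ _ → 1) uq)
    point≤1 : ∀ p q → ∑ zs (point p q) ≤ 1
    point≤1 p q = ≤-trans (≤-reflexive (∑-cong zs (λ x _ → ∑-* (𝟙 ⌊ x ≟ p ⌋) (λ y → 𝟙 ⌊ y ≟ q ⌋) zs)))
      (≤-trans (∑-δ _≟_ p (λ _ → ∑ zs (λ y → 𝟙 ⌊ y ≟ q ⌋)) uq) (row≤1 q))

  E-del : ∀ A {y zs} → Unique zs → y ∈ₗ zs → E (del _≟_ y zs) A ≤ E zs A
  E-del A {y} {zs} uq y∈ = begin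
    ∑ ds (λ x → ∑ ds (λ z → 𝟙 (A x z)))
      ≤⟨ ∑-mono ds (λ x _ → ≤-trans (m≤n+m _ _) (≤-reflexive (sym (∑-del _≟_ _ uq y∈)))) ⟩
    ∑ ds (λ x → ∑ zs (λ z → 𝟙 (A x z)))
      ≤⟨ m≤n+m _ _ ⟩
    _ ≡⟨ ∑-del _≟_ (λ x → ∑ zs (λ z → 𝟙 (A x z))) uq y∈ ⟨
    E zs A ∎
    where
    open ℕ.≤-Reasoning
    ds = del _≟_ y zs

  addE-change : ∀ A u v x y → addE _≟_ A u v x y ≡ A x y ⊎ (x ≡ u × y ≡ v) ⊎ (x ≡ v × y ≡ u)
  addE-change A u v x y with A x y in a
  ... | true  = inj₁ refl
  ... | false with addE-case _≟_ A u v x y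
  ...   | f with ⌊ x ≟ u ⌋ ∧ ⌊ y ≟ v ⌋ ∨ ⌊ x ≟ v ⌋ ∧ ⌊ y ≟ u ⌋
  ...     | false = inj₁ refl
  ...     | true with f (cong (_∨ true) a)
  ...       | inj₁ a′ = contradiction a (true≢false a′)
  ...       | inj₂ q  = inj₂ q

  common? : (c : ℕ) (A : V → V → Bool) {P : V → Set} (ws : List V) → (∀ x → P x → x ∈ₗ ws) → (∀ x → Dec (P x)) →
    ∀ x y → Dec (Common A P c x y)
  common? c A ws P⊆ws P? x y =
    K? _≟_ A ws (λ z → P⊆ws z ∘ proj₁) (λ z → P? z ×-dec (A x z ≟ᵇ true) ×-dec (A y z ≟ᵇ true)) c

  -- A pair of `Ps` is joined only if it is still a non-edge without a common K_c. No K_{c+2}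
  -- arises, because a new one would contain exactly such a K_c. Common cliques survive the addition
  -- of further edges, so one pass through the list is enough.
  resaturate : (c : ℕ) {P : V → Set} (ws : List V) → (∀ x → P x → x ∈ₗ ws) → (∀ x → Dec (P x)) →
    {A : V → V → Bool} → Sym A → Irr A → ¬ K A P (2 + c) → (Ps : List (V × V)) →
    (∀ {x y} → P x → P y → x ≢ y → A x y ≡ false → Common A P c x y ⊎ (x , y) ∈ₗ Ps ⊎ (y , x) ∈ₗ Ps) →
    Resaturation c P Ps A
  resaturate c ws P⊆ws P? {A} sA iA noK [] unsat = record
    { A′ = A ; sym′ = sA ; irr′ = iA ; noK′ = noK
    ; sat′ = λ px py x≢y a → [ id , [ (λ ()) , (λ ()) ]′ ]′ (unsat px py x≢y a)
    ; ⊇A = λ _ _ → id ; change = λ _ _ → inj₁ refl ; E≤ = λ _ → ≤-reflexive (sym (+-identityʳ _)) }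
  resaturate c {P} ws P⊆ws P? {A} sA iA noK ((u , v) ∷ Ps) unsat
    with (¬? (u ≟ v) ×-dec (A u v ≟ᵇ false) ×-dec P? u ×-dec P? v ×-dec ¬? (common? c A ws P⊆ws P? u v))
  ... | no settled = record
    { A′ = A′ ; sym′ = sym′ ; irr′ = irr′ ; noK′ = noK′ ; sat′ = sat′ ; ⊇A = ⊇A
    ; change = λ x y → Sum.map₂ (Sum.map there there) (change x y)
    ; E≤ = λ uq → ≤-trans (E≤ uq) (+-monoʳ-≤ _ (*-monoʳ-≤ 2 (n≤1+n _))) }
    where
    unsat′ : ∀ {x y} → P x → P y → x ≢ y → A x y ≡ false → Common A P c x y ⊎ (x , y) ∈ₗ Ps ⊎ (y , x) ∈ₗ Ps
    unsat′ {x} {y} px py x≢y a with unsat px py x≢y a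
    ... | inj₁ h                  = inj₁ h
    ... | inj₂ (inj₁ (there p)) = inj₂ (inj₁ p)
    ... | inj₂ (inj₂ (there p)) = inj₂ (inj₂ p)
    ... | inj₂ (inj₁ (here refl)) = inj₁ (decidable-stable (common? c A ws P⊆ws P? x y) (λ ¬h → settled (x≢y , a , px , py , ¬h)))
    ... | inj₂ (inj₂ (here refl)) =
      inj₁ (Common-sym c (decidable-stable (common? c A ws P⊆ws P? y x)
        (λ ¬h → settled (x≢y ∘ sym , trans (sA y x) a , py , px , ¬h))))
    open Resaturation (resaturate c ws P⊆ws P? sA iA noK Ps unsat′)
  ... | yes (u≢v , auv , pu , pv , ¬h) = record
    { A′ = A′ ; sym′ = sym′ ; irr′ = irr′ ; noK′ = noK′ ; sat′ = sat′
    ; ⊇A = λ x y a → ⊇A x y (addE-⊇ _≟_ A u v x y a)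
    ; change = change′
    ; E≤ = λ {zs} uq → ≤-trans (E≤ uq) (≤-trans (+-monoˡ-≤ _ (E-addE A u v uq)) (≤-reflexive (arith (E zs A) (length Ps)))) }
    where
    arith : ∀ e l → e + 2 + 2 * l ≡ e + 2 * suc l
    arith = solve-∀
    A+ : V → V → Bool
    A+ = addE _≟_ A u v
    noK+ : ¬ K A+ P (2 + c)
    noK+ k with K-addE _≟_ sA iA u≢v (2 + c) k
    ... | inj₁ k′ = noK k′
    ... | inj₂ (_ , _ , _ , refl , h) = ¬h h
    unsat′ : ∀ {x y} → P x → P y → x ≢ y → A+ x y ≡ false → Common A+ P c x y ⊎ (x , y) ∈ₗ Ps ⊎ (y , x) ∈ₗ Ps
    unsat′ {x} {y} px py x≢y a+ with A x y in a
    ... | true  = contradiction a+ λ ()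
    ... | false with unsat px py x≢y a
    ... | inj₁ h = inj₁ (K-mono c (λ z (pz , p , q) → pz , addE-⊇ _≟_ A u v x z p , addE-⊇ _≟_ A u v y z q)
                           (K-monoA c (addE-⊇ _≟_ A u v) h))
    ... | inj₂ (inj₁ (there p)) = inj₂ (inj₁ p)
    ... | inj₂ (inj₂ (there p)) = inj₂ (inj₂ p)
    ... | inj₂ (inj₁ (here refl)) = contradiction (trans (cong (_∨ _) a) a+) (true≢false (addE-new _≟_ A u v))
    ... | inj₂ (inj₂ (here refl)) =
      contradiction (trans (cong (_∨ _) a) a+) (true≢false (trans (addE-sym _≟_ sA u v x y) (addE-new _≟_ A u v)))
    open Resaturation (resaturate c ws P⊆ws P? (addE-sym _≟_ sA u v) (addE-irr _≟_ {A} iA u≢v) noK+ Ps unsat′)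
    change′ : ∀ x y → A′ x y ≡ A x y ⊎ (x , y) ∈ₗ (u , v) ∷ Ps ⊎ (y , x) ∈ₗ (u , v) ∷ Ps
    change′ x y with change x y
    ... | inj₂ (inj₁ p) = inj₂ (inj₁ (there p))
    ... | inj₂ (inj₂ p) = inj₂ (inj₂ (there p))
    ... | inj₁ eq with addE-change A u v x y
    ...   | inj₁ eq′                   = inj₁ (trans eq eq′)
    ...   | inj₂ (inj₁ (refl , refl)) = inj₂ (inj₁ (here refl))
    ...   | inj₂ (inj₂ (refl , refl)) = inj₂ (inj₂ (here refl))

-- Split graphs

length-cartesianProduct : (xs : List V) (ys : List W) → length (cartesianProduct xs ys) ≡ length xs * length ys
length-cartesianProduct []       ys = refl
length-cartesianProduct (x ∷ xs) ys =
  trans (List.length-++ (map (x ,_) ys)) (cong₂ _+_ (List.length-map (x ,_) ys) (length-cartesianProduct xs ys))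

In : List V → List V → V → Set
In hs is x = x ∈ₗ hs ⊎ x ∈ₗ is

-- A K_{c+2}-saturated graph with vertex set hs ∪ is, in which `is` is an independent set of vertices
-- of degree t with pairwise distinct neighbourhoods.  Deleting `is` leaves a maximal (c+2,t)-system
-- whose family consists of these neighbourhoods, and every maximal (c+2,t)-system arises in this way.
record SplitGraph (c t : ℕ) (A : V → V → Bool) (hs is : List V) : Set where
  field
    symm  : Sym A
    irre  : Irr A
    uniqH : Unique hs
    uniqI : Unique is
    disj  : ∀ {x} → x ∈ₗ hs → x ∈ₗ is → ⊥
    noK   : ¬ K A (In hs is) (2 + c)
    sat   : ∀ {x y} → In hs is x → In hs is y → x ≢ y → A x y ≡ false → Common A (In hs is) c x y
    indep : ∀ {x y} → x ∈ₗ is → y ∈ₗ is → A x y ≡ false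
    degI  : ∀ {x} → x ∈ₗ is → ∑ hs (𝟙 ∘ A x) ≡ t
    dist  : ∀ {x y} → x ∈ₗ is → y ∈ₗ is → x ≢ y → ∃ λ h → h ∈ₗ hs × A x h ≢ A y h

module _ (_≟_ : DecidableEquality V) where

  _∈?_ : (x : V) (xs : List V) → Dec (x ∈ₗ xs)
  _∈?_ = DecMem._∈?_ _≟_

  open SplitGraph

  -- A core vertex may be dropped if it has no neighbour among the remaining independent vertices:
  -- then it does not help to tell two of their neighbourhoods apart. As `Ps` lies inside the core,
  -- resaturation leaves the rows of `is′` unchanged.
  shrink : ∀ {c t A hs is} → SplitGraph c t A hs is → ∀ {hs′ is′ Ps} → Unique hs′ → Unique is′ →
    (∀ {x} → x ∈ₗ hs′ → x ∈ₗ hs) → (∀ {x} → x ∈ₗ is′ → x ∈ₗ is) →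
    (∀ {h i} → h ∈ₗ hs → ¬ (h ∈ₗ hs′) → i ∈ₗ is′ → A i h ≡ false) →
    (∀ {i} → i ∈ₗ is′ → ∑ hs′ (𝟙 ∘ A i) ≡ ∑ hs (𝟙 ∘ A i)) →
    (∀ {x y} → (x , y) ∈ₗ Ps → x ∈ₗ hs × y ∈ₗ hs) →
    (R : Resaturation c (In hs′ is′) Ps A) → SplitGraph c t (Resaturation.A′ R) hs′ is′
  shrink {c} {t} {A} {hs} {is} S {hs′} {is′} {Ps} uh ui hs⊆ is⊆ lost degs Ps⊆ R = record
    { symm = sym′ ; irre = irr′ ; uniqH = uh ; uniqI = ui
    ; disj = λ h i → disj S (hs⊆ h) (is⊆ i)
    ; noK = noK′ ; sat = sat′
    ; indep = λ {x} {y} x∈ y∈ → trans (row x∈ y) (indep S (is⊆ x∈) (is⊆ y∈))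
    ; degI = λ {x} x∈ → trans (∑-cong hs′ (λ h _ → cong 𝟙 (row x∈ h))) (trans (degs x∈) (degI S (is⊆ x∈)))
    ; dist = dist′ }
    where
    open Resaturation R
    row : ∀ {i} → i ∈ₗ is′ → ∀ y → A′ i y ≡ A i y
    row {i} i∈ y with change i y
    ... | inj₁ eq        = eq
    ... | inj₂ (inj₁ p) = contradiction (is⊆ i∈) (disj S (proj₁ (Ps⊆ p)))
    ... | inj₂ (inj₂ p) = contradiction (is⊆ i∈) (disj S (proj₂ (Ps⊆ p)))
    dist′ : ∀ {x y} → x ∈ₗ is′ → y ∈ₗ is′ → x ≢ y → ∃ λ h → h ∈ₗ hs′ × A′ x h ≢ A′ y h
    dist′ {x} {y} x∈ y∈ x≢y with dist S (is⊆ x∈) (is⊆ y∈) x≢y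
    ... | h , h∈ , ne with h ∈? hs′
    ...   | yes h∈′ = h , h∈′ , λ eq → ne (trans (sym (row x∈ h)) (trans eq (row y∈ h)))
    ...   | no  h∉  = contradiction (trans (lost h∈ h∉ x∈) (sym (lost h∈ h∉ y∈))) ne

  record Deletion (c t q : ℕ) (A : V → V → Bool) (hs hs′ is′ : List V) (y : V) : Set where
    field
      B      : V → V → Bool
      split  : SplitGraph c t B hs′ is′
      ⊇A     : ∀ x z → A x z ≡ true → B x z ≡ true
      change : ∀ x z → B x z ≡ A x z ⊎ (A y x ≡ true × A y z ≡ true)
      E≤     : E hs′ B ≤ E hs A + 2 * (q * q)

  -- Only pairs inside the neighbourhood of a deleted vertex y can become unsaturated.
  deleteVertex : ∀ {ρ t q A hs is} → SplitGraph (suc ρ) t A hs is → ∀ {hs′ is′} y →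
    Unique hs′ → Unique is′ →
    (∀ {x} → x ∈ₗ hs′ → x ∈ₗ hs) → (∀ {x} → x ∈ₗ is′ → x ∈ₗ is) →
    (∀ {h i} → h ∈ₗ hs → ¬ (h ∈ₗ hs′) → i ∈ₗ is′ → A i h ≡ false) →
    (∀ {i} → i ∈ₗ is′ → ∑ hs′ (𝟙 ∘ A i) ≡ ∑ hs (𝟙 ∘ A i)) →
    (∀ {x} → In hs is x → x ≢ y → In hs′ is′ x) → (∀ {i} → i ∈ₗ is → A y i ≡ true → ⊥) →
    ∑ hs (𝟙 ∘ A y) ≤ q → (∀ {B} → E hs′ B ≤ E hs B) → Deletion (suc ρ) t q A hs hs′ is′ y
  deleteVertex {ρ} {t} {q} {A} {hs} {is} S {hs′} {is′} y uh ui hs⊆ is⊆ lost degs rest noI dy Emono = record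
    { B = A′
    ; split = shrink S uh ui hs⊆ is⊆ lost degs Ps⊆ R
    ; ⊇A = ⊇A
    ; change = λ x z → Sum.map₂ [ (λ p → nbr p) , (λ p → let a , b = nbr p in b , a) ]′ (change x z)
    ; E≤ = ≤-trans (Emono {A′}) (≤-trans (E≤ (uniqH S)) (+-monoʳ-≤ (E hs A) (*-monoʳ-≤ 2 lenPs))) }
    where
    ns = sel (A y) hs
    Ps = cartesianProduct ns ns
    lenNs : length ns ≤ q
    lenNs = ≤-trans (≤-reflexive (length-sel (A y) hs)) dy
    lenPs : length Ps ≤ q * q
    lenPs = ≤-trans (≤-reflexive (length-cartesianProduct ns ns)) (*-mono-≤ lenNs lenNs)
    mem : ∀ {x z} → (x , z) ∈ₗ Ps → (x ∈ₗ hs × A y x ≡ true) × (z ∈ₗ hs × A y z ≡ true)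
    mem p = let a , b = Mem.∈-cartesianProduct⁻ ns ns p in ∈-sel⁻ a , ∈-sel⁻ b
    nbr : ∀ {x z} → (x , z) ∈ₗ Ps → A y x ≡ true × A y z ≡ true
    nbr p = let (_ , a) , (_ , b) = mem p in a , b
    Ps⊆ : ∀ {x z} → (x , z) ∈ₗ Ps → x ∈ₗ hs × z ∈ₗ hs
    Ps⊆ p = let (a , _) , (b , _) = mem p in a , b
    up : ∀ {x} → In hs′ is′ x → In hs is x
    up = Sum.map hs⊆ is⊆
    hnbr : ∀ {x} → In hs is x → A y x ≡ true → x ∈ₗ ns
    hnbr (inj₁ x∈) a = ∈-sel⁺ x∈ a
    hnbr (inj₂ x∈) a = ⊥-elim (noI x∈ a)
    unsat : ∀ {x z} → In hs′ is′ x → In hs′ is′ z → x ≢ z → A x z ≡ false →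
      Common A (In hs′ is′) (suc ρ) x z ⊎ (x , z) ∈ₗ Ps ⊎ (z , x) ∈ₗ Ps
    unsat {x} {z} x∈ z∈ x≢z a with K-split _≟_ (symm S) (irre S) y ρ (sat S (up x∈) (up z∈) x≢z a)
    ... | inj₁ h = inj₁ (K-mono (suc ρ) (λ w ((w∈ , p) , w≢y) → rest w∈ w≢y , p) h)
    ... | inj₂ ((_ , xy , zy) , _) = inj₂ (inj₁ (Mem.∈-cartesianProduct⁺
            (hnbr (up x∈) (trans (symm S y x) xy)) (hnbr (up z∈) (trans (symm S y z) zy))))
    R = resaturate _≟_ (suc ρ) {In hs′ is′} (hs′ ++ is′)
          (λ x → [ Mem.∈-++⁺ˡ , Mem.∈-++⁺ʳ hs′ ]′) (λ x → (x ∈? hs′) ⊎-dec (x ∈? is′))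
          (symm S) (irre S) (noK S ∘ K-mono (3 + ρ) (λ _ → up)) Ps unsat
    open Resaturation R

  deleteI : ∀ {ρ t A hs is} → SplitGraph (suc ρ) t A hs is → ∀ {y} → y ∈ₗ is →
    Deletion (suc ρ) t t A hs hs (del _≟_ y is) y
  deleteI {is = is} S {y} y∈ = deleteVertex S y (uniqH S) (del-unique _≟_ y (uniqI S)) id (proj₁ ∘ ∈-del⁻ _≟_)
    (λ h∈ h∉ _ → contradiction h∈ h∉) (λ _ → refl)
    (λ p x≢y → Sum.map₂ (λ x∈ → ∈-del⁺ _≟_ x∈ x≢y) p) (λ i∈ a → true≢false a (indep S y∈ i∈))
    (≤-reflexive (degI S y∈)) ≤-refl

  degI-del : ∀ {c t A hs is} → SplitGraph c t A hs is → ∀ {y} → y ∈ₗ hs → (∀ {i} → i ∈ₗ is → A y i ≡ false) →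
    ∀ {i} → i ∈ₗ is → ∑ (del _≟_ y hs) (𝟙 ∘ A i) ≡ ∑ hs (𝟙 ∘ A i)
  degI-del {A = A} {hs} S {y} y∈ noI {i} i∈ = sym (trans (∑-del _≟_ (𝟙 ∘ A i) (uniqH S) y∈)
    (cong (λ b → 𝟙 b + ∑ (del _≟_ y hs) (𝟙 ∘ A i)) (trans (symm S i y) (noI i∈))))

  lost-del : ∀ {c t A hs is} → SplitGraph c t A hs is → ∀ {y} → (∀ {i} → i ∈ₗ is → A y i ≡ false) →
    ∀ {h i} → h ∈ₗ hs → ¬ (h ∈ₗ del _≟_ y hs) → i ∈ₗ is → A i h ≡ false
  lost-del S {y} noI {h} {i} h∈ h∉ i∈ with h ≟ y
  ... | yes refl = trans (symm S i y) (noI i∈)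
  ... | no  h≢y  = contradiction (∈-del⁺ _≟_ h∈ h≢y) h∉

  deleteH : ∀ {ρ t q A hs is} → SplitGraph (suc ρ) t A hs is → ∀ {y} → y ∈ₗ hs →
    (∀ {i} → i ∈ₗ is → A y i ≡ false) → ∑ hs (𝟙 ∘ A y) ≤ q →
    Deletion (suc ρ) t q A hs (del _≟_ y hs) is y
  deleteH {A = A} S {y} y∈ noI dy = deleteVertex S y (del-unique _≟_ y (uniqH S)) (uniqI S) (proj₁ ∘ ∈-del⁻ _≟_) id
    (lost-del S noI) (degI-del S y∈ noI) (λ p x≢y → Sum.map₁ (λ x∈ → ∈-del⁺ _≟_ x∈ x≢y) p)
    (λ i∈ a → true≢false a (noI i∈)) dy (λ {B} → E-del _≟_ B (uniqH S) y∈)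

  -- Saturation is not lost here, so no edge is added: a common clique through `y` is rerouted
  -- through the twin `y′`.
  deleteTwin : ∀ {ρ t A hs is} → SplitGraph (suc ρ) t A hs is → ∀ {y y′} → y ∈ₗ hs →
    (∀ {i} → i ∈ₗ is → A y i ≡ false) → In hs is y′ → y′ ≢ y → (∀ {w} → In hs is w → A y w ≡ A y′ w) →
    SplitGraph (suc ρ) t A (del _≟_ y hs) is
  deleteTwin {ρ} {t} {A} {hs} {is} S {y} {y′} y∈ noI y′∈ y′≢y twin = shrink S (del-unique _≟_ y (uniqH S)) (uniqI S)
    (proj₁ ∘ ∈-del⁻ _≟_) id (lost-del S noI) (degI-del S y∈ noI) (λ ()) R
    where
    up : ∀ {x} → In (del _≟_ y hs) is x → In hs is x
    up = Sum.map₁ (proj₁ ∘ ∈-del⁻ _≟_)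
    down : ∀ {x} → In hs is x → x ≢ y → In (del _≟_ y hs) is x
    down p x≢y = Sum.map₁ (λ x∈ → ∈-del⁺ _≟_ x∈ x≢y) p
    sat″ : ∀ {x z} → In (del _≟_ y hs) is x → In (del _≟_ y hs) is z → x ≢ z → A x z ≡ false →
      Common A (In (del _≟_ y hs) is) (suc ρ) x z
    sat″ {x} {z} x∈ z∈ x≢z a with K-split _≟_ (symm S) (irre S) y ρ (sat S (up x∈) (up z∈) x≢z a)
    ... | inj₁ h = K-mono (suc ρ) (λ w ((w∈ , p) , w≢y) → down w∈ w≢y , p) h
    ... | inj₂ ((_ , xy , zy) , h) = y′ , (down y′∈ y′≢y , to x x∈ xy , to z z∈ zy) ,
          K-mono ρ (λ w ((w∈ , p) , q) → (down w∈ (λ { refl → true≢false q (irre S y) }) , p) , trans (sym (twin w∈)) q) h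
      where
      to : ∀ x → In (del _≟_ y hs) is x → A x y ≡ true → A x y′ ≡ true
      to x x∈ e = trans (symm S x y′) (trans (sym (twin (up x∈))) (trans (symm S y x) e))
    R : Resaturation (suc ρ) (In (del _≟_ y hs) is) [] A
    R = record { A′ = A ; sym′ = symm S ; irr′ = irre S ; noK′ = noK S ∘ K-mono (3 + ρ) (λ _ → up) ; sat′ = sat″
               ; ⊇A = λ _ _ → id ; change = λ _ _ → inj₁ refl ; E≤ = λ _ → m≤m+n _ _ }

-- Cleaning and trimming

-- The price of removing a core vertex of total degree below t. Up to t independent neighbours are
-- deleted first, at 2t² each. Each of these deletions adds at most t to its core degree, which
-- therefore ends at no more than t + t², and its own deletion costs twice the square of this.
cleanCost : ℕ → ℕ
cleanCost t = t * (2 * (t * t)) + 2 * ((t + t * t) * (t + t * t))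

-- What admissibility asks of the core vertices. Twins with a neighbour in `is` are harmless, as
-- they share this neighbour and it has degree t; so only core vertices without such neighbours are
-- restricted.
record Clean (t : ℕ) (A : V → V → Bool) (hs is : List V) : Set where
  field
    degH   : ∀ {h} → h ∈ₗ hs → t ≤ ∑ hs (𝟙 ∘ A h) + ∑ is (𝟙 ∘ A h)
    noTwin : ∀ {h y} → h ∈ₗ hs → ∑ is (𝟙 ∘ A h) ≡ 0 → In hs is y → y ≢ h →
             ¬ (∀ {w} → In hs is w → A h w ≡ A y w)

module _ (_≟_ : DecidableEquality V) where

  open SplitGraph
  open Deletion

  open Clean

  record NbrsDeleted (c t d : ℕ) (A : V → V → Bool) (hs is : List V) (h : V) : Set where
    field
      B     : V → V → Bool
      js    : List V
      splitN : SplitGraph c t B hs js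
      noI   : ∀ {i} → i ∈ₗ js → B h i ≡ false
      len   : length is ≤ length js + d
      len≤  : length js ≤ length is
      degN  : ∑ hs (𝟙 ∘ B h) ≤ ∑ hs (𝟙 ∘ A h) + d * t
      EN    : E hs B ≤ E hs A + d * (2 * (t * t))

  deleteNbrs : ∀ {ρ t A hs is} d → SplitGraph (suc ρ) t A hs is → ∀ {h} → h ∈ₗ hs →
    ∑ is (𝟙 ∘ A h) ≡ d → NbrsDeleted (suc ρ) t d A hs is h
  deleteNbrs {A = A} {hs} {is} zero S {h} h∈ eq = record
    { B = A ; js = is ; splitN = S ; noI = λ i∈ → count≡0⇒false eq _ i∈
    ; len = m≤m+n _ _ ; len≤ = ≤-refl ; degN = m≤m+n _ _ ; EN = m≤m+n _ _ }
  deleteNbrs {ρ} {t} {A} {hs} {is} (suc d) S {h} h∈ eq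
    with count>0⇒∃ (A h) is (subst (1 ≤_) (sym eq) (s≤s z≤n))
  ... | i , i∈ , hi = record
    { B = N.B ; js = N.js ; splitN = N.splitN ; noI = N.noI
    ; len = subst₂ _≤_ (sym (length-del _≟_ (uniqI S) i∈)) (sym (+-suc _ d)) (s≤s N.len)
    ; len≤ = ≤-trans N.len≤ (≤-trans (n≤1+n _) (≤-reflexive (sym (length-del _≟_ (uniqI S) i∈))))
    ; degN = ≤-trans N.degN (≤-trans (+-monoˡ-≤ (d * t) deg+) (≤-reflexive (ℕ.+-assoc _ t (d * t))))
    ; EN = ≤-trans N.EN (≤-trans (+-monoˡ-≤ _ (E≤ D)) (≤-reflexive (ℕ.+-assoc (E hs A) _ _))) }
    where
    D = deleteI _≟_ S i∈
    row : ∀ j → j ∈ₗ del _≟_ i is → B D h j ≡ A h j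
    row j j∈ with change D h j
    ... | inj₁ e       = e
    ... | inj₂ (_ , a) = contradiction (indep S i∈ (proj₁ (∈-del⁻ _≟_ j∈))) (true≢false a)
    eq′ : ∑ (del _≟_ i is) (𝟙 ∘ B D h) ≡ d
    eq′ = trans (∑-cong _ (λ j j∈ → cong 𝟙 (row j j∈)))
      (ℕ.suc-injective (trans (cong (λ b → 𝟙 b + ∑ (del _≟_ i is) (𝟙 ∘ A h)) (sym hi))
        (trans (sym (∑-del _≟_ (𝟙 ∘ A h) (uniqI S) i∈)) eq)))
    entry : ∀ z → 𝟙 (B D h z) ≤ 𝟙 (A h z) + 𝟙 (A i z)
    entry z with change D h z
    ... | inj₁ e rewrite e       = m≤m+n _ _
    ... | inj₂ (_ , a) rewrite a = ≤-trans (𝟙≤1 (B D h z)) (m≤n+m 1 _)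
    deg+ : ∑ hs (𝟙 ∘ B D h) ≤ ∑ hs (𝟙 ∘ A h) + t
    deg+ = ≤-trans (∑-mono hs (λ z _ → entry z))
      (≤-reflexive (trans (∑-+ _ _ hs) (cong (∑ hs (𝟙 ∘ A h) +_) (degI S i∈))))
    module N = NbrsDeleted (deleteNbrs d (split D) h∈ eq′)

  record CleanedUp (c t : ℕ) (A : V → V → Bool) (hs is : List V) : Set where
    field
      B      : V → V → Bool
      hs′    : List V
      is′    : List V
      splitC : SplitGraph c t B hs′ is′
      clean  : Clean t B hs′ is′
      hs≤    : length hs′ ≤ length hs
      is≥    : length is ≤ length is′ + length hs * t
      is≤    : length is′ ≤ length is
      EC     : E hs′ B ≤ E hs A + length hs * cleanCost t

  -- Repeatedly delete a vertex of hs that has total degree below t (after deleting its fewer than t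
  -- neighbours in `is`), or that has no neighbour in `is` and has a twin.  Each round lowers length hs.
  cleanUp : ∀ {ρ t A hs is} l → length hs ≡ l → SplitGraph (suc ρ) t A hs is → CleanedUp (suc ρ) t A hs is
  cleanUp {ρ} {t} {A} {hs} {is} l len S = cases l len (Any.any? low? hs) (Any.any? twin? hs)
    where
    ws = hs ++ is
    Low Twin : V → Set
    Low h  = ∑ hs (𝟙 ∘ A h) + ∑ is (𝟙 ∘ A h) < t
    low? : ∀ h → Dec (Low h)
    low? h = _ <? t
    Twin h = ∑ is (𝟙 ∘ A h) ≡ 0 × Any (λ y → y ≢ h × All (λ w → A h w ≡ A y w) ws) ws
    twin? : ∀ h → Dec (Twin h)
    twin? h = (_ ℕ.≟ 0) ×-dec Any.any? (λ y → ¬? (y ≟ h) ×-dec All.all? (λ w → A h w ≟ᵇ A y w) ws) ws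
    ∈ws : ∀ {x} → In hs is x → x ∈ₗ ws
    ∈ws = [ Mem.∈-++⁺ˡ , Mem.∈-++⁺ʳ hs ]′
    smaller : ∀ {h m} → h ∈ₗ hs → length hs ≡ suc m → length (del _≟_ h hs) ≡ m
    smaller h∈ eq = ℕ.suc-injective (trans (sym (length-del _≟_ (uniqH S) h∈)) eq)
    nonempty : ∀ {h} → h ∈ₗ hs → length hs ≢ 0
    nonempty h∈ eq = contradiction (trans (sym eq) (length-del _≟_ (uniqH S) h∈)) λ ()
    hs-del : ∀ {h} → h ∈ₗ hs → length (del _≟_ h hs) ≤ length hs
    hs-del h∈ = ≤-trans (n≤1+n _) (≤-reflexive (sym (length-del _≟_ (uniqH S) h∈)))
    cases : ∀ l → length hs ≡ l → Dec (Any Low hs) → Dec (Any Twin hs) → CleanedUp (suc ρ) t A hs is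
    cases _ _ (no ¬low) (no ¬twin) = record
      { B = A ; hs′ = hs ; is′ = is ; splitC = S
      ; clean = record
        { degH = λ h∈ → ≮⇒≥ (λ lt → ¬low (lose h∈ lt))
        ; noTwin = λ {h} {y} h∈ z y∈ y≢h tw → ¬twin (lose h∈ (z , lose (∈ws y∈) (y≢h ,
            All.tabulate (λ w∈ → tw (Mem.∈-++⁻ hs w∈))))) }
      ; hs≤ = ≤-refl ; is≥ = m≤m+n _ _ ; is≤ = ≤-refl ; EC = m≤m+n _ _ }
    cases zero lenm (yes low) _ = contradiction lenm (nonempty (proj₁ (proj₂ (find low))))
    cases zero lenm (no _) (yes twin) = contradiction lenm (nonempty (proj₁ (proj₂ (find twin))))
    cases (suc m) lenm (yes low) _ with find low
    ... | h , h∈ , lt = record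
      { B = R.B ; hs′ = R.hs′ ; is′ = R.is′ ; splitC = R.splitC ; clean = R.clean
      ; hs≤ = ≤-trans R.hs≤ (hs-del h∈)
      ; is≤ = ≤-trans R.is≤ N.len≤
      ; is≥ = begin
          length is ≤⟨ N.len ⟩
          length N.js + d ≤⟨ +-mono-≤ R.is≥ d≤t ⟩
          length R.is′ + length hs₁ * t + t ≡⟨ arith₁ (length R.is′) (length hs₁) t ⟩
          length R.is′ + suc (length hs₁) * t ≡⟨ cong (λ k → length R.is′ + k * t) (sym len₁) ⟩
          length R.is′ + length hs * t ∎
      ; EC = begin
          E R.hs′ R.B ≤⟨ R.EC ⟩
          E hs₁ (B D) + length hs₁ * cleanCost t ≤⟨ +-monoˡ-≤ _ (E≤ D) ⟩
          E hs N.B + 2 * (T * T) + length hs₁ * cleanCost t ≤⟨ +-monoˡ-≤ _ (+-monoˡ-≤ _ N.EN) ⟩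
          E hs A + d * (2 * (t * t)) + 2 * (T * T) + length hs₁ * cleanCost t
            ≤⟨ +-monoˡ-≤ _ (+-monoˡ-≤ _ (+-monoʳ-≤ (E hs A) (*-monoˡ-≤ (2 * (t * t)) d≤t))) ⟩
          E hs A + t * (2 * (t * t)) + 2 * (T * T) + length hs₁ * cleanCost t
            ≡⟨ arith₂ (E hs A) (t * (2 * (t * t))) (2 * (T * T)) (length hs₁) ⟩
          E hs A + suc (length hs₁) * cleanCost t ≡⟨ cong (λ k → E hs A + k * cleanCost t) (sym len₁) ⟩
          E hs A + length hs * cleanCost t ∎ }
      where
      open ℕ.≤-Reasoning
      d = ∑ is (𝟙 ∘ A h)
      T = t + t * t
      hs₁ = del _≟_ h hs
      len₁ : length hs ≡ suc (length hs₁)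
      len₁ = length-del _≟_ (uniqH S) h∈
      d≤t : d ≤ t
      d≤t = ≤-trans (m≤n+m d _) (<⇒≤ lt)
      module N = NbrsDeleted (deleteNbrs d S h∈ refl)
      D = deleteH _≟_ {q = T} N.splitN h∈ N.noI
        (≤-trans N.degN (+-mono-≤ (≤-trans (m≤m+n _ d) (<⇒≤ lt)) (*-monoˡ-≤ t d≤t)))
      module R = CleanedUp (cleanUp m (smaller h∈ lenm) (split D))
      arith₁ : ∀ a b t → a + b * t + t ≡ a + suc b * t
      arith₁ = solve-∀
      arith₂ : ∀ e a b k → e + a + b + k * (a + b) ≡ e + suc k * (a + b)
      arith₂ = solve-∀
    cases (suc m) lenm (no _) (yes twin) with find twin
    ... | h , h∈ , z , tw with find tw
    ...   | y , y∈ , y≢h , eqs = record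
      { B = R.B ; hs′ = R.hs′ ; is′ = R.is′ ; splitC = R.splitC ; clean = R.clean
      ; hs≤ = ≤-trans R.hs≤ (hs-del h∈)
      ; is≤ = R.is≤
      ; is≥ = ≤-trans R.is≥ (+-monoʳ-≤ (length R.is′) (*-monoˡ-≤ t (hs-del h∈)))
      ; EC = ≤-trans R.EC (+-mono-≤ (E-del _≟_ A (uniqH S) h∈) (*-monoˡ-≤ (cleanCost t) (hs-del h∈))) }
      where
      module R = CleanedUp (cleanUp m (smaller h∈ lenm) (deleteTwin _≟_ S h∈ (λ i∈ → count≡0⇒false z _ i∈)
        (Mem.∈-++⁻ hs y∈) y≢h (λ w∈ → All.lookup eqs (∈ws w∈))))

  record Trimmed (c t n d : ℕ) (A : V → V → Bool) (hs : List V) : Set where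
    field
      B      : V → V → Bool
      js     : List V
      splitT : SplitGraph c t B hs js
      cleanT : Clean t B hs js
      total  : length hs + length js ≡ n
      ET     : E hs B ≤ E hs A + d * (2 * (t * t))

  -- Deleting `i` threatens only its core neighbours, since vertices not adjacent to `i` keep their
  -- rows. It is safe if each core neighbour retains at least t neighbours in `is`. A core vertex
  -- with at most t neighbours in `is` rules out at most t choices of `i`, and `large` says that
  -- there are more choices than that in total.
  trim : ∀ {ρ t n A hs is} d → 1 ≤ t → SplitGraph (suc ρ) t A hs is → Clean t A hs is →
    length hs + length is ≡ n + d → length hs + length hs * t ≤ n → Trimmed (suc ρ) t n d A hs
  trim {A = A} {hs} {is} zero 1≤t S C eq le = record
    { B = A ; js = is ; splitT = S ; cleanT = C ; total = trans eq (+-identityʳ _) ; ET = m≤m+n _ _ }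
  trim {ρ} {t} {n} {A} {hs} {is} (suc d) 1≤t S C eq le = cases (Any.any? harmless? is)
    where
    cnt : V → ℕ
    cnt h = ∑ is (𝟙 ∘ A h)
    Harmless : V → Set
    Harmless i = All (λ h → A h i ≡ true → t < cnt h) hs
    harmless? : ∀ i → Dec (Harmless i)
    harmless? i = All.all? (λ h → (A h i ≟ᵇ true) →-dec (t <? cnt h)) hs
    large : length hs * t < length is
    large = ℕ.+-cancelˡ-< (length hs) _ _ (subst (length hs + length hs * t <_) (sym eq)
              (ℕ.≤-<-trans le (ℕ.m<m+n n (s≤s z≤n))))
    harm : V → V → ℕ
    harm i h = 𝟙 ⌊ cnt h ≤? t ⌋ * 𝟙 (A h i)
    harmful : ∀ i → ¬ Harmless i → 1 ≤ ∑ hs (harm i)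
    harmful i ¬ok with find (All.¬All⇒Any¬ (λ h → (A h i ≟ᵇ true) →-dec (t <? cnt h)) hs ¬ok)
    ... | h , h∈ , ¬h = ≤-trans pos (∑-∈ (harm i) h∈)
      where
      pos : 1 ≤ harm i h
      pos with A h i | cnt h ≤? t
      ... | true  | yes _   = s≤s z≤n
      ... | true  | no t≱   = contradiction (λ _ → ≰⇒> t≱) ¬h
      ... | false | _       = contradiction (λ ()) ¬h
    capped : ∀ h → 𝟙 ⌊ cnt h ≤? t ⌋ * cnt h ≤ t
    capped h with cnt h ≤? t
    ... | yes p = ≤-trans (≤-reflexive (+-identityʳ _)) p
    ... | no _  = z≤n
    cases : Dec (Any Harmless is) → Trimmed (suc ρ) t n (suc d) A hs
    cases (no none) = contradiction large (ℕ.≤⇒≯ (begin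
      length is ≡⟨ length-∑ is ⟩
      ∑ is (λ _ → 1) ≤⟨ ∑-mono is (λ i i∈ → harmful i (λ ok → none (lose i∈ ok))) ⟩
      ∑ is (λ i → ∑ hs (harm i)) ≡⟨ ∑-swap harm is hs ⟩
      ∑ hs (λ h → ∑ is (λ i → harm i h)) ≡⟨ ∑-cong hs (λ h _ → ∑-* (𝟙 ⌊ cnt h ≤? t ⌋) (𝟙 ∘ A h) is) ⟩
      ∑ hs (λ h → 𝟙 ⌊ cnt h ≤? t ⌋ * cnt h) ≤⟨ ∑-bound hs (λ h _ → capped h) ⟩
      length hs * t ∎))
      where open ℕ.≤-Reasoning
    cases (yes some) with find some
    ... | i , i∈ , ok = record
      { B = R.B ; js = R.js ; splitT = R.splitT ; cleanT = R.cleanT ; total = R.total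
      ; ET = ≤-trans R.ET (≤-trans (+-monoˡ-≤ _ (E≤ D)) (≤-reflexive (ℕ.+-assoc (E hs A) _ _))) }
      where
      D = deleteI _≟_ S i∈
      is₁ = del _≟_ i is
      rowI : ∀ h {j} → j ∈ₗ is → B D h j ≡ A h j
      rowI h {j} j∈ with change D h j
      ... | inj₁ e       = e
      ... | inj₂ (_ , a) = contradiction (indep S i∈ j∈) (true≢false a)
      rowN : ∀ {x} → A i x ≡ false → ∀ z → B D x z ≡ A x z
      rowN {x} a z with change D x z
      ... | inj₁ e        = e
      ... | inj₂ (a′ , _) = contradiction a (true≢false a′)
      cnt-del : ∀ h → cnt h ≡ 𝟙 (A h i) + ∑ is₁ (𝟙 ∘ B D h)
      cnt-del h = trans (∑-del _≟_ (𝟙 ∘ A h) (uniqI S) i∈)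
        (cong (𝟙 (A h i) +_) (∑-cong is₁ (λ j j∈ → cong 𝟙 (sym (rowI h (proj₁ (∈-del⁻ _≟_ j∈)))))))
      nbr-cnt : ∀ {h} → h ∈ₗ hs → A h i ≡ true → t ≤ ∑ is₁ (𝟙 ∘ B D h)
      nbr-cnt {h} h∈ a = s≤s⁻¹ (subst (t <_) (trans (cnt-del h) (cong (λ b → 𝟙 b + ∑ is₁ (𝟙 ∘ B D h)) a))
                           (All.lookup ok h∈ a))
      up : ∀ {x} → In hs is₁ x → In hs is x
      up = Sum.map₂ (proj₁ ∘ ∈-del⁻ _≟_)
      degH′ : ∀ {h} → h ∈ₗ hs → t ≤ ∑ hs (𝟙 ∘ B D h) + ∑ is₁ (𝟙 ∘ B D h)
      degH′ {h} h∈ with A h i in a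
      ... | true  = ≤-trans (nbr-cnt h∈ a) (m≤n+m _ _)
      ... | false = ≤-trans (degH C h∈) (+-mono-≤ (∑-mono hs (λ z _ → grow z))
                      (≤-reflexive (trans (cnt-del h) (cong (λ b → 𝟙 b + ∑ is₁ (𝟙 ∘ B D h)) a))))
        where
        grow : ∀ z → 𝟙 (A h z) ≤ 𝟙 (B D h z)
        grow z with A h z in e
        ... | false = z≤n
        ... | true rewrite ⊇A D h z e = ≤-refl
      notNbr : ∀ {h} → h ∈ₗ hs → ∑ is₁ (𝟙 ∘ B D h) ≡ 0 → A h i ≡ false
      notNbr {h} h∈ z with A h i in a
      ... | false = refl
      ... | true  = contradiction (≤-trans 1≤t (subst (t ≤_) z (nbr-cnt h∈ a))) λ ()
      noTwin′ : ∀ {h y} → h ∈ₗ hs → ∑ is₁ (𝟙 ∘ B D h) ≡ 0 → In hs is₁ y → y ≢ h →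
        ¬ (∀ {w} → In hs is₁ w → B D h w ≡ B D y w)
      noTwin′ {h} {y} h∈ z y∈ y≢h tw = noTwin C h∈ (trans (cnt-del h) (cong₂ _+_ (cong 𝟙 hi) z)) (up y∈) y≢h
        (λ {w} w∈ → old w (w ≟ i) w∈)
        where
        hi = notNbr h∈ z
        -- A core twin of `h` has no neighbour left in `is₁` either, whereas a neighbour of `i`
        -- would have at least t of them.
        yi : A y i ≡ false
        yi = [ (λ y∈h → notNbr y∈h (trans (∑-cong is₁ (λ j j∈ → cong 𝟙 (sym (tw (inj₂ j∈))))) z))
             , (λ y∈i → indep S (proj₁ (∈-del⁻ _≟_ y∈i)) i∈) ]′ y∈
        old : ∀ w → Dec (w ≡ i) → In hs is w → A h w ≡ A y w
        old w (yes refl) _  = trans hi (sym yi)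
        old w (no w≢i) w∈ = trans (sym (rowN (trans (symm S i h) hi) w))
          (trans (tw (Sum.map₂ (λ w∈i → ∈-del⁺ _≟_ w∈i w≢i) w∈)) (rowN (trans (symm S i y) yi) w))
      eq′ : length hs + length is₁ ≡ n + d
      eq′ = ℕ.suc-injective (trans (sym (+-suc (length hs) _))
        (trans (cong (length hs +_) (sym (length-del _≟_ (uniqI S) i∈))) (trans eq (+-suc n d))))
      clean′ : Clean t (B D) hs is₁
      clean′ = record { degH = degH′ ; noTwin = noTwin′ }
      module R = Trimmed (trim d 1≤t (split D) clean′ eq′ le)

  -- A system makes no demand on the degrees or twins of core vertices, so here any vertex of `is`
  -- may be deleted.
  thin : ∀ {ρ t s A hs is} d → SplitGraph (suc ρ) t A hs is → length is ≡ s + d →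
    ∃ λ B → ∃ λ js → SplitGraph (suc ρ) t B hs js × length js ≡ s × E hs B ≤ E hs A + d * (2 * (t * t))
  thin {A = A} {is = is} zero S eq = A , is , S , trans eq (+-identityʳ _) , m≤m+n _ _
  thin {s = s} {is = []} (suc d) S eq = contradiction (trans eq (+-suc s d)) λ ()
  thin {t = t} {s} {A} {hs} {i ∷ is} (suc d) S eq =
    let D = deleteI _≟_ S (here refl)
        B₁ , js , S′ , len , E₁ = thin d (split D) (ℕ.suc-injective
          (trans (sym (length-del _≟_ (uniqI S) (here refl))) (trans eq (+-suc s d))))
    in B₁ , js , S′ , len , ≤-trans E₁ (≤-trans (+-monoˡ-≤ _ (E≤ D)) (≤-reflexive (ℕ.+-assoc (E hs A) _ _)))

-- Graphs on Fin n

clique⇒K : ∀ {n} {A : Fin n → Fin n → Bool} {S : Subset n} {P : Fin n → Set} (k : ℕ) →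
  (∀ x → x ∈ S → P x) → CliqueIn A S k → K A P k
clique⇒K {A = A} k S⊆P (f , _ , f∈ , adj) = go k f (λ i → S⊆P (f i) (f∈ i)) adj
  where
  go : ∀ {P} k (f : Fin k → _) → (∀ i → P (f i)) → (∀ i j → i ≢ j → A (f i) (f j) ≡ true) → K A P k
  go zero    f f∈ adj = tt
  go (suc k) f f∈ adj = f zero , f∈ zero , go k (f ∘ suc) (λ i → f∈ (suc i) , adj zero (suc i) λ ())
                          (λ i j i≢j → adj (suc i) (suc j) (i≢j ∘ Fin.suc-injective))

K⇒clique : ∀ {n} {A : Fin n → Fin n → Bool} → Sym A → Irr A → {S : Subset n} {P : Fin n → Set} (k : ℕ) →
  (∀ x → P x → x ∈ S) → K A P k → CliqueIn A S k
K⇒clique {n} {A} sA iA k P⊆S h with go k h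
  where
  go : ∀ {P} k → K A P k → Σ (Fin k → Fin n) λ f → (∀ i → P (f i)) × (∀ i j → i ≢ j → A (f i) (f j) ≡ true)
  go zero    _            = (λ ()) , (λ ()) , λ ()
  go {P} (suc k) (x , px , h) with go k h
  ... | f , f∈ , adj = g , g∈ , gadj
    where
    g : Fin (suc k) → Fin n
    g zero    = x
    g (suc i) = f i
    g∈ : ∀ i → P (g i)
    g∈ zero    = px
    g∈ (suc i) = proj₁ (f∈ i)
    gadj : ∀ i j → i ≢ j → A (g i) (g j) ≡ true
    gadj zero    zero    ne = contradiction refl ne
    gadj zero    (suc j) ne = proj₂ (f∈ j)
    gadj (suc i) zero    ne = trans (sA (f i) x) (proj₂ (f∈ i))
    gadj (suc i) (suc j) ne = adj i j (ne ∘ cong suc)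
... | f , f∈ , adj = f , inj , (λ i → P⊆S (f i) (f∈ i)) , adj
  where
  inj : ∀ i j → f i ≡ f j → i ≡ j
  inj i j eq with i Fin.≟ j
  ... | yes p = p
  ... | no ne = contradiction (subst (λ y → A (f i) y ≡ false) eq (iA (f i))) (true≢false (adj i j ne))

∈full : ∀ {n} (x : Fin n) → x ∈ full
∈full x = Vec.lookup⇒[]= x full (Vec.lookup∘tabulate (λ _ → true) x)

∈-tabulate⁺ : ∀ {n} {f : Fin n → Bool} {x} → f x ≡ true → x ∈ Vec.tabulate f
∈-tabulate⁺ {f = f} {x} e = Vec.lookup⇒[]= x _ (trans (Vec.lookup∘tabulate f x) e)

∈-tabulate⁻ : ∀ {n} {f : Fin n → Bool} {x} → x ∈ Vec.tabulate f → f x ≡ true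
∈-tabulate⁻ {f = f} {x} p = trans (sym (Vec.lookup∘tabulate f x)) (Vec.[]=⇒lookup p)

∣tabulate∣ : ∀ {n} (f : Fin n → Bool) → ∣ Vec.tabulate f ∣ ≡ ∑ (allFin n) (𝟙 ∘ f)
∣tabulate∣ {zero}  f = refl
∣tabulate∣ {suc n} f = trans (cons (f zero) (Vec.tabulate (f ∘ suc))) (cong (𝟙 (f zero) +_)
  (trans (∣tabulate∣ (f ∘ suc)) (trans (sym (∑-map (𝟙 ∘ f) suc (allFin n)))
    (cong (λ xs → ∑ xs (𝟙 ∘ f)) (List.map-tabulate id suc)))))
  where
  cons : ∀ {m} b (p : Subset m) → ∣ b Vec.∷ p ∣ ≡ 𝟙 b + ∣ p ∣
  cons true  p = refl
  cons false p = refl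

∣∣≡∑ : ∀ {n} (p : Subset n) → ∣ p ∣ ≡ ∑ (allFin n) (𝟙 ∘ Vec.lookup p)
∣∣≡∑ p = trans (cong ∣_∣ (sym (Vec.tabulate∘lookup p))) (∣tabulate∣ (Vec.lookup p))

deg≡∑ : ∀ {n} (G : Graph n) i → deg G i ≡ ∑ (allFin n) (𝟙 ∘ adj G i)
deg≡∑ G i = ∣tabulate∣ (adj G i)

sum≡∑ : (f : V → ℕ) (xs : List V) → sum (map f xs) ≡ ∑ xs f
sum≡∑ f []       = refl
sum≡∑ f (x ∷ xs) = cong (f x +_) (sum≡∑ f xs)

handshake : ∀ {n} (G : Graph n) → 2 * edges G ≡ E (allFin n) (adj G)
handshake {n} G = begin
  2 * edges G ≡⟨ cong (2 *_) edges≡ ⟩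
  2 * ∑ xs (λ i → ∑ xs (below i)) ≡⟨ double (∑ xs (λ i → ∑ xs (below i))) ⟩
  ∑ xs (λ i → ∑ xs (below i)) + ∑ xs (λ i → ∑ xs (below i))
    ≡⟨ cong (∑ xs (λ i → ∑ xs (below i)) +_) (∑-swap below xs xs) ⟩
  ∑ xs (λ i → ∑ xs (below i)) + ∑ xs (λ j → ∑ xs (λ i → below i j)) ≡⟨ ∑-+ _ _ xs ⟨
  ∑ xs (λ i → ∑ xs (below i) + ∑ xs (λ j → below j i))
    ≡⟨ ∑-cong xs (λ i _ → trans (sym (∑-+ _ _ xs)) (∑-cong xs (λ j _ → both i j))) ⟩
  E xs (adj G) ∎
  where
  open ≡-Reasoning
  xs = allFin n
  below : Fin n → Fin n → ℕ
  below i j = 𝟙 (adj G i j ∧ ⌊ i Fin.<? j ⌋)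
  double : ∀ a → 2 * a ≡ a + a
  double = solve-∀
  edges≡ : edges G ≡ ∑ xs (λ i → ∑ xs (below i))
  edges≡ = trans (sum≡∑ _ xs) (∑-cong xs (λ i _ → ∣tabulate∣ (λ j → adj G i j ∧ ⌊ i Fin.<? j ⌋)))
  both : ∀ i j → below i j + below j i ≡ 𝟙 (adj G i j)
  both i j rewrite Graph.sym G j i with i Fin.<? j | j Fin.<? i
  ... | yes p | yes q = contradiction q (ℕ.<-asym p)
  ... | yes p | no q  rewrite 𝔹.∧-identityʳ (adj G i j) | 𝔹.∧-zeroʳ (adj G i j) = +-identityʳ _
  ... | no p  | yes q rewrite 𝔹.∧-identityʳ (adj G i j) | 𝔹.∧-zeroʳ (adj G i j) = refl
  ... | no p  | no q with Fin.toℕ-injective (ℕ.≤-antisym (≮⇒≥ q) (≮⇒≥ p))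
  ...   | refl rewrite Graph.irr G i = refl

lookup-injective : {xs : List V} → Unique xs → ∀ i j → lookup xs i ≡ lookup xs j → i ≡ j
lookup-injective {xs = x ∷ xs} (x∉ ∷ u) zero    zero    eq = refl
lookup-injective {xs = x ∷ xs} (x∉ ∷ u) zero    (suc j) eq = contradiction eq (All.lookup x∉ (Mem.∈-lookup j))
lookup-injective {xs = x ∷ xs} (x∉ ∷ u) (suc i) zero    eq = contradiction (sym eq) (All.lookup x∉ (Mem.∈-lookup i))
lookup-injective {xs = x ∷ xs} (x∉ ∷ u) (suc i) (suc j) eq = cong suc (lookup-injective u i j eq)

∈⇒lookup : {xs : List V} {x : V} → x ∈ₗ xs → ∃ λ i → lookup xs i ≡ x
∈⇒lookup x∈ = Any.index x∈ , sym (Any.lookup-index x∈)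

∑-lookup : (f : V → ℕ) (xs : List V) → ∑ (allFin (length xs)) (f ∘ lookup xs) ≡ ∑ xs f
∑-lookup f xs = trans (sym (∑-map f (lookup xs) (allFin (length xs))))
  (cong (λ ys → ∑ ys f) (trans (List.map-tabulate id (lookup xs)) (List.tabulate-lookup xs)))

induce : {A : V → V → Bool} → Sym A → Irr A → (xs : List V) → Graph (length xs)
induce {A = A} sA iA xs = record
  { adj = λ i j → A (lookup xs i) (lookup xs j)
  ; sym = λ i j → sA (lookup xs i) (lookup xs j)
  ; irr = λ i → iA (lookup xs i) }

module _ {A : V → V → Bool} (sA : Sym A) (iA : Irr A) where

  deg-induce : ∀ xs i → deg (induce sA iA xs) i ≡ ∑ xs (𝟙 ∘ A (lookup xs i))
  deg-induce xs i = trans (deg≡∑ (induce sA iA xs) i) (∑-lookup (𝟙 ∘ A (lookup xs i)) xs)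

  edges-induce : ∀ xs → 2 * edges (induce sA iA xs) ≡ E xs A
  edges-induce xs = trans (handshake (induce sA iA xs))
    (trans (∑-cong (allFin (length xs)) (λ i _ → ∑-lookup (𝟙 ∘ A (lookup xs i)) xs))
           (∑-lookup (λ x → ∑ xs (𝟙 ∘ A x)) xs))

AllPairs-∈ : {R : V → V → Set} {xs : List V} → Unique xs →
  (∀ {x y} → x ∈ₗ xs → y ∈ₗ xs → x ≢ y → R x y) → AllPairs R xs
AllPairs-∈ {xs = []}     []       r = []
AllPairs-∈ {xs = x ∷ xs} (x∉ ∷ u) r =
  All.tabulate (λ y∈ → r (here refl) (there y∈) (All.lookup x∉ y∈)) ∷ AllPairs-∈ u (λ p q → r (there p) (there q))

-- From split graphs to maximal systems and admissible graphs

module _ {c t : ℕ} {A : V → V → Bool} {hs is : List V}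
         (S : SplitGraph c t A hs is) where

  open SplitGraph S

  -- A clique has at most one vertex in an independent set. The two cases become the two
  -- alternatives in the maximality of a system: a K_r in the core, or a K_{r-1} inside one of the
  -- sets.
  K-indep : {P : V → Set} → (∀ x → P x → In hs is x) → (k : ℕ) → K A P k →
    K A (λ x → P x × x ∈ₗ hs) k ⊎
    (∃ λ i → i ∈ₗ is × P i × ∃ λ j → k ≡ suc j × K A (λ x → (P x × A i x ≡ true) × x ∈ₗ hs) j)
  K-indep P⊆ zero _ = inj₁ tt
  K-indep P⊆ (suc k) (x , px , h) with K-indep (λ y → P⊆ y ∘ proj₁) k h | P⊆ x px
  ... | inj₁ h′ | inj₁ x∈ = inj₁ (x , (px , x∈) , K-mono k (λ z ((pz , a) , z∈) → (pz , z∈) , a) h′)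
  ... | inj₁ h′ | inj₂ x∈ = inj₂ (x , x∈ , px , k , refl , h′)
  ... | inj₂ (i , i∈ , (pi , xi) , j , refl , h′) | inj₁ x∈ =
    inj₂ (i , i∈ , pi , suc j , refl , x , ((px , trans (symm i x) xi) , x∈) ,
          K-mono j (λ z (((pz , xz) , iz) , z∈) → ((pz , iz) , z∈) , xz) h′)
  ... | inj₂ (i , i∈ , (pi , xi) , _) | inj₂ x∈ = contradiction (indep x∈ i∈) (true≢false xi)

  nbrsInH : ∀ {i x} → i ∈ₗ is → In hs is x → A i x ≡ true → x ∈ₗ hs
  nbrsInH i∈ (inj₁ x∈) a = x∈
  nbrsInH i∈ (inj₂ x∈) a = contradiction (indep i∈ x∈) (true≢false a)

  core : Graph (length hs)
  core = induce symm irre hs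

  trace : V → Subset (length hs)
  trace i = Vec.tabulate (λ x → A i (lookup hs x))

  family : List (Subset (length hs))
  family = map trace is

  private
    lk = lookup hs

    toV : {P : Fin (length hs) → Set} {Q : V → Set} (k : ℕ) → (∀ x → P x → Q (lk x)) → K (adj core) P k → K A Q k
    toV k = K-image lk (λ _ _ → id) k

    toFin : {Q : V → Set} {P : Fin (length hs) → Set} (k : ℕ) → (∀ x → Q x → x ∈ₗ hs) → (∀ x → Q (lk x) → P x) →
      K A Q k → K (adj core) P k
    toFin k Q⊆ Q⇒P h = K-mono k Q⇒P (K-preimage lk k (λ y → ∈⇒lookup ∘ Q⊆ y) h)

    inH : ∀ x → In hs is (lk x)
    inH x = inj₁ (Mem.∈-lookup x)

    noCore : ¬ HasClique (adj core) (2 + c)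
    noCore h = noK (toV (2 + c) (λ x _ → inH x) (clique⇒K (2 + c) (λ _ _ → tt) h))

    noTrace : ∀ {i} → i ∈ₗ is → ¬ CliqueIn (adj core) (trace i) (suc c)
    noTrace {i} i∈ h = noK (i , inj₂ i∈ ,
      toV (suc c) (λ x a → inH x , a) (clique⇒K (suc c) (λ x → ∈-tabulate⁻ {f = A i ∘ lk}) h))

    coneTrace : ∀ {i} → i ∈ₗ is → ∀ x → x ∉ trace i → CliqueIn (adj core) (trace i ∪ ⁅ x ⁆) (suc c)
    coneTrace {i} i∈ x x∉ with A i (lk x) in a
    ... | true  = contradiction (∈-tabulate⁺ a) x∉
    ... | false = K⇒clique (Graph.sym core) (Graph.irr core) {P = λ y → A i (lk y) ≡ true ⊎ y ≡ x} (suc c)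
        (λ y → [ (λ e → Sub.x∈p∪q⁺ (inj₁ (∈-tabulate⁺ e))) , (λ { refl → Sub.x∈p∪q⁺ (inj₂ (Sub.x∈⁅x⁆ x)) }) ]′)
        (x , inj₂ refl , toFin c (λ y (y∈ , p , _) → nbrsInH i∈ y∈ p) (λ y (_ , p , q) → inj₁ p , q)
          (sat (inj₂ i∈) (inH x) (λ { refl → disj (Mem.∈-lookup x) i∈ }) a))

    meet : ∀ {i j} → i ∈ₗ is → j ∈ₗ is → trace i ≢ trace j → CliqueIn (adj core) (trace i ∩ trace j) c
    meet {i} {j} i∈ j∈ ne = K⇒clique (Graph.sym core) (Graph.irr core) c
        (λ x (p , q) → Sub.x∈p∩q⁺ (∈-tabulate⁺ p , ∈-tabulate⁺ q))
        (toFin c (λ y (y∈ , p , _) → nbrsInH i∈ y∈ p) (λ y → proj₂)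
          (sat (inj₂ i∈) (inj₂ j∈) (λ { refl → ne refl }) (indep i∈ j∈)))

    maximal : ∀ u w → u ≢ w → adj core u w ≡ false →
      HasClique (addEdge (adj core) u w) (2 + c) ⊎
      (∃ λ T → T ∈ₗ family × CliqueIn (addEdge (adj core) u w) T (suc c))
    maximal u w u≢w a with K-indep (λ x → proj₁) c (sat (inH u) (inH w) (u≢w ∘ lookup-injective uniqH u w) a)
    ... | inj₁ h = inj₁ (K⇒clique (addE-sym Fin._≟_ (Graph.sym core) u w) (addE-irr Fin._≟_ {adj core} (Graph.irr core) u≢w)
          (2 + c) (λ x _ → ∈full x)
          (Common⇒K-addE Fin._≟_ (Graph.sym core) (Graph.irr core) {P = λ _ → ⊤} tt tt c
            (toFin c (λ y → proj₂) (λ y ((_ , p) , _) → tt , p) h)))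
    ... | inj₂ (i , i∈ , (_ , ui , wi) , j , refl , h) = inj₂ (trace i , Mem.∈-map⁺ trace i∈ ,
          K⇒clique (addE-sym Fin._≟_ (Graph.sym core) u w) (addE-irr Fin._≟_ {adj core} (Graph.irr core) u≢w)
          (2 + j) (λ x → ∈-tabulate⁺)
          (Common⇒K-addE Fin._≟_ (Graph.sym core) (Graph.irr core) {P = λ x → A i (lk x) ≡ true}
            (trans (symm i (lk u)) ui) (trans (symm i (lk w)) wi) j
            (toFin j (λ y → proj₂) (λ y (((_ , p) , q) , _) → q , p) h)))

    lift : {Q : Subset (length hs) → Set} → (∀ {i} → i ∈ₗ is → Q (trace i)) → ∀ T → T ∈ₗ family → Q T
    lift q T T∈ with Mem.∈-map⁻ trace T∈
    ... | i , i∈ , refl = q i∈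

  maximalSystem : IsMaximalRTSystem (2 + c) t core family
  maximalSystem =
    ((noCore
      , lift (λ i∈ → noTrace i∈ , coneTrace i∈)
      , λ T U T∈ U∈ → lift {λ T → T ≢ U → _} (λ i∈ → lift {λ U → trace _ ≢ U → _} (λ j∈ → meet i∈ j∈) U U∈) T T∈)
    , maximal)
    , AllPairs.map⁺ (AllPairs-∈ uniqI distinct)
    , All.map⁺ (All.tabulate size)
    where
    size : ∀ {i} → i ∈ₗ is → ∣ trace i ∣ ≡ t
    size {i} i∈ = trans (∣tabulate∣ (A i ∘ lk)) (trans (∑-lookup (𝟙 ∘ A i) hs) (degI i∈))
    distinct : ∀ {i j} → i ∈ₗ is → j ∈ₗ is → i ≢ j → trace i ≢ trace j
    distinct {i} {j} i∈ j∈ i≢j eq with dist i∈ j∈ i≢j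
    ... | h , h∈ , ne with ∈⇒lookup h∈
    ...   | x , refl = ne (trans (sym (Vec.lookup∘tabulate (A i ∘ lk) x))
                        (trans (cong (λ T → Vec.lookup T x) eq) (Vec.lookup∘tabulate (A j ∘ lk) x)))

  splitEdges : E (hs ++ is) A ≡ E hs A + 2 * (t * length is)
  splitEdges = begin
    E (hs ++ is) A
      ≡⟨ trans (∑-++ _ hs is) (cong₂ _+_ (rows hs) (rows is)) ⟩
    (E hs A + ∑ hs (λ x → ∑ is (λ y → 𝟙 (A x y)))) + (HI + ∑ is (λ x → ∑ is (λ y → 𝟙 (A x y))))
      ≡⟨ cong₂ (λ a b → (E hs A + a) + (HI + b))
          (trans (∑-swap _ hs is) (∑-cong is (λ i _ → ∑-cong hs (λ h _ → cong 𝟙 (symm h i)))))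
          (trans (∑-cong is (λ i i∈ → trans (∑-cong is (λ j j∈ → cong 𝟙 (indep i∈ j∈))) (∑-zero is))) (∑-zero is)) ⟩
    (E hs A + HI) + (HI + 0)
      ≡⟨ cong (λ a → (E hs A + a) + (a + 0)) (trans (∑-cong is (λ i → degI)) (∑-const t is)) ⟩
    (E hs A + length is * t) + (length is * t + 0)
      ≡⟨ arith (E hs A) (length is) t ⟩
    E hs A + 2 * (t * length is) ∎
    where
    open ≡-Reasoning
    HI = ∑ is (λ x → ∑ hs (λ y → 𝟙 (A x y)))
    rows : ∀ xs → ∑ xs (λ x → ∑ (hs ++ is) (λ y → 𝟙 (A x y))) ≡
      ∑ xs (λ x → ∑ hs (λ y → 𝟙 (A x y))) + ∑ xs (λ x → ∑ is (λ y → 𝟙 (A x y)))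
    rows xs = trans (∑-cong xs (λ x _ → ∑-++ _ hs is)) (∑-+ _ _ xs)
    arith : ∀ e l t → (e + l * t) + (l * t + 0) ≡ e + 2 * (t * l)
    arith = solve-∀

  admissible : Clean t A hs is →
    Σ (Graph (length (hs ++ is))) λ G → TsatAdmissible (2 + c) t G × 2 * edges G ≡ E hs A + 2 * (t * length is)
  admissible C = G , ((noG , satG) , minDeg , twins) , trans (edges-induce symm irre ws) splitEdges
    where
    open Clean C
    ws = hs ++ is
    G = induce symm irre ws
    lw = lookup ws
    inW : ∀ x → In hs is (lw x)
    inW x = Mem.∈-++⁻ hs (Mem.∈-lookup x)
    toIndex : ∀ {y} → In hs is y → ∃ λ x → lw x ≡ y
    toIndex = [ ∈⇒lookup ∘ Mem.∈-++⁺ˡ , ∈⇒lookup ∘ Mem.∈-++⁺ʳ hs ]′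
    uniqW : Unique ws
    uniqW = Uniq.++⁺ uniqH uniqI (λ (p , q) → disj p q)
    noG : ¬ HasClique (adj G) (2 + c)
    noG h = noK (K-image lw (λ _ _ → id) (2 + c) (λ x _ → inW x) (clique⇒K {P = λ _ → ⊤} (2 + c) (λ _ _ → tt) h))
    satG : ∀ u v → u ≢ v → adj G u v ≡ false → HasClique (addEdge (adj G) u v) (2 + c)
    satG u v u≢v a = K⇒clique (addE-sym Fin._≟_ (Graph.sym G) u v) (addE-irr Fin._≟_ {adj G} (Graph.irr G) u≢v)
      (2 + c) (λ x _ → ∈full x)
      (Common⇒K-addE Fin._≟_ (Graph.sym G) (Graph.irr G) {P = λ _ → ⊤} tt tt c
        (K-mono c (λ x (_ , p) → tt , p)
          (K-preimage lw c (λ y → toIndex ∘ proj₁) (sat (inW u) (inW v) (u≢v ∘ lookup-injective uniqW u v) a))))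
    deg≡ : ∀ x → deg G x ≡ ∑ hs (𝟙 ∘ A (lw x)) + ∑ is (𝟙 ∘ A (lw x))
    deg≡ x = trans (deg-induce symm irre ws x) (∑-++ _ hs is)
    minDeg : MinDegGe t G
    minDeg x = subst (t ≤_) (sym (deg≡ x))
      ([ degH , (λ i∈ → ≤-trans (≤-reflexive (sym (degI i∈))) (m≤m+n _ _)) ]′ (inW x))
    degI-G : ∀ {x} → lw x ∈ₗ is → deg G x ≡ t
    degI-G {x} i∈ = trans (deg≡ x) (trans (cong₂ _+_ (degI i∈)
      (trans (∑-cong is (λ j j∈ → cong 𝟙 (indep i∈ j∈))) (∑-zero is))) (+-identityʳ t))
    twins : TwinCondition t G
    twins u v (u≢v , eq) = cases (inW u) (inW v)
      where
      ne : lw u ≢ lw v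
      ne = u≢v ∘ lookup-injective uniqW u v
      eqV : ∀ {w} → In hs is w → A (lw u) w ≡ A (lw v) w
      eqV w∈ with toIndex w∈
      ... | x , refl = eq x
      common : ∀ {i} → i ∈ₗ is → A (lw u) i ≡ true → ∃ λ w → adj G u w ≡ true × adj G v w ≡ true × deg G w ≡ t
      common i∈ a with toIndex (inj₂ i∈)
      ... | x , refl = x , a , trans (sym (eq x)) a , degI-G i∈
      cases : In hs is (lw u) → In hs is (lw v) →
        ∃ λ w → adj G u w ≡ true × adj G v w ≡ true × deg G w ≡ t
      cases (inj₂ u∈) (inj₂ v∈) with dist u∈ v∈ ne
      ... | h , h∈ , differ = contradiction (eqV (inj₁ h∈)) differ
      cases (inj₁ u∈) v∈ with ∑ is (𝟙 ∘ A (lw u)) in z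
      ... | zero  = ⊥-elim (noTwin u∈ z v∈ (ne ∘ sym) eqV)
      ... | suc k with count>0⇒∃ (A (lw u)) is (subst (1 ≤_) (sym z) (s≤s z≤n))
      ...   | i , i∈ , a = common i∈ a
      cases (inj₂ u∈) (inj₁ v∈) with ∑ is (𝟙 ∘ A (lw v)) in z
      ... | zero  = ⊥-elim (noTwin v∈ z (inj₂ u∈) ne (sym ∘ eqV))
      ... | suc k with count>0⇒∃ (A (lw v)) is (subst (1 ≤_) (sym z) (s≤s z≤n))
      ...   | i , i∈ , a = common i∈ (trans (eqV (inj₂ i∈)) a)

-- From maximal systems to split graphs

module FromSystem {c t v : ℕ} {H : Graph v} {F : List (Subset v)} (M : IsMaximalRTSystem (2 + c) t H F) where

  private
    sys = proj₁ (proj₁ M)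
    noH = proj₁ sys
    unique = proj₁ (proj₂ M)
    s = length F

    T : Fin s → Subset v
    T = lookup F

    T∈ : ∀ j → T j ∈ₗ F
    T∈ = λ j → Mem.∈-lookup j

  Vertex : Set
  Vertex = Fin v ⊎ Fin s

  _≟ⱽ_ : DecidableEquality Vertex
  _≟ⱽ_ = Sum.≡-dec Fin._≟_ Fin._≟_

  joined : Vertex → Vertex → Bool
  joined (inj₁ x) (inj₁ y) = adj H x y
  joined (inj₁ x) (inj₂ j) = Vec.lookup (T j) x
  joined (inj₂ i) (inj₁ y) = Vec.lookup (T i) y
  joined (inj₂ i) (inj₂ j) = false

  hs is : List Vertex
  hs = map inj₁ (allFin v)
  is = map inj₂ (allFin s)

  private
    ∈hs : ∀ x → inj₁ x ∈ₗ hs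
    ∈hs x = Mem.∈-map⁺ inj₁ (Mem.∈-allFin x)

    ∈is : ∀ j → inj₂ j ∈ₗ is
    ∈is j = Mem.∈-map⁺ inj₂ (Mem.∈-allFin j)

    All∈ : ∀ w → In hs is w
    All∈ (inj₁ x) = inj₁ (∈hs x)
    All∈ (inj₂ j) = inj₂ (∈is j)

    symJ : Sym joined
    symJ (inj₁ x) (inj₁ y) = Graph.sym H x y
    symJ (inj₁ x) (inj₂ j) = refl
    symJ (inj₂ i) (inj₁ y) = refl
    symJ (inj₂ i) (inj₂ j) = refl

    irrJ : Irr joined
    irrJ (inj₁ x) = Graph.irr H x
    irrJ (inj₂ j) = refl

    K-joined : ∀ {P} k → K joined P k → K (adj H) (P ∘ inj₁) k ⊎
      (∃ λ i → P (inj₂ i) × ∃ λ j → k ≡ suc j × K (adj H) (λ x → P (inj₁ x) × x ∈ T i) j)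
    K-joined zero _ = inj₁ tt
    K-joined (suc k) (inj₁ x , px , h) with K-joined k h
    ... | inj₁ h′ = inj₁ (x , px , h′)
    ... | inj₂ (i , (pi , xi) , j , refl , h′) = inj₂ (i , pi , suc j , refl , x , (px , Vec.lookup⇒[]= x _ xi) ,
          K-mono j (λ y ((py , xy) , y∈) → (py , y∈) , xy) h′)
    K-joined (suc k) (inj₂ i , pi , h) with K-joined k h
    ... | inj₁ h′ = inj₂ (i , pi , k , refl , K-mono k (λ y (py , iy) → py , Vec.lookup⇒[]= y _ iy) h′)
    ... | inj₂ (_ , (_ , ()) , _)

    noHK : ¬ K (adj H) (λ _ → ⊤) (2 + c)
    noHK = noH ∘ K⇒clique (Graph.sym H) (Graph.irr H) (2 + c) (λ x _ → ∈full x)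

    noTK : ∀ i → ¬ K (adj H) (_∈ T i) (suc c)
    noTK i = proj₁ (proj₁ (proj₂ sys) (T i) (T∈ i)) ∘ K⇒clique (Graph.sym H) (Graph.irr H) (suc c) (λ x → id)

    noJ : ¬ K joined (In hs is) (2 + c)
    noJ h with K-joined (2 + c) h
    ... | inj₁ h′                      = noHK (K-mono (2 + c) (λ _ _ → tt) h′)
    ... | inj₂ (i , _ , _ , refl , h′) = noTK i (K-mono (suc c) (λ _ → proj₂) h′)

    toJ : ∀ {P Q} k → (∀ x → P x → Q (inj₁ x)) → K (adj H) P k → K joined Q k
    toJ k = K-image inj₁ (λ _ _ → id) k

    -- The K_{r-1} that appears when `x` joins `T i` must contain `x`, because `T i` alone has none.
    -- Its other vertices are common neighbours of `x` and the new vertex.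
    satHI : ∀ x i → Vec.lookup (T i) x ≡ false → Common joined (In hs is) c (inj₁ x) (inj₂ i)
    satHI x i a with K-split Fin._≟_ (Graph.sym H) (Graph.irr H) x c
      (clique⇒K (suc c) (λ y → id) (proj₂ (proj₁ (proj₂ sys) (T i) (T∈ i)) x
        (λ x∈ → true≢false (Vec.[]=⇒lookup x∈) a)))
    ... | inj₁ h = contradiction (K-mono (suc c) inT h) (noTK i)
      where
      inT : ∀ y → y ∈ T i ∪ ⁅ x ⁆ × y ≢ x → y ∈ T i
      inT y (y∈ , y≢x) with Sub.x∈p∪q⁻ (T i) ⁅ x ⁆ y∈
      ... | inj₁ p = p
      ... | inj₂ q = contradiction (Sub.x∈⁅y⁆⇒x≡y x q) y≢x
    ... | inj₂ (_ , h) = toJ c nbr h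
      where
      nbr : ∀ y → y ∈ T i ∪ ⁅ x ⁆ × adj H x y ≡ true →
        In hs is (inj₁ y) × adj H x y ≡ true × Vec.lookup (T i) y ≡ true
      nbr y (y∈ , xy) with Sub.x∈p∪q⁻ (T i) ⁅ x ⁆ y∈
      ... | inj₁ p = All∈ (inj₁ y) , xy , Vec.[]=⇒lookup p
      ... | inj₂ q with Sub.x∈⁅y⁆⇒x≡y x q
      ...   | refl = contradiction (Graph.irr H x) (true≢false xy)

    T-injective : ∀ i j → T i ≡ T j → i ≡ j
    T-injective = lookup-injective unique

    satJ : ∀ x y → x ≢ y → joined x y ≡ false → Common joined (In hs is) c x y
    satJ (inj₁ x) (inj₂ i) ne a = satHI x i a
    satJ (inj₂ i) (inj₁ x) ne a = Common-sym {u = inj₁ x} {inj₂ i} c (satHI x i a)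
    satJ (inj₂ i) (inj₂ j) ne a = toJ c
      (λ x x∈ → let p , q = Sub.x∈p∩q⁻ (T i) (T j) x∈ in All∈ (inj₁ x) , Vec.[]=⇒lookup p , Vec.[]=⇒lookup q)
      (clique⇒K c (λ y → id) (proj₂ (proj₂ sys) (T i) (T j) (T∈ i) (T∈ j) (ne ∘ cong inj₂ ∘ T-injective i j)))
    satJ (inj₁ x) (inj₁ y) ne a with proj₂ (proj₁ M) x y (ne ∘ cong inj₁) a
    ... | inj₁ h with K-addE Fin._≟_ (Graph.sym H) (Graph.irr H) (ne ∘ cong inj₁) (2 + c) (clique⇒K {P = λ _ → ⊤} (2 + c) (λ _ _ → tt) h)
    ...   | inj₁ h′                    = contradiction h′ noHK
    ...   | inj₂ (_ , _ , _ , refl , h′) = toJ c (λ z (_ , p) → All∈ (inj₁ z) , p) h′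
    satJ (inj₁ x) (inj₁ y) ne a | inj₂ (U , U∈ , h)
      with ∈⇒lookup U∈
    ... | i , refl with K-addE Fin._≟_ (Graph.sym H) (Graph.irr H) (ne ∘ cong inj₁) (suc c) (clique⇒K (suc c) (λ y → id) h)
    ...   | inj₁ h′ = contradiction h′ (noTK i)
    ...   | inj₂ (x∈ , y∈ , j , refl , h′) = inj₂ i , (All∈ (inj₂ i) , Vec.[]=⇒lookup x∈ , Vec.[]=⇒lookup y∈) ,
              toJ j (λ z (z∈ , p) → (All∈ (inj₁ z) , p) , Vec.[]=⇒lookup z∈) h′

    unI : ∀ {x} → x ∈ₗ is → ∃ λ i → x ≡ inj₂ i
    unI x∈ = let i , _ , eq = Mem.∈-map⁻ inj₂ x∈ in i , eq

    indepJ : ∀ {x y} → x ∈ₗ is → y ∈ₗ is → joined x y ≡ false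
    indepJ x∈ y∈ with unI x∈ | unI y∈
    ... | i , refl | j , refl = refl

    degJ : ∀ {x} → x ∈ₗ is → ∑ hs (𝟙 ∘ joined x) ≡ t
    degJ x∈ with unI x∈
    ... | i , refl = trans (∑-map _ inj₁ (allFin v)) (trans (sym (∣∣≡∑ (T i))) (All.lookup (proj₂ (proj₂ M)) (T∈ i)))

    distJ : ∀ {x y} → x ∈ₗ is → y ∈ₗ is → x ≢ y → ∃ λ h → h ∈ₗ hs × joined x h ≢ joined y h
    distJ x∈ y∈ ne with unI x∈ | unI y∈
    ... | i , refl | j , refl with Fin.any? (λ z → ¬? (Vec.lookup (T i) z ≟ᵇ Vec.lookup (T j) z))
    ...   | yes (z , differ) = inj₁ z , ∈hs z , differ
    ...   | no same = contradiction (cong inj₂ (T-injective i j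
              (trans (sym (Vec.tabulate∘lookup (T i)))
                (trans (Vec.tabulate-cong (λ z → decidable-stable (_ ≟ᵇ _) (λ d → same (z , d))))
                  (Vec.tabulate∘lookup (T j)))))) ne

  split : SplitGraph c t joined hs is
  split = record
    { symm = symJ ; irre = irrJ
    ; uniqH = Uniq.map⁺ Sum.inj₁-injective (Uniq.allFin⁺ v)
    ; uniqI = Uniq.map⁺ Sum.inj₂-injective (Uniq.allFin⁺ s)
    ; disj = λ x∈h x∈i → case trans (sym (proj₂ (proj₂ (Mem.∈-map⁻ inj₁ x∈h)))) (proj₂ (unI x∈i)) of λ ()
    ; noK = noJ ; sat = λ {x} {y} _ _ ne a → satJ x y ne a ; indep = indepJ ; degI = degJ ; dist = distJ }

  length-hs : length hs ≡ v
  length-hs = trans (List.length-map inj₁ (allFin v)) (List.length-tabulate id)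

  length-is : length is ≡ length F
  length-is = trans (List.length-map inj₂ (allFin s)) (List.length-tabulate id)

  E-hs : E hs joined ≡ 2 * edges H
  E-hs = trans (∑-map _ inj₁ (allFin v)) (trans (∑-cong (allFin v) (λ x _ → ∑-map _ inj₁ (allFin v))) (sym (handshake H)))

-- Sizes of the core and of the independent set

distinct-traces : (A : V → V → Bool) (hs is : List V) → AllPairs (λ x y → ∃ λ h → h ∈ₗ hs × A x h ≢ A y h) is →
  length is ≤ 2 ^ length hs
distinct-traces A []       []           _                    = z≤n
distinct-traces A []       (_ ∷ [])     _                    = s≤s z≤n
distinct-traces A []       (_ ∷ _ ∷ _) (((_ , () , _) ∷ _) ∷ _)
-- The vertex `h` splits `is` into two classes; inside a class it distinguishes nothing, so the
-- remaining core vertices must.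
distinct-traces A (h ∷ hs) is d = begin
  length is ≡⟨ length-sel-not p is ⟨
  length (sel p is) + length (sel (not ∘ p) is)
    ≤⟨ +-mono-≤ (half p (λ a b → trans a (sym b))) (half (not ∘ p) (λ a b → 𝔹.not-injective (trans a (sym b)))) ⟩
  2 ^ length hs + 2 ^ length hs ≡⟨ cong (2 ^ length hs +_) (sym (+-identityʳ _)) ⟩
  2 ^ length (h ∷ hs) ∎
  where
  open ℕ.≤-Reasoning
  p = λ x → A x h
  half : (q : _ → Bool) → (∀ {x y} → q x ≡ true → q y ≡ true → A x h ≡ A y h) → length (sel q is) ≤ 2 ^ length hs
  half q same = distinct-traces A hs (sel q is) (refine is d)
    where
    refine : ∀ is → AllPairs (λ x y → ∃ λ z → z ∈ₗ h ∷ hs × A x z ≢ A y z) is →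
      AllPairs (λ x y → ∃ λ z → z ∈ₗ hs × A x z ≢ A y z) (sel q is)
    refine []       []       = []
    refine (x ∷ xs) (d ∷ ds) with q x in qx
    ... | false = refine xs ds
    ... | true  = All.tabulate sep ∷ refine xs ds
      where
      sep : ∀ {y} → y ∈ₗ sel q xs → ∃ λ z → z ∈ₗ hs × A x z ≢ A y z
      sep y∈ with ∈-sel⁻ {p = q} y∈
      ... | y∈xs , qy with All.lookup d y∈xs
      ...   | z , here refl , ne = contradiction (same qx qy) ne
      ...   | z , there z∈ , ne  = z , z∈ , ne

module _ {ρ t : ℕ} {A : V → V → Bool} {hs is : List V}
         (S : SplitGraph (suc ρ) t A hs is) where

  open SplitGraph S

  length-is≤ : length is ≤ 2 ^ length hs
  length-is≤ = distinct-traces A hs is (AllPairs-∈ uniqI dist)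

  -- A core vertex not adjacent to `i` shares a neighbour with `i`, as c is at least 1. This
  -- neighbour lies in the core, so the vertex has positive core degree and is counted in `E hs A`.
  length-hs≤ : ∀ {i} → i ∈ₗ is → length hs ≤ t + E hs A
  length-hs≤ {i} i∈ = begin
    length hs ≡⟨ length-∑ hs ⟩
    ∑ hs (λ _ → 1) ≤⟨ ∑-mono hs touched ⟩
    ∑ hs (λ h → 𝟙 (A i h) + ∑ hs (𝟙 ∘ A h)) ≡⟨ ∑-+ _ _ hs ⟩
    ∑ hs (𝟙 ∘ A i) + E hs A ≡⟨ cong (_+ E hs A) (degI i∈) ⟩
    t + E hs A ∎
    where
    open ℕ.≤-Reasoning
    touched : ∀ h → h ∈ₗ hs → 1 ≤ 𝟙 (A i h) + ∑ hs (𝟙 ∘ A h)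
    touched h h∈ with A i h in a
    ... | true  = s≤s z≤n
    ... | false with sat (inj₂ i∈) (inj₁ h∈) (λ { refl → disj h∈ i∈ }) a
    ...   | z , (z∈ , iz , hz) , _ = ≤-trans (≤-reflexive (cong 𝟙 (sym hz))) (∑-∈ (𝟙 ∘ A h) (nbrsInH S i∈ z∈ iz))

-- A new core vertex `nothing` joined to everything raises the forbidden clique size and t by one.
-- Sparse systems therefore have to be constructed only for triangles.
module Cone (_≟_ : DecidableEquality V) {c t : ℕ} {A : V → V → Bool} {hs is : List V}
            (S : SplitGraph c t A hs is) where

  open SplitGraph S

  _≟°_ : DecidableEquality (Maybe V)
  _≟°_ = Maybe.≡-dec _≟_

  A° : Maybe V → Maybe V → Bool
  A° nothing  nothing  = false
  A° nothing  (just _) = true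
  A° (just _) nothing  = true
  A° (just x) (just y) = A x y

  hs° is° : List (Maybe V)
  hs° = nothing ∷ map just hs
  is° = map just is

  private
    K-just : ∀ {P} k → (P nothing → ⊥) → K A° P k → K A (P ∘ just) k
    K-just zero    _  _                  = tt
    K-just (suc k) ∌ (nothing , p , _) = ⊥-elim (∌ p)
    K-just (suc k) ∌ (just x , p , h)  = x , p , K-just k (∌ ∘ proj₁) h

    K-cone : ∀ {P} k → K A° P (suc k) → K A (P ∘ just) k
    K-cone k       (nothing , p , h) = K-mono k (λ _ → proj₁) (K-just k (λ ()) h)
    K-cone zero    (just x , p , h)  = tt
    K-cone (suc k) (just x , p , h)  = x , p , K-cone k h

    fromIn : ∀ {x} → In hs° is° (just x) → In hs is x
    fromIn (inj₁ (there p)) with Mem.∈-map⁻ just p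
    ... | _ , q , refl = inj₁ q
    fromIn (inj₂ p) with Mem.∈-map⁻ just p
    ... | _ , q , refl = inj₂ q

    toIn : ∀ {x} → In hs is x → In hs° is° (just x)
    toIn = Sum.map (there ∘ Mem.∈-map⁺ just) (Mem.∈-map⁺ just)

    ∈is° : ∀ {x} → x ∈ₗ is° → ∃ λ y → y ∈ₗ is × x ≡ just y
    ∈is° = Mem.∈-map⁻ just

    sym° : Sym A°
    sym° nothing  nothing  = refl
    sym° nothing  (just _) = refl
    sym° (just _) nothing  = refl
    sym° (just x) (just y) = symm x y

    irr° : Irr A°
    irr° nothing  = refl
    irr° (just x) = irre x

    sat° : ∀ {x y} → In hs° is° x → In hs° is° y → x ≢ y → A° x y ≡ false → Common A° (In hs° is°) (suc c) x y
    sat° {nothing} {nothing} _ _ ne _ = contradiction refl ne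
    sat° {just x} {just y} p q ne f = nothing , (inj₁ (here refl) , refl , refl) ,
      K-image just (λ _ _ → id) c (λ z (w , r) → (toIn w , r) , refl) (sat (fromIn p) (fromIn q) (ne ∘ cong just) f)

    disj° : ∀ {x} → x ∈ₗ hs° → x ∈ₗ is° → ⊥
    disj° (here refl) q = case ∈is° q of λ { (_ , _ , ()) }
    disj° (there p)   q with Mem.∈-map⁻ just p | ∈is° q
    ... | _ , x∈ , refl | _ , x∈′ , refl = disj x∈ x∈′

    indep° : ∀ {x y} → x ∈ₗ is° → y ∈ₗ is° → A° x y ≡ false
    indep° p q with ∈is° p | ∈is° q
    ... | _ , x∈ , refl | _ , y∈ , refl = indep x∈ y∈

    degI° : ∀ {x} → x ∈ₗ is° → ∑ hs° (𝟙 ∘ A° x) ≡ suc t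
    degI° p with ∈is° p
    ... | x , x∈ , refl = cong suc (trans (∑-map (𝟙 ∘ A° (just x)) just hs) (degI x∈))

    dist° : ∀ {x y} → x ∈ₗ is° → y ∈ₗ is° → x ≢ y → ∃ λ h → h ∈ₗ hs° × A° x h ≢ A° y h
    dist° p q ne with ∈is° p | ∈is° q
    ... | _ , x∈ , refl | _ , y∈ , refl = let h , h∈ , d = dist x∈ y∈ (ne ∘ cong just) in just h , there (Mem.∈-map⁺ just h∈) , d

  split : SplitGraph (suc c) (suc t) A° hs° is°
  split = record
    { symm = sym° ; irre = irr°
    ; uniqH = All.tabulate (λ p e → case Mem.∈-map⁻ just p of λ { (_ , _ , refl) → case e of λ () }) ∷ Uniq.map⁺ Maybe.just-injective uniqH
    ; uniqI = Uniq.map⁺ Maybe.just-injective uniqI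
    ; disj = disj° ; noK = λ h → noK (K-mono (2 + c) (λ _ → fromIn) (K-cone (2 + c) h))
    ; sat = sat° ; indep = indep° ; degI = degI° ; dist = dist° }

  E° : E hs° A° ≡ E hs A + 2 * length hs
  E° = begin
    ∑ (map just hs) (𝟙 ∘ A° nothing) + ∑ (map just hs) (λ x → ∑ hs° (𝟙 ∘ A° x))
      ≡⟨ cong₂ _+_ (∑-map (𝟙 ∘ A° nothing) just hs) (∑-map (λ x → ∑ hs° (𝟙 ∘ A° x)) just hs) ⟩
    ∑ hs (λ _ → 1) + ∑ hs (λ x → 1 + ∑ (map just hs) (𝟙 ∘ A° (just x)))
      ≡⟨ cong (∑ hs (λ _ → 1) +_) (trans (∑-+ (λ _ → 1) _ hs) (cong (∑ hs (λ _ → 1) +_) (∑-cong hs (λ x _ → ∑-map (𝟙 ∘ A° (just x)) just hs)))) ⟩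
    ∑ hs (λ _ → 1) + (∑ hs (λ _ → 1) + E hs A)
      ≡⟨ cong (λ n → n + (n + E hs A)) (sym (length-∑ hs)) ⟩
    length hs + (length hs + E hs A) ≡⟨ arith (length hs) (E hs A) ⟩
    E hs A + 2 * length hs ∎
    where
    open ≡-Reasoning
    arith : ∀ a e → a + (a + e) ≡ e + 2 * a
    arith = solve-∀

-- Sparse systems

-- Here `nothing` is a wildcard: a core vertex of the example is tied to only some of the three
-- indices.
match : ∀ {n} → Maybe (Fin n) → Fin n → Bool
match nothing  x = true
match (just y) x = ⌊ y Fin.≟ x ⌋

match⇒≡ : ∀ {n} {x y : Fin n} → match (just y) x ≡ true → y ≡ x
match⇒≡ {x = x} {y} = ⌊⌋-true {P? = y Fin.≟ x}

match-refl : ∀ {n} (x : Fin n) → match (just x) x ≡ true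
match-refl x = true-⌊⌋ {P? = x Fin.≟ x} refl

compat : ∀ {n} → Fin n → (p q : Maybe (Fin n)) →
  (∃ λ x → match p x ≡ true × match q x ≡ true) ⊎ (∃ λ x → ∃ λ y → p ≡ just x × q ≡ just y × x ≢ y)
compat z nothing  nothing  = inj₁ (z , refl , refl)
compat z nothing  (just y) = inj₁ (y , refl , match-refl y)
compat z (just x) nothing  = inj₁ (x , match-refl x , refl)
compat z (just x) (just y) with x Fin.≟ y
... | yes refl = inj₁ (x , match-refl x , match-refl x)
... | no ne    = inj₂ (x , y , refl , refl , ne)

mismatch : ∀ {n} (p : Maybe (Fin n)) x → match p x ≡ false → ∃ λ y → p ≡ just y × y ≢ x
mismatch (just y) x e = y , refl , ⌊⌋-false {P? = y Fin.≟ x} e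

distinct : ∀ {n} → Fin n → Fin n → Bool
distinct x y = not ⌊ x Fin.≟ y ⌋

distinct⁺ : ∀ {n} {x y : Fin n} → x ≢ y → distinct x y ≡ true
distinct⁺ {x = x} {y} ne with x Fin.≟ y
... | yes e = contradiction e ne
... | no _  = refl

distinct⁻ : ∀ {n} {x y : Fin n} → distinct x y ≡ true → x ≢ y
distinct⁻ {x = x} {y} e = ⌊⌋-false {P? = x Fin.≟ y} (𝔹.not-injective e)

-- Two vertices on one side of a crown together miss at most two vertices of the other side, so
-- three indices guarantee a common neighbour.
third : ∀ {n} → 3 ≤ n → (i j : Fin n) → ∃ λ l → l ≢ i × l ≢ j
third (s≤s (s≤s (s≤s _))) zero          zero          = suc zero , (λ ()) , (λ ())
third (s≤s (s≤s (s≤s _))) zero          (suc zero)    = suc (suc zero) , (λ ()) , (λ ())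
third (s≤s (s≤s (s≤s _))) zero          (suc (suc _)) = suc zero , (λ ()) , (λ ())
third (s≤s (s≤s (s≤s _))) (suc zero)    zero          = suc (suc zero) , (λ ()) , (λ ())
third (s≤s (s≤s (s≤s _))) (suc (suc _)) zero          = suc zero , (λ ()) , (λ ())
third (s≤s (s≤s (s≤s _))) (suc _)       (suc _)       = zero , (λ ()) , (λ ())

∑-cartesianProduct : (f : V × W → ℕ) (xs : List V) (ys : List W) →
  ∑ (cartesianProduct xs ys) f ≡ ∑ xs (λ x → ∑ ys (λ y → f (x , y)))
∑-cartesianProduct f []       ys = refl
∑-cartesianProduct f (x ∷ xs) ys =
  trans (∑-++ f (map (x ,_) ys) _) (cong₂ _+_ (∑-map f (x ,_) ys) (∑-cartesianProduct f xs ys))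

sumList : List V → List W → List (V ⊎ W)
sumList xs ys = map inj₁ xs ++ map inj₂ ys

sumList-unique : {xs : List V} {ys : List W} → Unique xs → Unique ys → Unique (sumList xs ys)
sumList-unique {xs = xs} {ys} ux uy = Uniq.++⁺ (Uniq.map⁺ Sum.inj₁-injective ux) (Uniq.map⁺ Sum.inj₂-injective uy) apart
  where
  apart : ∀ {z} → z ∈ₗ map inj₁ xs × z ∈ₗ map inj₂ ys → ⊥
  apart (p , q) with Mem.∈-map⁻ inj₁ p | Mem.∈-map⁻ inj₂ q
  ... | _ , _ , refl | _ , _ , ()

∈-sumList : {xs : List V} {ys : List W} → (∀ x → x ∈ₗ xs) → (∀ y → y ∈ₗ ys) → ∀ z → z ∈ₗ sumList xs ys
∈-sumList all₁ all₂ (inj₁ x)           = Mem.∈-++⁺ˡ (Mem.∈-map⁺ inj₁ (all₁ x))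
∈-sumList {xs = xs} all₁ all₂ (inj₂ y) = Mem.∈-++⁺ʳ (map inj₁ xs) (Mem.∈-map⁺ inj₂ (all₂ y))

∑-sumList : (f : V ⊎ W → ℕ) (xs : List V) (ys : List W) → ∑ (sumList xs ys) f ≡ ∑ xs (f ∘ inj₁) + ∑ ys (f ∘ inj₂)
∑-sumList f xs ys = trans (∑-++ f (map inj₁ xs) (map inj₂ ys)) (cong₂ _+_ (∑-map f inj₁ xs) (∑-map f inj₂ ys))

∑-point : ∀ {n} (x : Fin n) → ∑ (allFin n) (λ y → 𝟙 ⌊ y Fin.≟ x ⌋) ≡ 1
∑-point {n} x = trans (∑-del Fin._≟_ (λ y → 𝟙 ⌊ y Fin.≟ x ⌋) (Uniq.allFin⁺ n) (Mem.∈-allFin x))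
  (cong₂ _+_ (cong 𝟙 (match-refl x)) (trans (∑-cong (del Fin._≟_ x (allFin n)) other) (∑-zero (del Fin._≟_ x (allFin n)))))
  where
  other : ∀ y → y ∈ₗ del Fin._≟_ x (allFin n) → 𝟙 ⌊ y Fin.≟ x ⌋ ≡ 0
  other y y∈ with y Fin.≟ x
  ... | yes e = contradiction e (proj₂ (∈-del⁻ Fin._≟_ {xs = allFin n} y∈))
  ... | no _  = refl

-- A triangle-saturated graph with an independent set of l k² vertices (x , m , i) of degree 6 + q and
-- only O(l² + k³) further edges.  In the core, α x is joined to β y for x ≠ y, and a m i is joined to
-- b j for i ≠ j and to z m′ for m ≠ m′.  The vertex (x , m , i) is joined to all iso, to the non-adjacent
-- pair α x, β x and to the independent triple a m i, b i, z m: it fits a core vertex if it agrees with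
-- all of its indices.
module Example (q l k : ℕ) (3≤l : 3 ≤ l) (3≤k : 3 ≤ k) where

  Core Vx : Set
  Core = (Fin (suc q) ⊎ (Fin l ⊎ Fin l)) ⊎ ((Fin k × Fin k) ⊎ (Fin k ⊎ Fin k))
  Vx   = Core ⊎ (Fin l × Fin k × Fin k)

  pattern iso i = inj₁ (inj₁ i)
  pattern α x   = inj₁ (inj₂ (inj₁ x))
  pattern β x   = inj₁ (inj₂ (inj₂ x))
  pattern a m i = inj₂ (inj₁ (m , i))
  pattern b i   = inj₂ (inj₂ (inj₁ i))
  pattern z m   = inj₂ (inj₂ (inj₂ m))

  _≟ᶜ_ : DecidableEquality Core
  _≟ᶜ_ = Sum.≡-dec (Sum.≡-dec Fin._≟_ (Sum.≡-dec Fin._≟_ Fin._≟_))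
           (Sum.≡-dec (×.≡-dec Fin._≟_ Fin._≟_) (Sum.≡-dec Fin._≟_ Fin._≟_))

  _≟ᵛ_ : DecidableEquality Vx
  _≟ᵛ_ = Sum.≡-dec _≟ᶜ_ (×.≡-dec Fin._≟_ (×.≡-dec Fin._≟_ Fin._≟_))

  half : Core → Core → Bool
  half (α x)   (β y)  = distinct x y
  half (a m i) (b j)  = distinct i j
  half (a m i) (z m′) = distinct m m′
  half _       _      = false

  data Edge : Core → Core → Set where
    αβ : ∀ {x y} → x ≢ y → Edge (α x) (β y)
    ab : ∀ {m i j} → i ≢ j → Edge (a m i) (b j)
    az : ∀ {m m′ i} → m ≢ m′ → Edge (a m i) (z m′)

  half⇒Edge : ∀ u w → half u w ≡ true → Edge u w
  half⇒Edge (α x)   (β y)  e = αβ (distinct⁻ e)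
  half⇒Edge (a m i) (b j)  e = ab (distinct⁻ e)
  half⇒Edge (a m i) (z m′) e = az (distinct⁻ e)
  half⇒Edge (iso _) (inj₁ _) ()
  half⇒Edge (iso _) (inj₂ _) ()
  half⇒Edge (α _) (iso _) ()
  half⇒Edge (α _) (α _) ()
  half⇒Edge (α _) (inj₂ _) ()
  half⇒Edge (β _) (inj₁ _) ()
  half⇒Edge (β _) (inj₂ _) ()
  half⇒Edge (a _ _) (inj₁ _) ()
  half⇒Edge (a _ _) (a _ _) ()
  half⇒Edge (b _) (inj₁ _) ()
  half⇒Edge (b _) (inj₂ _) ()
  half⇒Edge (z _) (inj₁ _) ()
  half⇒Edge (z _) (inj₂ _) ()

  reqX : Core → Maybe (Fin l)
  reqX (α x) = just x
  reqX (β x) = just x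
  reqX _     = nothing

  reqM reqI : Core → Maybe (Fin k)
  reqM (a m i) = just m
  reqM (z m)   = just m
  reqM _       = nothing
  reqI (a m i) = just i
  reqI (b i)   = just i
  reqI _       = nothing

  fits : Fin l × Fin k × Fin k → Core → Bool
  fits (x , m , i) u = match (reqX u) x ∧ (match (reqM u) m ∧ match (reqI u) i)

  A : Vx → Vx → Bool
  A (inj₁ u) (inj₁ w) = half u w ∨ half w u
  A (inj₁ u) (inj₂ τ) = fits τ u
  A (inj₂ σ) (inj₁ w) = fits σ w
  A (inj₂ σ) (inj₂ τ) = false

  symA : Sym A
  symA (inj₁ u) (inj₁ w) = 𝔹.∨-comm (half u w) (half w u)
  symA (inj₁ u) (inj₂ τ) = refl
  symA (inj₂ σ) (inj₁ w) = refl
  symA (inj₂ σ) (inj₂ τ) = refl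

  Adjacent : Core → Core → Set
  Adjacent u w = Edge u w ⊎ Edge w u

  adjacent : ∀ u w → A (inj₁ u) (inj₁ w) ≡ true → Adjacent u w
  adjacent u w e with half u w in p
  ... | true  = inj₁ (half⇒Edge u w p)
  ... | false = inj₂ (half⇒Edge w u e)

  irrA : Irr A
  irrA (inj₂ σ) = refl
  irrA (inj₁ u) with A (inj₁ u) (inj₁ u) in e
  ... | false = refl
  ... | true with adjacent u u e
  ...   | inj₁ ()
  ...   | inj₂ ()

  side : Core → Bool
  side (β _) = true
  side (b _) = true
  side (z _) = true
  side _     = false

  side-half : ∀ {u w} → Edge u w → side u ≡ false × side w ≡ true
  side-half (αβ _) = refl , refl
  side-half (ab _) = refl , refl
  side-half (az _) = refl , refl

  side-adj : ∀ {u w} → Adjacent u w → side w ≡ not (side u)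
  side-adj (inj₁ e) = let p , r = side-half e in trans r (cong not (sym p))
  side-adj (inj₂ e) = let p , r = side-half e in trans p (cong not (sym r))

  fits-parts : ∀ {x m i} u → fits (x , m , i) u ≡ true →
    match (reqX u) x ≡ true × match (reqM u) m ≡ true × match (reqI u) i ≡ true
  fits-parts {x} {m} {i} u e = let p , r = ∧-true {match (reqX u) x} e in p , ∧-true {match (reqM u) m} r

  fits-edge : ∀ σ {u w} → Edge u w → fits σ u ≡ true → fits σ w ≡ true → ⊥
  fits-edge σ@(x , m , i) {u} {w} e p r with fits-parts {x} {m} {i} u p | fits-parts {x} {m} {i} w r
  fits-edge σ (αβ ne) _ _ | p , _ | r , _ = ne (trans (match⇒≡ p) (sym (match⇒≡ r)))
  fits-edge σ (ab ne) _ _ | _ , _ , p | _ , _ , r = ne (trans (match⇒≡ p) (sym (match⇒≡ r)))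
  fits-edge σ (az ne) _ _ | _ , p , _ | _ , r , _ = ne (trans (match⇒≡ p) (sym (match⇒≡ r)))

  fits-adj : ∀ σ {u w} → A (inj₁ u) (inj₁ w) ≡ true → fits σ u ≡ true → fits σ w ≡ true → ⊥
  fits-adj σ {u} {w} e p r = [ (λ d → fits-edge σ d p r) , (λ d → fits-edge σ d r p) ]′ (adjacent u w e)

  -- The core is bipartite by `side`, the core vertices that fit a given triple are pairwise
  -- non-adjacent, and so are the triples.
  noTriangle : ∀ x y w → A x y ≡ true → A x w ≡ true → A y w ≡ true → ⊥
  noTriangle (inj₁ u) (inj₁ w) (inj₁ y) p r s = contradiction
    (trans (side-adj (adjacent u y r)) (sym (side-adj (adjacent u w p))))
    (λ e → not-fixed (trans (sym e) (side-adj (adjacent w y s))))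
    where
    not-fixed : ∀ {b} → b ≢ not b
    not-fixed {true}  ()
    not-fixed {false} ()
  noTriangle (inj₂ σ) (inj₁ u) (inj₁ w) p r s = fits-adj σ {u} {w} s p r
  noTriangle (inj₁ u) (inj₂ σ) (inj₁ w) p r s = fits-adj σ {u} {w} r p s
  noTriangle (inj₁ u) (inj₁ w) (inj₂ σ) p r s = fits-adj σ {u} {w} p r s

  Linked : Vx → Vx → Set
  Linked x y = ∃ λ w → A x w ≡ true × A y w ≡ true

  swap : ∀ x y → Linked x y → Linked y x
  swap x y (w , p , r) = w , r , p

  0k : Fin k
  0k = fromℕ< (≤-trans (s≤s z≤n) 3≤k)
  0l : Fin l
  0l = fromℕ< (≤-trans (s≤s z≤n) 3≤l)

  edge⇒A : ∀ {u w} → Edge u w → A (inj₁ u) (inj₁ w) ≡ true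
  edge⇒A (αβ {x} {y} ne) = cong (_∨ half (β y) (α x)) (distinct⁺ ne)
  edge⇒A (ab {m} {i} {j} ne) = cong (_∨ half (b j) (a m i)) (distinct⁺ ne)
  edge⇒A (az {m} {m′} {i} ne) = cong (_∨ half (z m′) (a m i)) (distinct⁺ ne)

  edge⇒A′ : ∀ {u w} → Edge u w → A (inj₁ w) (inj₁ u) ≡ true
  edge⇒A′ {u} {w} e = trans (symA (inj₁ w) (inj₁ u)) (edge⇒A e)

  data HasX : Core → Fin l → Set where
    αx : ∀ {x} → HasX (α x) x
    βx : ∀ {x} → HasX (β x) x
  data HasM : Core → Fin k → Set where
    am : ∀ {m i} → HasM (a m i) m
    zm : ∀ {m} → HasM (z m) m
  data HasI : Core → Fin k → Set where
    ai : ∀ {m i} → HasI (a m i) i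
    bi : ∀ {i} → HasI (b i) i

  hasX : ∀ {u x} → reqX u ≡ just x → HasX u x
  hasX {α x} refl = αx
  hasX {β x} refl = βx
  hasM : ∀ {u m} → reqM u ≡ just m → HasM u m
  hasM {a m i} refl = am
  hasM {z m} refl = zm
  hasI : ∀ {u i} → reqI u ≡ just i → HasI u i
  hasI {a m i} refl = ai
  hasI {b i} refl = bi

  nonadj : ∀ {u w} → Adjacent u w → A (inj₁ u) (inj₁ w) ≡ false → {X : Set} → X
  nonadj (inj₁ e) f = ⊥-elim (true≢false (edge⇒A e) f)
  nonadj (inj₂ e) f = ⊥-elim (true≢false (edge⇒A′ e) f)

  clashX : ∀ {u w x y} → HasX u x → HasX w y → x ≢ y → A (inj₁ u) (inj₁ w) ≡ false → Linked (inj₁ u) (inj₁ w)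
  clashX {x = x} {y} αx αx ne f = let s , s≢x , s≢y = third 3≤l x y in
    inj₁ (β s) , edge⇒A (αβ (s≢x ∘ sym)) , edge⇒A (αβ (s≢y ∘ sym))
  clashX {x = x} {y} βx βx ne f = let s , s≢x , s≢y = third 3≤l x y in
    inj₁ (α s) , edge⇒A′ (αβ s≢x) , edge⇒A′ (αβ s≢y)
  clashX αx βx ne f = nonadj (inj₁ (αβ ne)) f
  clashX βx αx ne f = nonadj (inj₂ (αβ (ne ∘ sym))) f

  twoA : ∀ {m i m′ i′} → Linked (inj₁ (a m i)) (inj₁ (a m′ i′))
  twoA {m} {i} {m′} {i′} = let s , s≢i , s≢i′ = third 3≤k i i′ in
    inj₁ (b s) , edge⇒A (ab {m} (s≢i ∘ sym)) , edge⇒A (ab {m′} (s≢i′ ∘ sym))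

  clashM : ∀ {u w m m′} → HasM u m → HasM w m′ → m ≢ m′ → A (inj₁ u) (inj₁ w) ≡ false → Linked (inj₁ u) (inj₁ w)
  clashM am am ne f = twoA
  clashM {m = m} {m′} zm zm ne f = let s , s≢m , s≢m′ = third 3≤k m m′ in
    inj₁ (a s 0k) , edge⇒A′ (az {i = 0k} s≢m) , edge⇒A′ (az {i = 0k} s≢m′)
  clashM (am {m} {i}) zm ne f = nonadj (inj₁ (az {i = i} ne)) f
  clashM zm (am {m} {i}) ne f = nonadj (inj₂ (az {i = i} (ne ∘ sym))) f

  clashI : ∀ {u w i j} → HasI u i → HasI w j → i ≢ j → A (inj₁ u) (inj₁ w) ≡ false → Linked (inj₁ u) (inj₁ w)
  clashI ai ai ne f = twoA
  clashI {i = i} {j} bi bi ne f = let s , s≢i , s≢j = third 3≤k i j in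
    inj₁ (a 0k s) , edge⇒A′ (ab {0k} s≢i) , edge⇒A′ (ab {0k} s≢j)
  clashI (ai {m}) bi ne f = nonadj (inj₁ (ab {m} ne)) f
  clashI bi (ai {m}) ne f = nonadj (inj₂ (ab {m} (ne ∘ sym))) f

  fits-self : ∀ {x m i} u → match (reqX u) x ≡ true → match (reqM u) m ≡ true → match (reqI u) i ≡ true →
    fits (x , m , i) u ≡ true
  fits-self u p r s = cong₂ _∧_ p (cong₂ _∧_ r s)

  -- If the two vertices agree in every index that both carry, some triple fits both. Otherwise they
  -- clash in an index; being non-adjacent, they are then of the same kind there and have a common
  -- neighbour in the core.
  linkedHH : ∀ u w → A (inj₁ u) (inj₁ w) ≡ false → Linked (inj₁ u) (inj₁ w)
  linkedHH u w f with compat 0l (reqX u) (reqX w) | compat 0k (reqM u) (reqM w) | compat 0k (reqI u) (reqI w)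
  ... | inj₁ (x , p , p′) | inj₁ (m , r , r′) | inj₁ (i , s , s′) =
    inj₂ (x , m , i) , fits-self {x} {m} {i} u p r s , fits-self {x} {m} {i} w p′ r′ s′
  ... | inj₂ (x , y , p , r , ne) | _ | _ = clashX (hasX p) (hasX r) ne f
  ... | _ | inj₂ (x , y , p , r , ne) | _ = clashM (hasM p) (hasM r) ne f
  ... | _ | _ | inj₂ (x , y , p , r , ne) = clashI (hasI p) (hasI r) ne f

  linkedIX : ∀ {x m i u y} → HasX u y → y ≢ x → Linked (inj₂ (x , m , i)) (inj₁ u)
  linkedIX {x} {m} {i} αx ne = inj₁ (β x) , fits-self {x} {m} {i} (β x) (match-refl x) refl refl , edge⇒A (αβ ne)
  linkedIX {x} {m} {i} βx ne = inj₁ (α x) , fits-self {x} {m} {i} (α x) (match-refl x) refl refl , edge⇒A′ (αβ (ne ∘ sym))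

  linkedIM : ∀ {x m i u y} → HasM u y → y ≢ m → Linked (inj₂ (x , m , i)) (inj₁ u)
  linkedIM {x} {m} {i} (am {i = i′}) ne = inj₁ (z m) , fits-self {x} {m} {i} (z m) refl (match-refl m) refl , edge⇒A (az {i = i′} ne)
  linkedIM {x} {m} {i} zm ne = inj₁ (a m i) , fits-self {x} {m} {i} (a m i) refl (match-refl m) (match-refl i) , edge⇒A′ (az {i = i} (ne ∘ sym))

  linkedII : ∀ {x m i u y} → HasI u y → y ≢ i → Linked (inj₂ (x , m , i)) (inj₁ u)
  linkedII {x} {m} {i} (ai {m′}) ne = inj₁ (b i) , fits-self {x} {m} {i} (b i) refl refl (match-refl i) , edge⇒A (ab {m′} ne)
  linkedII {x} {m} {i} bi ne = inj₁ (a m i) , fits-self {x} {m} {i} (a m i) refl (match-refl m) (match-refl i) , edge⇒A′ (ab {m} (ne ∘ sym))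

  linkedI : ∀ σ u → fits σ u ≡ false → Linked (inj₂ σ) (inj₁ u)
  linkedI (x , m , i) u f with match (reqX u) x in p | match (reqM u) m in r | match (reqI u) i in s
  ... | false | _ | _ = let y , e , ne = mismatch (reqX u) x p in linkedIX (hasX e) ne
  ... | true | false | _ = let y , e , ne = mismatch (reqM u) m r in linkedIM (hasM e) ne
  ... | true | true | false = let y , e , ne = mismatch (reqI u) i s in linkedII (hasI e) ne

  linked : ∀ x y → A x y ≡ false → Linked x y
  linked (inj₁ u) (inj₁ w) f = linkedHH u w f
  linked (inj₁ u) (inj₂ σ) f = swap (inj₂ σ) (inj₁ u) (linkedI σ u f)
  linked (inj₂ σ) (inj₁ u) f = linkedI σ u f
  -- The vertices `iso` fit every triple. Having q + 1 of them ensures that there is at least one.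
  linked (inj₂ σ) (inj₂ τ) f = inj₁ (iso zero) , refl , refl

  pairs : List (Fin k × Fin k)
  pairs = cartesianProduct (allFin k) (allFin k)

  crowns : List (Fin l ⊎ Fin l)
  crowns = sumList (allFin l) (allFin l)

  cores : List Core
  cores = sumList (sumList (allFin (suc q)) crowns) (sumList pairs (sumList (allFin k) (allFin k)))

  triples : List (Fin l × Fin k × Fin k)
  triples = cartesianProduct (allFin l) pairs

  hs is : List Vx
  hs = map inj₁ cores
  is = map inj₂ triples

  ∑-cores : ∀ f → ∑ cores f ≡
    (∑ (allFin (suc q)) (λ i → f (iso i)) + (∑ (allFin l) (λ x → f (α x)) + ∑ (allFin l) (λ x → f (β x)))) +
    (∑ (allFin k) (λ m → ∑ (allFin k) (λ i → f (a m i))) + (∑ (allFin k) (λ i → f (b i)) + ∑ (allFin k) (λ m → f (z m))))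
  ∑-cores f = trans (∑-sumList f (sumList (allFin (suc q)) crowns) (sumList pairs (sumList (allFin k) (allFin k)))) (cong₂ _+_
    (trans (∑-sumList (f ∘ inj₁) (allFin (suc q)) crowns)
      (cong (∑ (allFin (suc q)) (λ i → f (iso i)) +_) (∑-sumList (f ∘ inj₁ ∘ inj₂) (allFin l) (allFin l))))
    (trans (∑-sumList (f ∘ inj₂) pairs (sumList (allFin k) (allFin k)))
      (cong₂ _+_ (∑-cartesianProduct (f ∘ inj₂ ∘ inj₁) (allFin k) (allFin k)) (∑-sumList (f ∘ inj₂ ∘ inj₂) (allFin k) (allFin k)))))

  ∑-cores≤ : ∀ f c₁ c₂ c₃ c₄ c₅ c₆ → (∀ i → f (iso i) ≤ c₁) → (∀ x → f (α x) ≤ c₂) → (∀ x → f (β x) ≤ c₃) →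
    (∀ m i → f (a m i) ≤ c₄) → (∀ i → f (b i) ≤ c₅) → (∀ m → f (z m) ≤ c₆) →
    ∑ cores f ≤ (suc q * c₁ + (l * c₂ + l * c₃)) + (k * (k * c₄) + (k * c₅ + k * c₆))
  ∑-cores≤ f c₁ c₂ c₃ c₄ c₅ c₆ h₁ h₂ h₃ h₄ h₅ h₆ = ≤-trans (≤-reflexive (∑-cores f))
    (+-mono-≤ (+-mono-≤ (over h₁) (+-mono-≤ (over h₂) (over h₃)))
      (+-mono-≤ (over (λ m → over (h₄ m))) (+-mono-≤ (over h₅) (over h₆))))
    where
    over : ∀ {n c} {g : Fin n → ℕ} → (∀ i → g i ≤ c) → ∑ (allFin n) g ≤ n * c
    over {n} {c} h = ≤-trans (∑-bound (allFin n) (λ i _ → h i)) (≤-reflexive (cong (_* c) (List.length-tabulate {n = n} id)))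

  length-cores : length cores ≡ (suc q + (l + l)) + (k * k + (k + k))
  length-cores = trans (length-∑ cores) (trans (∑-cores (λ _ → 1))
    (cong₂ _+_ (cong₂ _+_ (ones (suc q)) (cong₂ _+_ (ones l) (ones l)))
      (cong₂ _+_ (trans (∑-cong (allFin k) (λ _ _ → ones k)) (trans (∑-const k (allFin k)) (cong (_* k) (List.length-tabulate {n = k} id))))
        (cong₂ _+_ (ones k) (ones k)))))
    where
    ones : ∀ n → ∑ (allFin n) (λ _ → 1) ≡ n
    ones n = trans (∑-const 1 (allFin n)) (trans (*-identityʳ _) (List.length-tabulate {n = n} id))

  E-cores : E hs A ≤ 2 * (l * l + 2 * (k * k * k))
  E-cores = begin
    E hs A
      ≡⟨ trans (∑-map (λ x → ∑ hs (𝟙 ∘ A x)) inj₁ cores) (∑-cong cores (λ u _ → ∑-map (𝟙 ∘ A (inj₁ u)) inj₁ cores)) ⟩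
    ∑ cores (λ u → ∑ cores (λ w → 𝟙 (half u w ∨ half w u)))
      ≤⟨ ∑-mono cores (λ u _ → ∑-mono cores (λ w _ → 𝟙-∨ (half u w) (half w u))) ⟩
    ∑ cores (λ u → ∑ cores (λ w → 𝟙 (half u w) + 𝟙 (half w u)))
      ≡⟨ trans (∑-cong cores (λ u _ → ∑-+ (𝟙 ∘ half u) (λ w → 𝟙 (half w u)) cores)) (trans (∑-+ row (λ u → ∑ cores (λ w → 𝟙 (half w u))) cores)
          (cong (∑ cores row +_) (∑-swap (λ u w → 𝟙 (half w u)) cores cores))) ⟩
    ∑ cores row + ∑ cores row
      ≤⟨ +-mono-≤ total total ⟩
    (l * l + 2 * (k * k * k)) + (l * l + 2 * (k * k * k))
      ≡⟨ cong (l * l + 2 * (k * k * k) +_) (sym (+-identityʳ _)) ⟩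
    2 * (l * l + 2 * (k * k * k)) ∎
    where
    open ℕ.≤-Reasoning
    row : Core → ℕ
    row u = ∑ cores (λ w → 𝟙 (half u w))
    none : ∀ u → (∀ w → half u w ≡ false) → row u ≤ 0
    none u h = ≤-reflexive (trans (∑-cong cores (λ w _ → cong 𝟙 (h w))) (∑-zero cores))
    isoRow : ∀ i w → half (iso i) w ≡ false
    isoRow i (inj₁ _) = refl
    isoRow i (inj₂ _) = refl
    βRow : ∀ i w → half (β i) w ≡ false
    βRow i (inj₁ _) = refl
    βRow i (inj₂ _) = refl
    bRow : ∀ i w → half (b i) w ≡ false
    bRow i (inj₁ _) = refl
    bRow i (inj₂ _) = refl
    zRow : ∀ i w → half (z i) w ≡ false
    zRow i (inj₁ _) = refl
    zRow i (inj₂ _) = refl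
    αRow : ∀ x → row (α x) ≤ l
    αRow x = ≤-trans (∑-cores≤ (𝟙 ∘ half (α x)) 0 0 1 0 0 0 (λ _ → z≤n) (λ _ → z≤n) (λ _ → 𝟙≤1 _) (λ _ _ → z≤n) (λ _ → z≤n) (λ _ → z≤n))
      (≤-reflexive (lem (suc q) l k))
      where
      lem : ∀ q l k → (q * 0 + (l * 0 + l * 1)) + (k * (k * 0) + (k * 0 + k * 0)) ≡ l
      lem = solve-∀
    aRow : ∀ m i → row (a m i) ≤ 2 * k
    aRow m i = ≤-trans (∑-cores≤ (𝟙 ∘ half (a m i)) 0 0 0 0 1 1 (λ _ → z≤n) (λ _ → z≤n) (λ _ → z≤n) (λ _ _ → z≤n) (λ _ → 𝟙≤1 _) (λ _ → 𝟙≤1 _))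
      (≤-reflexive (lem (suc q) l k))
      where
      lem : ∀ q l k → (q * 0 + (l * 0 + l * 0)) + (k * (k * 0) + (k * 1 + k * 1)) ≡ 2 * k
      lem = solve-∀
    total : ∑ cores row ≤ l * l + 2 * (k * k * k)
    total = ≤-trans (∑-cores≤ row 0 l 0 (2 * k) 0 0 (λ i → none (iso i) (isoRow i)) αRow (λ i → none (β i) (βRow i)) aRow
        (λ i → none (b i) (bRow i)) (λ i → none (z i) (zRow i)))
      (≤-reflexive (lem (suc q) l k))
      where
      lem : ∀ q l k → (q * 0 + (l * l + l * 0)) + (k * (k * (2 * k)) + (k * 0 + k * 0)) ≡ l * l + 2 * (k * k * k)
      lem = solve-∀

  -- A triple is joined to the q + 1 vertices `iso` and to exactly one vertex of each of the kinds
  -- `α`, `β`, `a`, `b`, `z`.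
  degree : ∀ σ → ∑ cores (𝟙 ∘ fits σ) ≡ 6 + q
  degree (x , m , i) = trans (∑-cores (𝟙 ∘ fits (x , m , i))) (trans (cong₂ _+_
    (cong₂ _+_ isos (cong₂ _+_ (pt x) (pt x)))
    (cong₂ _+_ as (cong₂ _+_ (∑-point i) (pt m)))) (arith q))
    where
    arith : ∀ q → suc q + 2 + 3 ≡ 6 + q
    arith = solve-∀
    isos : ∑ (allFin (suc q)) (λ _ → 1) ≡ suc q
    isos = trans (∑-const 1 (allFin (suc q))) (trans (*-identityʳ _) (List.length-tabulate {n = suc q} id))
    pt : ∀ {n} (x : Fin n) → ∑ (allFin n) (λ y → 𝟙 (⌊ y Fin.≟ x ⌋ ∧ true)) ≡ 1
    pt {n} x = trans (∑-cong (allFin n) (λ y _ → cong 𝟙 (𝔹.∧-identityʳ ⌊ y Fin.≟ x ⌋))) (∑-point x)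
    inner : ∀ c → ∑ (allFin k) (λ i′ → 𝟙 (c ∧ ⌊ i′ Fin.≟ i ⌋)) ≡ 𝟙 c
    inner true  = ∑-point i
    inner false = ∑-zero (allFin k)
    as : ∑ (allFin k) (λ m′ → ∑ (allFin k) (λ i′ → 𝟙 (⌊ m′ Fin.≟ m ⌋ ∧ ⌊ i′ Fin.≟ i ⌋))) ≡ 1
    as = trans (∑-cong (allFin k) (λ m′ _ → inner ⌊ m′ Fin.≟ m ⌋)) (∑-point m)

  separated : ∀ σ τ → σ ≢ τ → ∃ λ u → fits σ u ≢ fits τ u
  separated (x , m , i) (y , m′ , i′) ne with x Fin.≟ y | m Fin.≟ m′ | i Fin.≟ i′
  ... | yes refl | yes refl | yes refl = contradiction refl ne
  ... | no x≢y | _ | _ = α x , λ e →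
    x≢y (match⇒≡ (proj₁ (fits-parts {y} {m′} {i′} (α x) (trans (sym e) (fits-self {x} {m} {i} (α x) (match-refl x) refl refl)))))
  ... | yes _ | no m≢m′ | _ = z m , λ e →
    m≢m′ (match⇒≡ (proj₁ (proj₂ (fits-parts {y} {m′} {i′} (z m) (trans (sym e) (fits-self {x} {m} {i} (z m) refl (match-refl m) refl))))))
  ... | yes _ | yes _ | no i≢i′ = b i , λ e →
    i≢i′ (match⇒≡ (proj₂ (proj₂ (fits-parts {y} {m′} {i′} (b i) (trans (sym e) (fits-self {x} {m} {i} (b i) refl refl (match-refl i)))))))

  ∈pairs : ∀ p → p ∈ₗ pairs
  ∈pairs (m , i) = Mem.∈-cartesianProduct⁺ (Mem.∈-allFin m) (Mem.∈-allFin i)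

  ∈cores : ∀ u → u ∈ₗ cores
  ∈cores = ∈-sumList (∈-sumList Mem.∈-allFin (∈-sumList Mem.∈-allFin Mem.∈-allFin))
             (∈-sumList ∈pairs (∈-sumList Mem.∈-allFin Mem.∈-allFin))

  ∈V : ∀ v → In hs is v
  ∈V (inj₁ u)       = inj₁ (Mem.∈-map⁺ inj₁ (∈cores u))
  ∈V (inj₂ (x , p)) = inj₂ (Mem.∈-map⁺ inj₂ (Mem.∈-cartesianProduct⁺ (Mem.∈-allFin x) (∈pairs p)))

  split : SplitGraph 1 (6 + q) A hs is
  split = record
    { symm = symA ; irre = irrA
    ; uniqH = Uniq.map⁺ Sum.inj₁-injective (sumList-unique
        (sumList-unique (Uniq.allFin⁺ (suc q)) (sumList-unique (Uniq.allFin⁺ l) (Uniq.allFin⁺ l)))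
        (sumList-unique uniqPairs (sumList-unique (Uniq.allFin⁺ k) (Uniq.allFin⁺ k))))
    ; uniqI = Uniq.map⁺ Sum.inj₂-injective (Uniq.cartesianProduct⁺ (Uniq.allFin⁺ l) uniqPairs)
    ; disj = disj′
    ; noK = λ (x , _ , y , (_ , p) , w , ((_ , r) , s) , _) → noTriangle x y w p r s
    ; sat = λ {x} {y} _ _ _ f → let w , p , r = linked x y f in w , (∈V w , p , r) , tt
    ; indep = indep′ ; degI = degI′ ; dist = dist′ }
    where
    uniqPairs : Unique pairs
    uniqPairs = Uniq.cartesianProduct⁺ (Uniq.allFin⁺ k) (Uniq.allFin⁺ k)
    disj′ : ∀ {v} → v ∈ₗ hs → v ∈ₗ is → ⊥
    disj′ p r with Mem.∈-map⁻ inj₁ p | Mem.∈-map⁻ inj₂ r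
    ... | _ , _ , refl | _ , _ , ()
    indep′ : ∀ {x y} → x ∈ₗ is → y ∈ₗ is → A x y ≡ false
    indep′ p r with Mem.∈-map⁻ inj₂ p | Mem.∈-map⁻ inj₂ r
    ... | _ , _ , refl | _ , _ , refl = refl
    degI′ : ∀ {x} → x ∈ₗ is → ∑ hs (𝟙 ∘ A x) ≡ 6 + q
    degI′ p with Mem.∈-map⁻ inj₂ p
    ... | σ , _ , refl = trans (∑-map (𝟙 ∘ A (inj₂ σ)) inj₁ cores) (degree σ)
    dist′ : ∀ {x y} → x ∈ₗ is → y ∈ₗ is → x ≢ y → ∃ λ h → h ∈ₗ hs × A x h ≢ A y h
    dist′ p r ne with Mem.∈-map⁻ inj₂ p | Mem.∈-map⁻ inj₂ r
    ... | σ , _ , refl | τ , _ , refl = let u , d = separated σ τ (ne ∘ cong inj₂) in inj₁ u , Mem.∈-map⁺ inj₁ (∈cores u) , d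

  length-hs : length hs ≡ (suc q + (l + l)) + (k * k + (k + k))
  length-hs = trans (List.length-map inj₁ cores) length-cores

  length-is : length is ≡ l * (k * k)
  length-is = trans (List.length-map inj₂ triples) (trans (length-cartesianProduct (allFin l) pairs)
    (cong₂ _*_ (List.length-tabulate {n = l} id) (trans (length-cartesianProduct (allFin k) (allFin k))
      (cong₂ _*_ (List.length-tabulate {n = k} id) (List.length-tabulate {n = k} id)))))

-- Systems with o(s) edges for all large s

record Realisation (c t s v e : ℕ) : Set₁ where
  field
    {Vertex} : Set
    _≟_      : DecidableEquality Vertex
    {A}      : Vertex → Vertex → Bool
    {hs is}  : List Vertex
    split    : SplitGraph c t A hs is
    sizeI    : length is ≡ s
    sizeH    : length hs ≡ v
    sizeE    : E hs A ≤ e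

cones : ∀ {t s v e} ρ → Realisation 1 t s v e → Realisation (suc ρ) (ρ + t) s (ρ + v) (e + 2 * (ρ * (ρ + v)))
cones {e = e} zero R = record
  { _≟_ = _≟_ ; split = split ; sizeI = sizeI ; sizeH = sizeH ; sizeE = ≤-trans sizeE (m≤m+n _ _) }
  where open Realisation R
cones {v = v} {e} (suc ρ) R = record
  { _≟_ = _≟°_ ; split = Cone.split _≟_ split
  ; sizeI = trans (List.length-map just is) sizeI ; sizeH = cong suc (trans (List.length-map just hs) sizeH)
  ; sizeE = begin
      E hs° A° ≡⟨ E° ⟩
      E hs A + 2 * length hs ≤⟨ +-mono-≤ sizeE (≤-reflexive (cong (2 *_) sizeH)) ⟩
      e + 2 * (ρ * (ρ + v)) + 2 * (ρ + v) ≤⟨ m≤m+n _ (2 * suc ρ) ⟩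
      e + 2 * (ρ * (ρ + v)) + 2 * (ρ + v) + 2 * suc ρ ≡⟨ arith e ρ v ⟩
      e + 2 * (suc ρ * (suc ρ + v)) ∎ }
  where
  open Realisation (cones ρ R)
  open Cone _≟_ split hiding (split)
  open ℕ.≤-Reasoning
  arith : ∀ e ρ v → e + 2 * (ρ * (ρ + v)) + 2 * (ρ + v) + 2 * suc ρ ≡ e + 2 * (suc ρ * (suc ρ + v))
  arith = solve-∀

thinned : ∀ {ρ t s d v e} → Realisation (suc ρ) t (s + d) v e → Realisation (suc ρ) t s v (e + d * (2 * (t * t)))
thinned {d = d} R =
  let _ , _ , S , len , e≤ = thin _≟_ d split sizeI
  in record { _≟_ = _≟_ ; split = S ; sizeI = len ; sizeH = sizeH ; sizeE = ≤-trans e≤ (+-monoˡ-≤ _ sizeE) }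
  where open Realisation R

SystemWith : ℕ → ℕ → ℕ → ℕ → Set
SystemWith r t s m = Σ ℕ λ v → Σ (Graph v) λ H → Σ (List (Subset v)) λ F →
  IsMaximalRTSystem r t H F × length F ≡ s × edges H ≡ m

realised : ∀ {c t s v e} → Realisation c t s v e → ∃ λ m → SystemWith (2 + c) t s m × 2 * m ≤ e
realised R = edges (core split) ,
  (_ , core split , family split , maximalSystem split , trans (List.length-map (trace split) is) sizeI , refl) ,
  ≤-trans (≤-reflexive (edges-induce (SplitGraph.symm split) (SplitGraph.irre split) hs)) sizeE
  where open Realisation R

example : ∀ q l k → 3 ≤ l → 3 ≤ k →
  Realisation 1 (6 + q) (l * (k * k)) ((suc q + (l + l)) + (k * k + (k + k))) (2 * (l * l + 2 * (k * k * k)))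
example q l k 3≤l 3≤k = record
  { _≟_ = _≟ᵛ_ ; split = split ; sizeI = length-is ; sizeH = length-hs ; sizeE = E-cores }
  where open Example q l k 3≤l 3≤k

cube : ℕ → ℕ
cube k = k * k * k

cube-mono : ∀ {a b} → a ≤ b → cube a ≤ cube b
cube-mono le = *-mono-≤ (*-mono-≤ le le) le

cube-suc : ∀ k → cube k < cube (suc k)
cube-suc k = ℕ.*-mono-< {k * k} {suc k * suc k} (ℕ.*-mono-< (ℕ.n<1+n k) (ℕ.n<1+n k)) (ℕ.n<1+n k)

cubeRoot : ∀ {C} → 1 ≤ C → ∀ s → ∃ λ k → C * cube k ≤ s × s < C * cube (suc k)
cubeRoot {C} 1≤C zero    = 0 , ≤-reflexive (ℕ.*-zeroʳ C) , *-mono-≤ 1≤C (s≤s z≤n)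
cubeRoot {C} 1≤C (suc s) with cubeRoot 1≤C s
... | k , lo , hi with C * cube (suc k) ≤? suc s
...   | yes le = suc k , le , ℕ.≤-<-trans hi (ℕ.*-monoʳ-< C ⦃ >-nonZero 1≤C ⦄ (cube-suc (suc k)))
...   | no ¬le = k , ≤-trans lo (n≤1+n s) , ≰⇒> ¬le

-- The rounding is strict, so d = n when n divides s. In return the predecessor `l` always satisfies
-- `l * n ≤ s`, from which the crown size is bounded.
ceiling : ∀ s {n} → 1 ≤ n → ∃ λ l → ∃ λ d → suc l * n ≡ s + d × d ≤ n × l * n ≤ s
ceiling s {suc n′} _ = s / n , n ∸ s % n , exact , ℕ.m∸n≤m n (s % n) ,
  ≤-trans (m≤n+m _ (s % n)) (≤-reflexive (sym (m≡m%n+[m/n]*n s n)))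
  where
  n = suc n′
  open ≡-Reasoning
  arith : ∀ a b c → (a + b) + c ≡ (a + c) + b
  arith = solve-∀
  exact : n + s / n * n ≡ s + (n ∸ s % n)
  exact = begin
    n + s / n * n ≡⟨ cong (_+ s / n * n) (sym (ℕ.m+[n∸m]≡n (<⇒≤ (m%n<n s n)))) ⟩
    (s % n + (n ∸ s % n)) + s / n * n ≡⟨ arith (s % n) (n ∸ s % n) (s / n * n) ⟩
    (s % n + s / n * n) + (n ∸ s % n) ≡⟨ cong (_+ (n ∸ s % n)) (sym (m≡m%n+[m/n]*n s n)) ⟩
    s + (n ∸ s % n) ∎

-- With k ≈ (s/C)^(1/3) the crown has size l = O(k), so that l k² ≈ s while there are O(k³) = O(s/C) edges.
module SmallSystem (ρ q t C Λ Bd k s l′ d : ℕ) (t≡ : ρ + (6 + q) ≡ t) (1≤C : 1 ≤ C) (Λ≡ : Λ ≡ 8 * C)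
  (Bd≡ : Bd ≡ 2 * (Λ * Λ) + 2 * (ρ * (ρ + suc q + 2 * Λ + 3)) + 2 * (t * t))
  (lo : C * cube k ≤ s) (hi : s < C * cube (suc k)) (big : Bd + 3 ≤ k)
  (s≡ : suc l′ * (k * k) ≡ s + d) (d≤ : d ≤ k * k) (l′≤ : l′ * (k * k) ≤ s) where

  private
    open ℕ.≤-Reasoning
    l = suc l′
    n = k * k
    3≤k : 3 ≤ k
    3≤k = ≤-trans (m≤n+m 3 Bd) big
    1≤k : 1 ≤ k
    1≤k = ≤-trans (s≤s z≤n) 3≤k
    instance
      k≢0 = >-nonZero 1≤k
    k≤n : k ≤ n
    k≤n = ℕ.m≤m*n k k
    1≤n : 1 ≤ n
    1≤n = ≤-trans 1≤k k≤n
    k≤l : k ≤ l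
    k≤l = ℕ.*-cancelʳ-≤ k l n ⦃ >-nonZero 1≤n ⦄ (begin
      k * n ≡⟨ ℕ.*-assoc k k k ⟨
      cube k ≡⟨ ℕ.*-identityˡ (cube k) ⟨
      1 * cube k ≤⟨ *-monoˡ-≤ (cube k) 1≤C ⟩
      C * cube k ≤⟨ lo ⟩
      s ≤⟨ m≤m+n s d ⟩
      s + d ≡⟨ s≡ ⟨
      l * n ∎)
    -- The factor 8 in `Λ` comes from k + 1 ≤ 2k, and the strict inequality in `hi` pays for the
    -- step from `l′` to its successor.
    l≤ : l ≤ Λ * k
    l≤ = ℕ.*-cancelʳ-< n l′ (Λ * k) (begin-strict
      l′ * n ≤⟨ l′≤ ⟩
      s <⟨ hi ⟩
      C * cube (suc k) ≤⟨ *-monoʳ-≤ C (cube-mono (+-monoˡ-≤ k 1≤k)) ⟩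
      C * cube (k + k) ≡⟨ arith C k ⟩
      8 * C * k * n ≡⟨ cong (λ x → x * k * n) Λ≡ ⟨
      Λ * k * n ∎)
      where
      arith : ∀ C k → C * ((k + k) * (k + k) * (k + k)) ≡ 8 * C * k * (k * k)
      arith = solve-∀
    v = (suc q + (l + l)) + (k * k + (k + k))
    e₁ = 2 * (l * l + 2 * cube k) + 2 * (ρ * (ρ + v))
    l≤n : l ≤ Λ * n
    l≤n = ≤-trans l≤ (*-monoʳ-≤ Λ k≤n)
    v≤ : ρ + v ≤ (ρ + suc q + 2 * Λ + 3) * n
    v≤ = begin
      ρ + v
        ≤⟨ +-mono-≤ (up ρ) (+-mono-≤ (+-mono-≤ (up (suc q)) (+-mono-≤ l≤n l≤n)) (+-monoʳ-≤ n (+-mono-≤ k≤n k≤n))) ⟩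
      ρ * n + ((suc q * n + (Λ * n + Λ * n)) + (n + (n + n))) ≡⟨ arith ρ (suc q) Λ n ⟩
      (ρ + suc q + 2 * Λ + 3) * n ∎
      where
      up : ∀ a → a ≤ a * n
      up a = ≤-trans (≤-reflexive (sym (*-identityʳ a))) (*-monoʳ-≤ a 1≤n)
      arith : ∀ ρ q Λ n → ρ * n + ((q * n + (Λ * n + Λ * n)) + (n + (n + n))) ≡ (ρ + q + 2 * Λ + 3) * n
      arith = solve-∀
    -- Everything of order k², including the l² edges between the `α` and the `β` because l = O(k),
    -- is gathered in Bd k² and absorbed by one more k³, as Bd ≤ k.
    total : e₁ + d * (2 * (t * t)) ≤ 5 * cube k
    total = begin
      e₁ + d * (2 * (t * t))
        ≤⟨ +-mono-≤ (+-mono-≤ (*-monoʳ-≤ 2 (+-monoˡ-≤ (2 * cube k) (*-mono-≤ l≤ l≤))) (*-monoʳ-≤ 2 (*-monoʳ-≤ ρ v≤)))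
             (*-monoˡ-≤ (2 * (t * t)) d≤) ⟩
      2 * (Λ * k * (Λ * k) + 2 * cube k) + 2 * (ρ * ((ρ + suc q + 2 * Λ + 3) * n)) + n * (2 * (t * t))
        ≡⟨ arith Λ k ρ (ρ + suc q + 2 * Λ + 3) (2 * (t * t)) ⟩
      4 * cube k + (2 * (Λ * Λ) + 2 * (ρ * (ρ + suc q + 2 * Λ + 3)) + 2 * (t * t)) * n
        ≡⟨ cong (λ x → 4 * cube k + x * n) (sym Bd≡) ⟩
      4 * cube k + Bd * n ≤⟨ +-monoʳ-≤ (4 * cube k) (*-monoˡ-≤ n (≤-trans (m≤m+n Bd 3) big)) ⟩
      4 * cube k + k * n ≡⟨ arith′ k ⟩
      5 * cube k ∎
      where
      arith : ∀ Λ k ρ x y → 2 * (Λ * k * (Λ * k) + 2 * (k * k * k)) + 2 * (ρ * (x * (k * k))) + k * k * y ≡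
        4 * (k * k * k) + (2 * (Λ * Λ) + 2 * (ρ * x) + y) * (k * k)
      arith = solve-∀
      arith′ : ∀ k → 4 * (k * k * k) + k * (k * k) ≡ 5 * (k * k * k)
      arith′ = solve-∀

  smallRealisation : Realisation (suc ρ) t s (ρ + v) (e₁ + d * (2 * (t * t)))
  smallRealisation = thinned (subst₂ (λ t x → Realisation (suc ρ) t x (ρ + v) e₁) t≡ s≡
    (cones ρ (example q l k (≤-trans 3≤k k≤l) 3≤k)))

  smallSystem : ∃ λ m → SystemWith (3 + ρ) t s m × m ≤ 5 * cube k
  smallSystem = let m , sys , 2m≤ = realised smallRealisation
                in m , sys , ≤-trans (ℕ.m≤n*m m 2) (≤-trans 2m≤ total)

smallSystems : ∀ ρ q t → ρ + (6 + q) ≡ t → ∀ j → ∃ λ N → ∀ s → N ≤ s → ∃ λ m → SystemWith (3 + ρ) t s m × j * m ≤ s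
-- With C = 5j + 5, j times the edge bound 5k³ is at most Ck³ ≤ s; the summand 5 keeps C positive
-- when j = 0.
smallSystems ρ q t t≡ j = with-constants (5 * j + 5) (8 * (5 * j + 5)) _ refl refl refl
  where
  open ℕ.≤-Reasoning
  with-constants : ∀ C Λ Bd → C ≡ 5 * j + 5 → Λ ≡ 8 * C →
    Bd ≡ 2 * (Λ * Λ) + 2 * (ρ * (ρ + suc q + 2 * Λ + 3)) + 2 * (t * t) →
    ∃ λ N → ∀ s → N ≤ s → ∃ λ m → SystemWith (3 + ρ) t s m × j * m ≤ s
  with-constants C Λ Bd C≡ Λ≡ Bd≡ = C * cube (Bd + 3) , build
    where
    1≤C : 1 ≤ C
    1≤C = subst (1 ≤_) (sym C≡) (≤-trans (s≤s z≤n) (m≤n+m 5 (5 * j)))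
    arith : ∀ j c → j * (5 * c) + 5 * c ≡ (5 * j + 5) * c
    arith = solve-∀
    build : ∀ s → C * cube (Bd + 3) ≤ s → ∃ λ m → SystemWith (3 + ρ) t s m × j * m ≤ s
    build s le =
      let k , lo , hi = cubeRoot 1≤C s
          big : Bd + 3 ≤ k
          big = ≮⇒≥ (λ k< → <⇒≱ hi (≤-trans (*-monoʳ-≤ C (cube-mono k<)) le))
          1≤k : 1 ≤ k
          1≤k = ≤-trans (≤-trans (s≤s z≤n) (m≤n+m 3 Bd)) big
          l′ , d , s≡ , d≤ , l′≤ = ceiling s (*-mono-≤ 1≤k 1≤k)
          m , sys , m≤ = SmallSystem.smallSystem ρ q t C Λ Bd k s l′ d t≡ 1≤C Λ≡ Bd≡ lo hi big s≡ d≤ l′≤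
      in m , sys , (begin
        j * m ≤⟨ *-monoʳ-≤ j m≤ ⟩
        j * (5 * cube k) ≤⟨ m≤m+n _ (5 * cube k) ⟩
        j * (5 * cube k) + 5 * cube k ≡⟨ arith j (cube k) ⟩
        (5 * j + 5) * cube k ≡⟨ cong (_* cube k) C≡ ⟨
        C * cube k ≤⟨ lo ⟩
        s ∎)

-- Decidability and minima

minimum : {P : ℕ → Set} → (∀ m → Dec (P m)) → ∀ {k} → P k → ∃ (IsMin P)
minimum {P} P? {k} pk with below (suc k)
  where
  below : ∀ n → ∃ (IsMin P) ⊎ (∀ j → j < n → ¬ P j)
  below zero    = inj₂ (λ _ ())
  below (suc n) with below n
  ... | inj₁ found = inj₁ found
  ... | inj₂ none with P? n
  ...   | yes pn = inj₁ (n , pn , λ j pj → ≮⇒≥ (λ j<n → none j j<n pj))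
  ...   | no ¬pn = inj₂ (λ j j<1+n pj → [ (λ j<n → none j j<n pj) , (λ { refl → ¬pn pj }) ]′ (ℕ.m≤n⇒m<n∨m≡n (s≤s⁻¹ j<1+n)))
... | inj₁ found = found
... | inj₂ none  = contradiction pk (none k ≤-refl)

_≈_ : ∀ {n} → Graph n → Graph n → Set
G ≈ G′ = ∀ i j → adj G i j ≡ adj G′ i j

≈-sym : ∀ {n} {G G′ : Graph n} → G ≈ G′ → G′ ≈ G
≈-sym e i j = sym (e i j)

-- The search runs over bit vectors of length n². A graph is recovered from its vector only up to
-- pointwise equality of adjacency, which is why `Q` has to respect `≈`.
anyGraph? : ∀ {n} {Q : Graph n → Set} → (∀ {G G′} → G ≈ G′ → Q G → Q G′) → (∀ G → Dec (Q G)) → Dec (Σ (Graph n) Q)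
anyGraph? {n} {Q} resp Q? = Dec.map′ fromMatrix toMatrix (Sub.anySubset? matrix?)
  where
  entry : Subset (n * n) → Fin n → Fin n → Bool
  entry M i j = Vec.lookup M (combine i j)
  Matrix : Subset (n * n) → Set
  Matrix M = Σ (Sym (entry M)) λ s → Σ (Irr (entry M)) λ i → Q (record { adj = entry M ; sym = s ; irr = i })
  matrix? : ∀ M → Dec (Matrix M)
  matrix? M with Fin.all? (λ i → Fin.all? (λ j → entry M i j ≟ᵇ entry M j i)) | Fin.all? (λ i → entry M i i ≟ᵇ false)
  ... | no ¬s | _    = no (¬s ∘ proj₁)
  ... | yes _ | no ¬i = no (λ (_ , i , _) → ¬i i)
  ... | yes s | yes i = Dec.map′ (λ q → s , i , q) (λ (_ , _ , q) → resp (λ _ _ → refl) q) (Q? _)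
  fromMatrix : ∃ Matrix → Σ (Graph n) Q
  fromMatrix (M , s , i , q) = _ , q
  toMatrix : Σ (Graph n) Q → ∃ Matrix
  toMatrix (G , q) = M , s , i , resp (λ x y → sym (entry≡ x y)) q
    where
    M = Vec.tabulate (λ p → adj G (proj₁ (Fin.remQuot {n} n p)) (proj₂ (Fin.remQuot {n} n p)))
    entry≡ : ∀ x y → entry M x y ≡ adj G x y
    entry≡ x y = trans (Vec.lookup∘tabulate _ (combine x y)) (cong (λ p → adj G (proj₁ p) (proj₂ p)) (Fin.remQuot-combine x y))
    s : Sym (entry M)
    s x y = trans (entry≡ x y) (trans (Graph.sym G x y) (sym (entry≡ y x)))
    i : Irr (entry M)
    i x = trans (entry≡ x x) (Graph.irr G x)

anyList? : ∀ {v} s {P : List (Subset v) → Set} → (∀ F → Dec (P F)) → Dec (∃ λ F → length F ≡ s × P F)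
anyList? zero    P? = Dec.map′ (λ p → [] , refl , p) (λ { ([] , _ , p) → p }) (P? [])
anyList? (suc s) P? = Dec.map′ (λ (S , F , l , p) → S ∷ F , cong suc l , p)
  (λ { (S ∷ F , l , p) → S , F , ℕ.suc-injective l , p })
  (Sub.anySubset? (λ S → anyList? s (λ F → P? (S ∷ F))))

clique? : ∀ {n} {A : Fin n → Fin n → Bool} → Sym A → Irr A → ∀ S k → Dec (CliqueIn A S k)
clique? {n} {A} sA iA S k = Dec.map′ (K⇒clique sA iA k (λ _ → id)) (clique⇒K k (λ _ → id))
  (K? Fin._≟_ A (allFin n) (λ x _ → Mem.∈-allFin x) (λ x → x Sub.∈? S) k)

-- Adding a loop would break irreflexivity, so u ≢ v is decided first.
forNonEdges? : ∀ {n} (G : Graph n) {P : Fin n → Fin n → Set} →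
  (∀ u v → u ≢ v → Dec (P u v)) → Dec (∀ u v → u ≢ v → adj G u v ≡ false → P u v)
forNonEdges? G {P} P? = Fin.all? (λ u → Fin.all? (λ v → at u v (u Fin.≟ v)))
  where
  at : ∀ u v → Dec (u ≡ v) → Dec (u ≢ v → adj G u v ≡ false → P u v)
  at u v (yes e) = yes (λ ne → contradiction e ne)
  at u v (no ne) = Dec.map′ (λ f _ → f) (λ f → f ne) ((adj G u v ≟ᵇ false) →-dec P? u v ne)

addClique? : ∀ {n} (G : Graph n) {u v} → u ≢ v → ∀ S k → Dec (CliqueIn (addEdge (adj G) u v) S k)
addClique? G {u} {v} ne = clique? (addE-sym Fin._≟_ (Graph.sym G) u v) (addE-irr Fin._≟_ {adj G} (Graph.irr G) ne)

clique-resp : ∀ {n} {A B : Fin n → Fin n → Bool} {S k} → (∀ i j → A i j ≡ B i j) → CliqueIn A S k → CliqueIn B S k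
clique-resp e (f , inj , f∈ , ad) = f , inj , f∈ , λ i j ne → trans (sym (e (f i) (f j))) (ad i j ne)

addEdge-resp : ∀ {n} {A B : Fin n → Fin n → Bool} {u v} → (∀ i j → A i j ≡ B i j) → ∀ i j → addEdge A u v i j ≡ addEdge B u v i j
addEdge-resp e i j = cong (_∨ _) (e i j)

deg-resp : ∀ {n} {G G′ : Graph n} → G ≈ G′ → ∀ i → deg G i ≡ deg G′ i
deg-resp e i = cong ∣_∣ (Vec.tabulate-cong (e i))

edges-resp : ∀ {n} {G G′ : Graph n} → G ≈ G′ → edges G ≡ edges G′
edges-resp {n} e = cong sum (List.map-cong (λ i → cong ∣_∣ (Vec.tabulate-cong (λ j → cong (_∧ _) (e i j)))) (allFin n))

admissible-resp : ∀ {n r t} {G G′ : Graph n} → G ≈ G′ → TsatAdmissible r t G → TsatAdmissible r t G′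
admissible-resp {t = t} {G} {G′} e ((free , sat) , low , twin) =
  ( free ∘ clique-resp (≈-sym {G = G} {G′} e)
  , λ u v ne f → clique-resp (addEdge-resp e) (sat u v ne (trans (e u v) f)))
  , (λ i → subst (t ≤_) (deg-resp {G = G} {G′} e i) (low i))
  , λ u v (ne , tw) → let w , a , b , d = twin u v (ne , λ w → trans (e u w) (trans (tw w) (sym (e v w))))
                      in w , trans (sym (e u w)) a , trans (sym (e v w)) b , trans (sym (deg-resp {G = G} {G′} e w)) d

admissible? : ∀ {n} r t (G : Graph n) → Dec (TsatAdmissible r t G)
admissible? r t G =
  (¬? (clique? (Graph.sym G) (Graph.irr G) full r) ×-dec forNonEdges? G (λ u v ne → addClique? G ne full r))
  ×-dec Fin.all? (λ i → t ≤? deg G i)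
  ×-dec Fin.all? (λ u → Fin.all? (λ v → (¬? (u Fin.≟ v) ×-dec Fin.all? (λ w → adj G u w ≟ᵇ adj G v w)) →-dec
    Fin.any? (λ w → (adj G u w ≟ᵇ true) ×-dec (adj G v w ≟ᵇ true) ×-dec (deg G w ℕ.≟ t))))

tsatExists : ∀ {n r t} → Σ (Graph n) (TsatAdmissible r t) → ∃ (IsTsat n r t)
tsatExists {n} {r} {t} (G , adm) = minimum
  (λ m → anyGraph? (λ {G} {G′} e (a , p) → admissible-resp {G = G} {G′} e a , trans (sym (edges-resp {G = G} {G′} e)) p)
    (λ G → admissible? r t G ×-dec (edges G ℕ.≟ m)))
  (G , adm , refl)

All? : {P : V → Set} → (∀ x → Dec (P x)) → ∀ xs → Dec (∀ x → x ∈ₗ xs → P x)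
All? P? xs = Dec.map′ (λ all x x∈ → All.lookup all x∈) (λ f → All.tabulate (λ {x} → f x)) (All.all? P? xs)

maximal-resp : ∀ {r t v} {H H′ : Graph v} {F} → H ≈ H′ → IsMaximalRTSystem r t H F → IsMaximalRTSystem r t H′ F
maximal-resp {H = H} {H′} e (((free , (own , meet)) , mx) , uq) =
  (( free ∘ clique-resp (≈-sym {G = H} {H′} e)
   , (λ S S∈ → proj₁ (own S S∈) ∘ clique-resp (≈-sym {G = H} {H′} e) , λ x x∉ → clique-resp e (proj₂ (own S S∈) x x∉))
   , λ S T S∈ T∈ ne → clique-resp e (meet S T S∈ T∈ ne))
  , λ u w ne f → Sum.map (clique-resp (addEdge-resp e)) (λ (S , S∈ , h) → S , S∈ , clique-resp (addEdge-resp e) h)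
      (mx u w ne (trans (e u w) f)))
  , uq

maximal? : ∀ r t {v} (H : Graph v) F → Dec (IsMaximalRTSystem r t H F)
maximal? r t {v} H F =
  ((¬? (cl full r)
    ×-dec All? (λ S → ¬? (cl S (r ∸ 1)) ×-dec Fin.all? (λ x → ¬? (x Sub.∈? S) →-dec cl (S ∪ ⁅ x ⁆) (r ∸ 1))) F
    ×-dec Dec.map′ (λ f S T S∈ T∈ → f S S∈ T T∈) (λ f S S∈ T T∈ → f S T S∈ T∈)
        (All? (λ S → All? (λ T → ¬? (S ≟ˢ T) →-dec cl (S ∩ T) (r ∸ 2)) F) F))
   ×-dec forNonEdges? H (λ u w ne → addClique? H ne full r ⊎-dec
      Dec.map′ find (λ (S , S∈ , h) → lose S∈ h) (Any.any? (λ S → addClique? H ne S (r ∸ 1)) F)))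
  ×-dec AllPairs.allPairs? (λ S T → ¬? (S ≟ˢ T)) F
  ×-dec All.all? (λ S → ∣ S ∣ ℕ.≟ t) F
  where
  cl = clique? (Graph.sym H) (Graph.irr H)
  _≟ˢ_ : DecidableEquality (Subset v)
  _≟ˢ_ = Vec.≡-dec 𝔹._≟_

-- The order of `H` is bounded in terms of its edges, which makes the existence of a system with m
-- edges a finite search.
vertices≤ : ∀ {ρ t s m} → 1 ≤ s → (sys : SystemWith (3 + ρ) t s m) → proj₁ sys ≤ t + 2 * m
vertices≤ 1≤s (v , H , [] , _ , refl , _) = contradiction 1≤s λ ()
vertices≤ {ρ} {t} _ (v , H , T ∷ F , M , _ , refl) =
  subst₂ _≤_ length-hs (cong (t +_) E-hs) (length-hs≤ split (Mem.∈-map⁺ inj₂ (Mem.∈-allFin zero)))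
  where open FromSystem {suc ρ} {t} {v} {H} {T ∷ F} M

systemWith? : ∀ ρ t s → 1 ≤ s → ∀ m → Dec (SystemWith (3 + ρ) t s m)
systemWith? ρ t s 1≤s m = Dec.map′ (λ (v , sys) → toℕ v , sys) small
  (Fin.any? (λ (v : Fin (suc (t + 2 * m))) → anyGraph? (λ {H} {H′} e (F , M , l , k) →
      F , maximal-resp {H = H} {H′} e M , l , trans (sym (edges-resp {G = H} {H′} e)) k)
    (λ H → Dec.map′ (λ (F , l , M , k) → F , M , l , k) (λ (F , M , l , k) → F , l , M , k)
      (anyList? s (λ F → maximal? (3 + ρ) t H F ×-dec (edges H ℕ.≟ m))))))
  where
  small : SystemWith (3 + ρ) t s m → ∃ λ (v : Fin (suc (t + 2 * m))) → _
  small sys@(v , rest) = fromℕ< (s≤s (vertices≤ 1≤s sys)) , subst (λ v → Σ (Graph v) λ H → Σ (List (Subset v)) λ F →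
    IsMaximalRTSystem (3 + ρ) t H F × length F ≡ s × edges H ≡ m) (sym (Fin.toℕ-fromℕ< (s≤s (vertices≤ 1≤s sys)))) rest

e′Exists : ∀ {ρ t s m} → 1 ≤ s → SystemWith (3 + ρ) t s m → ∃ (IsE' (3 + ρ) t s)
e′Exists {ρ} {t} {s} 1≤s sys = minimum (systemWith? ρ t s 1≤s) sys

-- Two families

-- One for the first index, and one class of later indices for each of the at most b elements of its
-- second set, with first sets smaller by one.
skewBound : ℕ → ℕ → ℕ
skewBound zero    b = 1
skewBound (suc a) b = suc (b * skewBound a b)

AllPairs-with : {P : V → Set} {R : V → V → Set} {xs : List V} → All P xs → AllPairs R xs →
  AllPairs (λ x y → P x × P y × R x y) xs
AllPairs-with []       []       = []
AllPairs-with (p ∷ ps) (r ∷ rs) = All.zipWith (λ (q , s) → p , q , s) (ps , r) ∷ AllPairs-with ps rs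

-- A crude form of the skew two families theorem: every α j with j after i meets β i in some x; among
-- the α j containing a common x, the element x lies in no β j and can be dropped from all α j.
skew : (_≟_ : DecidableEquality W) (β : V → List W) (b a : ℕ) (α : V → List W) (js : List V) →
  AllPairs (λ i j → ∃ λ x → x ∈ₗ α j × x ∈ₗ β i) js →
  All (λ j → ∀ x → x ∈ₗ α j → x ∈ₗ β j → ⊥) js →
  All (λ j → length (α j) ≤ a) js → All (λ j → length (β j) ≤ b) js → length js ≤ skewBound a b
skew _≟_ β b a α [] _ _ _ _ = z≤n
skew _≟_ β b zero α (i ∷ []) _ _ _ _ = s≤s z≤n
skew _≟_ β b zero α (i ∷ j ∷ js) (((x , x∈ , _) ∷ _) ∷ _) _ (_ ∷ lα ∷ _) _ with α j | x∈ | lα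
... | _ ∷ _ | _ | ()
skew {W} {V} _≟_ β b (suc a) α (i ∷ js) (meets ∷ pairs) (_ ∷ dis) (_ ∷ lα) (lβi ∷ lβ) = s≤s (begin
  length js ≡⟨ trans (sym (*-identityʳ _)) (sym (∑-const 1 js)) ⟩
  ∑ js (λ _ → 1) ≤⟨ ∑-mono js (λ j j∈ → hit j (All.lookup meets j∈)) ⟩
  ∑ js (λ j → ∑ (β i) (λ x → 𝟙 (has x j))) ≡⟨ ∑-swap (λ j x → 𝟙 (has x j)) js (β i) ⟩
  ∑ (β i) (λ x → ∑ js (λ j → 𝟙 (has x j))) ≤⟨ ∑-bound (β i) (λ x _ → ≤-trans (≤-reflexive (sym (length-sel (has x) js))) (part x)) ⟩
  length (β i) * skewBound a b ≤⟨ *-monoˡ-≤ (skewBound a b) lβi ⟩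
  b * skewBound a b ∎)
  where
  open ℕ.≤-Reasoning
  has : W → V → Bool
  has x j = ⌊ _∈?_ _≟_ x (α j) ⌋
  hit : ∀ j → (∃ λ x → x ∈ₗ α j × x ∈ₗ β i) → 1 ≤ ∑ (β i) (λ x → 𝟙 (has x j))
  hit j (x , x∈α , x∈β) = ≤-trans yes1 (∑-∈ (λ x → 𝟙 (has x j)) x∈β)
    where
    yes1 : 1 ≤ 𝟙 (has x j)
    yes1 with _∈?_ _≟_ x (α j)
    ... | yes _ = s≤s z≤n
    ... | no x∉ = contradiction x∈α x∉
  hasT : ∀ {x j} → has x j ≡ true → x ∈ₗ α j
  hasT {x} {j} e with _∈?_ _≟_ x (α j)
  ... | yes p = p
  part : ∀ x → length (sel (has x) js) ≤ skewBound a b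
  part x = skew _≟_ β b a (λ j → del _≟_ x (α j)) (sel (has x) js)
    (AllPairs.map reduce (AllPairs-with facts (AllPairs.filter⁺ P? pairs)))
    (All.map (λ d y y∈ → d y (proj₁ (∈-del⁻ _≟_ y∈))) (All.filter⁺ P? dis))
    (All.map shorter (All.zip (facts , All.filter⁺ P? lα)))
    (All.filter⁺ P? lβ)
    where
    P? = λ j → has x j ≟ᵇ true
    facts : All (λ j → x ∈ₗ α j × (∀ y → y ∈ₗ α j → y ∈ₗ β j → ⊥)) (sel (has x) js)
    facts = All.zip (All.map hasT (All.all-filter P? js) , All.filter⁺ P? dis)
    reduce : ∀ {i j} → (x ∈ₗ α i × (∀ y → y ∈ₗ α i → y ∈ₗ β i → ⊥)) ×
      (x ∈ₗ α j × (∀ y → y ∈ₗ α j → y ∈ₗ β j → ⊥)) × (∃ λ y → y ∈ₗ α j × y ∈ₗ β i) →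
      ∃ λ y → y ∈ₗ del _≟_ x (α j) × y ∈ₗ β i
    reduce ((xi , di) , _ , y , yα , yβ) = y , ∈-del⁺ _≟_ yα (λ { refl → di x xi yβ }) , yβ
    shorter : ∀ {j} → (x ∈ₗ α j × (∀ y → y ∈ₗ α j → y ∈ₗ β j → ⊥)) × length (α j) ≤ suc a →
      length (del _≟_ x (α j)) ≤ a
    shorter {j} ((x∈ , _) , l) = s≤s⁻¹ (≤-trans
      (List.filter-notAll (λ y → ¬? (y ≟ x)) (α j) (lose x∈ (λ ne → ne refl))) l)

-- Keeping `y` discards the at most M entries that are bad for `y`, including `y` itself. Badness is
-- not assumed symmetric, so only pairs in the order of choice are controlled; this is why a skew
-- version of the two families theorem is called for.
greedy : (bad : V → V → Bool) (M l : ℕ) (ys : List V) → length ys ≤ l →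
  (∀ y → y ∈ₗ ys → bad y y ≡ true) → (∀ y → y ∈ₗ ys → ∑ ys (𝟙 ∘ bad y) ≤ M) →
  ∃ λ cs → (∀ {y} → y ∈ₗ cs → y ∈ₗ ys) × AllPairs (λ y z → bad y z ≡ false) cs × length ys ≤ M * length cs
greedy bad M l       []       _       self few = [] , (λ ()) , [] , z≤n
greedy bad M (suc l) (y ∷ ys) (s≤s le) self few =
  let zs = sel (not ∘ bad y) ys
      up : ∀ {z} → z ∈ₗ zs → z ∈ₗ y ∷ ys
      up = λ z∈ → there (proj₁ (∈-sel⁻ {p = not ∘ bad y} {xs = ys} z∈))
      cs , cs⊆ , pairs , len = greedy bad M l zs
        (≤-trans (List.length-filter (λ z → not (bad y z) ≟ᵇ true) ys) le)
        (λ z z∈ → self z (up z∈)) (λ z z∈ → ≤-trans (sub z) (few z (up z∈)))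
  in y ∷ cs , (λ { (here e) → here e ; (there z∈) → up (cs⊆ z∈) })
   , All.tabulate (λ z∈ → 𝔹.not-injective (proj₂ (∈-sel⁻ {p = not ∘ bad y} {xs = ys} (cs⊆ z∈)))) ∷ pairs
   , (begin
       suc (length ys) ≡⟨ cong suc (length-sel-not (bad y) ys) ⟨
       suc (length (sel (bad y) ys)) + length zs ≤⟨ +-mono-≤ head≤ len ⟩
       M + M * length cs ≡⟨ ℕ.*-suc M (length cs) ⟨
       M * suc (length cs) ∎)
  where
  open ℕ.≤-Reasoning
  head≤ : suc (length (sel (bad y) ys)) ≤ M
  head≤ = ≤-trans (≤-reflexive (cong₂ _+_ (cong 𝟙 (sym (self y (here refl)))) (length-sel (bad y) ys))) (few y (here refl))
  sub : ∀ z → ∑ (sel (not ∘ bad y) ys) (𝟙 ∘ bad z) ≤ ∑ (y ∷ ys) (𝟙 ∘ bad z)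
  sub z = ≤-trans (≤-reflexive (∑-sel (not ∘ bad y) (𝟙 ∘ bad z) ys))
    (≤-trans (∑-mono ys (λ w _ → ≤-trans (*-monoˡ-≤ _ (𝟙≤1 (not (bad y w)))) (≤-reflexive (+-identityʳ _)))) (m≤n+m _ _))

module _ (A : V → V → Bool) where

  -- Cliques written as vertex sequences. They are the elements of the ground set to which the two
  -- families theorem is applied.
  cliques : ℕ → List V → List (List V)
  cliques zero    xs = [] ∷ []
  cliques (suc k) xs = concatMap (λ x → map (x ∷_) (cliques k (sel (A x) xs))) xs

  length-cliques : ∀ k xs {d} → length xs ≤ d → length (cliques k xs) ≤ d ^ k
  length-cliques zero    xs     le = ≤-refl
  length-cliques (suc k) xs {d} le = begin
    length (cliques (suc k) xs) ≡⟨ length-concat xs ⟩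
    ∑ xs (λ x → length (map (x ∷_) (cliques k (sel (A x) xs)))) ≤⟨ ∑-bound xs each ⟩
    length xs * d ^ k ≤⟨ *-monoˡ-≤ (d ^ k) le ⟩
    d ^ suc k ∎
    where
    open ℕ.≤-Reasoning
    length-concat : ∀ {f : V → List (List V)} ys → length (concatMap f ys) ≡ ∑ ys (length ∘ f)
    length-concat []           = refl
    length-concat {f} (y ∷ ys) = trans (List.length-++ (f y)) (cong (length (f y) +_) (length-concat ys))
    each : ∀ x → x ∈ₗ xs → length (map (x ∷_) (cliques k (sel (A x) xs))) ≤ d ^ k
    each x _ = ≤-trans (≤-reflexive (List.length-map (x ∷_) (cliques k (sel (A x) xs))))
      (length-cliques k (sel (A x) xs) (≤-trans (List.length-filter (λ y → A x y ≟ᵇ true) xs) le))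

  -- The sequence is fixed before `xs`, so that the same one is found in the lists of two different
  -- neighbourhoods.
  K⇒cliques : ∀ k {P : V → Set} → K A P k → ∃ λ e → ∀ xs → (∀ x → P x → x ∈ₗ xs) → e ∈ₗ cliques k xs
  K⇒cliques zero    _            = [] , λ _ _ → here refl
  K⇒cliques (suc k) (x , px , h) = let e , e∈ = K⇒cliques k h in x ∷ e , λ xs P⊆ →
    Mem.∈-concatMap⁺ (λ x → map (x ∷_) (cliques k (sel (A x) xs)))
      (lose (P⊆ x px) (Mem.∈-map⁺ (x ∷_) (e∈ (sel (A x) xs) (λ y (py , a) → ∈-sel⁺ (P⊆ y py) a))))

  cliques⇒K : ∀ k e xs ys → e ∈ₗ cliques k xs → e ∈ₗ cliques k ys → K A (λ x → x ∈ₗ xs × x ∈ₗ ys) k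
  cliques⇒K zero    e xs ys _ _ = tt
  cliques⇒K (suc k) e xs ys p q
    with find (Mem.∈-concatMap⁻ (λ x → map (x ∷_) (cliques k (sel (A x) xs))) {xs = xs} p)
       | find (Mem.∈-concatMap⁻ (λ x → map (x ∷_) (cliques k (sel (A x) ys))) {xs = ys} q)
  ... | x , x∈ , p′ | y , y∈ , q′ with Mem.∈-map⁻ (x ∷_) p′ | Mem.∈-map⁻ (y ∷_) q′
  ...   | e₁ , e₁∈ , refl | .e₁ , e₂∈ , refl = x , (x∈ , y∈) ,
          K-mono k (λ z (z₁ , z₂) → let z∈ , a = ∈-sel⁻ {p = A x} z₁ in (z∈ , proj₁ (∈-sel⁻ {p = A x} z₂)) , a)
            (cliques⇒K k e₁ _ _ e₁∈ e₂∈)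

-- As `y` and `φ y` are adjacent, their neighbourhoods share no K_c, for it would extend to a
-- K_{c+2}. For pairs that are not bad, `nb z` and `nb (φ y)` do share one. After a greedy choice of
-- indices, the sets of c-cliques in `nb (φ y)` and in `nb y` are thus two skew cross-intersecting
-- families of bounded sets.
pairBound : (_≟_ : DecidableEquality V) {A : V → V → Bool} → Sym A → Irr A → (c : ℕ) → ¬ K A (λ _ → ⊤) (2 + c) →
  (nb : V → List V) → (∀ {y z} → z ∈ₗ nb y → A y z ≡ true) → (D M : ℕ) (ys : List V) (φ : V → V) (bad : V → V → Bool) →
  (∀ y → y ∈ₗ ys → A y (φ y) ≡ true) →
  (∀ y → y ∈ₗ ys → length (nb y) ≤ D) → (∀ y → y ∈ₗ ys → length (nb (φ y)) ≤ D) →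
  (∀ y z → y ∈ₗ ys → z ∈ₗ ys → bad y z ≡ false → K A (λ x → x ∈ₗ nb z × x ∈ₗ nb (φ y)) c) →
  (∀ y → y ∈ₗ ys → bad y y ≡ true) → (∀ y → y ∈ₗ ys → ∑ ys (𝟙 ∘ bad y) ≤ M) →
  length ys ≤ M * skewBound (D ^ c) (D ^ c)
pairBound _≟_ {A} sA iA c noK nb nb⇒A D M ys φ bad edge l₁ l₂ far self few =
  let cs , cs⊆ , pairs , len = greedy bad M (length ys) ys ≤-refl self few
  in ≤-trans len (*-monoʳ-≤ M (skew (List.≡-dec _≟_) (λ y → cliques A c (nb (φ y))) (D ^ c) (D ^ c)
      (λ y → cliques A c (nb y)) cs
      (AllPairs.map (λ {y} {z} (y∈ , z∈ , b) → let e , e∈ = K⇒cliques A c (far y z y∈ z∈ b)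
                                  in e , e∈ (nb z) (λ _ → proj₁) , e∈ (nb (φ y)) (λ _ → proj₂))
        (AllPairs-with (All.tabulate cs⊆) pairs))
      (All.tabulate (λ {y} y∈ e p q → noK (Common⇒K sA iA tt tt (edge y (cs⊆ y∈)) c
        (K-mono c (λ z (a , b) → tt , nb⇒A a , nb⇒A b) (cliques⇒K A c e _ _ p q)))))
      (All.tabulate (λ {y} y∈ → length-cliques A c (nb y) (l₁ y (cs⊆ y∈))))
      (All.tabulate (λ {y} y∈ → length-cliques A c (nb (φ y)) (l₂ y (cs⊆ y∈))))))

-- The lower bound

∑-zero⇒ : (f : V → ℕ) {xs : List V} {x : V} → x ∈ₗ xs → ∑ xs f ≡ 0 → f x ≡ 0
∑-zero⇒ f x∈ eq = ℕ.n≤0⇒n≡0 (subst (f _ ≤_) eq (∑-∈ f x∈))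

-- Vertices of degree at least D are big (B), the others small (L).  I consists of the small vertices of
-- degree t all of whose neighbours are big.  By `pairBound` there are boundedly many small vertices with
-- fewer than t big neighbours (Y), and boundedly many big vertices that have a neighbour in I but fewer
-- than D′ big neighbours (Z).  The big vertices with neither property (is3) send many edges to R = L ∖ I.
module Lower {c t n : ℕ} (D′ D κ ball≤ : ℕ) (D′≡ : suc (2 * t) ≡ D′) (D≡ : suc (4 * (t * suc t)) + D′ ≡ D)
  (κ≡ : suc (4 * (t * suc t)) + D ≡ κ) (ball≡ : suc D + D * D ≡ ball≤)
  (G : Graph n) (adm : TsatAdmissible (2 + c) t G) where

  A = adj G
  vs = allFin n

  sA : Sym A
  sA = Graph.sym G
  iA : Irr A
  iA = Graph.irr G

  noK₂ : ¬ K A (λ _ → ⊤) (2 + c)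
  noK₂ = proj₁ (proj₁ adm) ∘ K⇒clique sA iA (2 + c) (λ x _ → ∈full x)

  satG : ∀ x y → x ≢ y → A x y ≡ false → Common A (λ _ → ⊤) c x y
  satG x y ne a with K-addE Fin._≟_ sA iA ne (2 + c) (clique⇒K {P = λ _ → ⊤} (2 + c) (λ _ _ → tt) (proj₂ (proj₁ adm) x y ne a))
  ... | inj₁ h                      = contradiction h noK₂
  ... | inj₂ (_ , _ , _ , refl , h) = h

  d : Fin n → ℕ
  d v = ∑ vs (𝟙 ∘ A v)

  dIn : (Fin n → Bool) → Fin n → ℕ
  dIn p v = ∑ vs (λ z → 𝟙 (p z) * 𝟙 (A v z))

  d≥t : ∀ v → t ≤ d v
  d≥t v = subst (t ≤_) (deg≡∑ G v) (proj₁ (proj₂ adm) v)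

  dIn≤d : ∀ p v → dIn p v ≤ d v
  dIn≤d p v = ∑-mono vs (λ z _ → ≤-trans (*-monoˡ-≤ _ (𝟙≤1 (p z))) (≤-reflexive (+-identityʳ _)))

  dIn-swap : ∀ p q → ∑ vs (λ v → 𝟙 (p v) * dIn q v) ≡ ∑ vs (λ v → 𝟙 (q v) * dIn p v)
  dIn-swap p q = begin
    ∑ vs (λ v → 𝟙 (p v) * dIn q v) ≡⟨ ∑-cong vs (λ v _ → sym (∑-* (𝟙 (p v)) _ vs)) ⟩
    ∑ vs (λ v → ∑ vs (λ z → 𝟙 (p v) * (𝟙 (q z) * 𝟙 (A v z)))) ≡⟨ ∑-swap _ vs vs ⟩
    ∑ vs (λ z → ∑ vs (λ v → 𝟙 (p v) * (𝟙 (q z) * 𝟙 (A v z))))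
      ≡⟨ ∑-cong vs (λ z _ → ∑-cong vs (λ v _ → trans (cong (λ b → 𝟙 (p v) * (𝟙 (q z) * 𝟙 b)) (sA v z)) (lem (𝟙 (p v)) (𝟙 (q z)) _))) ⟩
    ∑ vs (λ z → ∑ vs (λ v → 𝟙 (q z) * (𝟙 (p v) * 𝟙 (A z v)))) ≡⟨ ∑-cong vs (λ z _ → ∑-* (𝟙 (q z)) _ vs) ⟩
    ∑ vs (λ z → 𝟙 (q z) * dIn p z) ∎
    where
    open ≡-Reasoning
    lem : ∀ a b c → a * (b * c) ≡ b * (a * c)
    lem = solve-∀

  isB isL isI isR isY isZ is3 : Fin n → Bool
  isB v = ⌊ D ≤? d v ⌋
  isL v = not (isB v)
  isI v = isL v ∧ (⌊ d v ℕ.≟ t ⌋ ∧ ⌊ dIn isB v ℕ.≟ t ⌋)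
  isR v = isL v ∧ not (isI v)
  isY v = isL v ∧ ⌊ dIn isB v <? t ⌋
  isZ v = isB v ∧ (⌊ dIn isB v <? D′ ⌋ ∧ ⌊ 1 ≤? dIn isI v ⌋)
  is3 v = isB v ∧ (⌊ dIn isB v <? D′ ⌋ ∧ not ⌊ 1 ≤? dIn isI v ⌋)

  B-deg : ∀ {v} → isB v ≡ true → D ≤ d v
  B-deg {v} = ⌊⌋-true {P? = D ≤? d v}

  L-deg : ∀ {v} → isL v ≡ true → d v < D
  L-deg {v} e = ≰⇒> (⌊⌋-false {P? = D ≤? d v} (𝔹.not-injective e))

  I-facts : ∀ {v} → isI v ≡ true → isL v ≡ true × d v ≡ t × dIn isB v ≡ t
  I-facts {v} e = let l , e′ = ∧-true {isL v} e ; p , q = ∧-true {⌊ d v ℕ.≟ t ⌋} e′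
                  in l , ⌊⌋-true {P? = d v ℕ.≟ t} p , ⌊⌋-true {P? = dIn isB v ℕ.≟ t} q

  d-split : ∀ v → d v ≡ dIn isB v + dIn isL v
  d-split v = trans (∑-cong vs (λ z _ → lem (isB z) (𝟙 (A v z)))) (∑-+ _ _ vs)
    where
    lem : ∀ b x → x ≡ 𝟙 b * x + 𝟙 (not b) * x
    lem true  x = lem′ x where
      lem′ : ∀ x → x ≡ x + 0 + 0
      lem′ = solve-∀
    lem false x = sym (+-identityʳ x)

  I-nbr : ∀ {v z} → isI v ≡ true → A v z ≡ true → isB z ≡ true
  I-nbr {v} {z} e a with isB z in b
  ... | true  = refl
  ... | false = contradiction (subst (λ x → x * 𝟙 (A v z) ≡ 0) (cong (𝟙 ∘ not) b)
                  (∑-zero⇒ (λ z → 𝟙 (isL z) * 𝟙 (A v z)) (Mem.∈-allFin z) none)) (subst (λ b → 1 * 𝟙 b ≢ 0) (sym a) λ ())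
    where
    none : dIn isL v ≡ 0
    none = let _ , dv , dB = I-facts {v} e in ℕ.+-cancelˡ-≡ t _ _
             (trans (trans (sym (trans (d-split v) (cong (_+ dIn isL v) dB))) dv) (sym (+-identityʳ t)))

  NB : Fin n → List (Fin n)
  NB y = sel (λ z → isB z ∧ A y z) vs

  NB⇒A : ∀ {y z} → z ∈ₗ NB y → A y z ≡ true
  NB⇒A {y} {z} z∈ = proj₂ (∧-true {isB z} (proj₂ (∈-sel⁻ {p = λ z → isB z ∧ A y z} {xs = vs} z∈)))

  ∈NB : ∀ {y z} → isB z ≡ true → A y z ≡ true → z ∈ₗ NB y
  ∈NB {y} {z} b a = ∈-sel⁺ {p = λ z → isB z ∧ A y z} (Mem.∈-allFin z) (cong₂ _∧_ b a)

  length-NB : ∀ y → length (NB y) ≡ dIn isB y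
  length-NB y = trans (length-sel (λ z → isB z ∧ A y z) vs) (∑-cong vs (λ z _ → lem (isB z) (A y z)))
    where
    lem : ∀ a b → 𝟙 (a ∧ b) ≡ 𝟙 a * 𝟙 b
    lem true  b = sym (+-identityʳ _)
    lem false b = refl

  D′≤D : D′ ≤ D
  D′≤D = subst (D′ ≤_) D≡ (m≤n+m D′ (suc (4 * (t * suc t))))

  t<D : t < D
  t<D = ≤-trans (≤-trans (s≤s (m≤m+n t (t + 0))) (≤-reflexive D′≡)) D′≤D

  pick : (Fin n → Bool) → Fin n → Fin n
  pick p v with Fin.any? (λ z → (p z ∧ A v z) ≟ᵇ true)
  ... | yes (z , _) = z
  ... | no _        = v

  pick-spec : ∀ p {v} → 1 ≤ dIn p v → p (pick p v) ≡ true × A v (pick p v) ≡ true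
  pick-spec p {v} pos with Fin.any? (λ z → (p z ∧ A v z) ≟ᵇ true)
  ... | yes (z , e) = ∧-true {p z} e
  ... | no none     = contradiction (subst (1 ≤_) (trans (∑-cong vs (λ z _ → zero′ z)) (∑-zero vs)) pos) λ ()
    where
    zero′ : ∀ z → 𝟙 (p z) * 𝟙 (A v z) ≡ 0
    zero′ z with p z in e | A v z in a
    ... | true  | true  = contradiction (z , cong₂ _∧_ e a) none
    ... | true  | false = refl
    ... | false | _     = refl

  bound : ℕ
  bound = ball≤ * skewBound (D ^ c) (D ^ c)

  Ys Zs : List (Fin n)
  Ys = sel isY vs
  Zs = sel isZ vs

  ∑sel≤ : ∀ p (f : Fin n → ℕ) → ∑ (sel p vs) f ≤ ∑ vs f
  ∑sel≤ p f = ≤-trans (≤-reflexive (∑-sel p f vs))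
    (∑-mono vs (λ x _ → ≤-trans (*-monoˡ-≤ (f x) (𝟙≤1 (p x))) (≤-reflexive (+-identityʳ _))))

  -- The partner `φ y` lies in `I`, so all its neighbours are big. By saturation every z in `Zs` not
  -- adjacent to `φ y` shares with it a K_c of big vertices, and fewer than D vertices are adjacent
  -- to it.
  |Z|≤ : length Zs ≤ bound
  |Z|≤ = pairBound Fin._≟_ sA iA c noK₂ NB NB⇒A D (ball≤) Zs φ (A ∘ φ) (λ y y∈ → proj₂ (spec y∈))
    (λ y y∈ → ≤-trans (≤-reflexive (length-NB y)) (≤-trans (<⇒≤ (proj₁ (proj₂ (facts y∈)))) D′≤D))
    (λ y y∈ → ≤-trans (≤-reflexive (trans (length-NB (φ y)) (proj₂ (proj₂ (I-facts (proj₁ (spec y∈))))))) (<⇒≤ t<D))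
    (λ y z y∈ z∈ a → K-mono c (λ x (_ , p , q) → let b = I-nbr (proj₁ (spec y∈)) q in ∈NB b p , ∈NB b q)
      (satG z (φ y) (λ { refl → true≢false (proj₁ (facts z∈)) (𝔹.not-injective (proj₁ (I-facts (proj₁ (spec y∈))))) })
        (trans (sA z (φ y)) a)))
    (λ y y∈ → trans (sA (φ y) y) (proj₂ (spec y∈)))
    (λ y y∈ → ≤-trans (∑sel≤ isZ (𝟙 ∘ A (φ y)))
      (≤-trans (<⇒≤ (L-deg (proj₁ (I-facts (proj₁ (spec y∈)))))) (≤-trans (n≤1+n D) (≤-trans (m≤m+n (suc D) (D * D)) (≤-reflexive ball≡)))))
    where
    φ = pick isI
    facts : ∀ {y} → y ∈ₗ Zs → isB y ≡ true × dIn isB y < D′ × 1 ≤ dIn isI y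
    facts {y} y∈ = let b , e = ∧-true {isB y} (proj₂ (∈-sel⁻ {p = isZ} {xs = vs} y∈)) ; p , q = ∧-true {⌊ dIn isB y <? D′ ⌋} e
                   in b , ⌊⌋-true {P? = dIn isB y <? D′} p , ⌊⌋-true {P? = 1 ≤? dIn isI y} q
    spec : ∀ {y} → y ∈ₗ Zs → isI (φ y) ≡ true × A y (φ y) ≡ true
    spec y∈ = pick-spec isI (proj₂ (proj₂ (facts y∈)))

  -- A vertex of degree at least t with fewer than t big neighbours has a small neighbour `φ y`. A
  -- vertex z shares with `φ y` a K_c of big vertices unless z equals `φ y`, is adjacent to it, or
  -- is reached from it through a small vertex. There are at most 1 + D + D² such exceptions, which
  -- is the constant `ball≤`.
  |Y|≤ : length Ys ≤ bound
  |Y|≤ = pairBound Fin._≟_ sA iA c noK₂ NB NB⇒A D (ball≤) Ys φ bad (λ y y∈ → proj₂ (spec y∈))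
    (λ y y∈ → small (proj₁ (facts y∈)))
    (λ y y∈ → small (proj₁ (spec y∈)))
    far
    (λ y y∈ → true-⌊⌋ {P? = 1 ≤? ball (φ y) y} (≤-trans (≤-reflexive (cong 𝟙 (sym (trans (sA (φ y) y) (proj₂ (spec y∈))))))
      (≤-trans (m≤m+n _ _) (m≤n+m _ (𝟙 ⌊ y Fin.≟ φ y ⌋)))))
    (λ y y∈ → ≤-trans (∑sel≤ isY (𝟙 ∘ bad y)) (count (proj₁ (spec y∈))))
    where
    φ = pick isL
    facts : ∀ {y} → y ∈ₗ Ys → isL y ≡ true × dIn isB y < t
    facts {y} y∈ = let l , e = ∧-true {isL y} (proj₂ (∈-sel⁻ {p = isY} {xs = vs} y∈)) in l , ⌊⌋-true {P? = dIn isB y <? t} e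
    spec : ∀ {y} → y ∈ₗ Ys → isL (φ y) ≡ true × A y (φ y) ≡ true
    spec {y} y∈ = pick-spec isL (ℕ.+-cancelˡ-≤ (dIn isB y) _ _
      (≤-trans (≤-reflexive (ℕ.+-comm _ 1)) (≤-trans (proj₂ (facts y∈)) (≤-trans (d≥t y) (≤-reflexive (d-split y))))))
    small : ∀ {y} → isL y ≡ true → length (NB y) ≤ D
    small {y} l = ≤-trans (≤-reflexive (length-NB y)) (≤-trans (dIn≤d isB y) (<⇒≤ (L-deg l)))
    ball : Fin n → Fin n → ℕ
    ball u y = 𝟙 ⌊ y Fin.≟ u ⌋ + (𝟙 (A u y) + ∑ vs (λ w → 𝟙 (isL w) * 𝟙 (A u w) * 𝟙 (A w y)))
    bad : Fin n → Fin n → Bool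
    bad y z = ⌊ 1 ≤? ball (φ y) z ⌋
    far : ∀ y z → y ∈ₗ Ys → z ∈ₗ Ys → bad y z ≡ false → K A (λ x → x ∈ₗ NB z × x ∈ₗ NB (φ y)) c
    far y z y∈ z∈ b = K-mono c (λ x (_ , p , q) → inB x p q , inB′ x p q) (satG z u z≢u (trans (sA z u) uz))
      where
      u = φ y
      zeroBall : ball u z ≡ 0
      zeroBall = ℕ.n<1⇒n≡0 (≰⇒> (⌊⌋-false {P? = 1 ≤? ball u z} b))
      rest0 = ℕ.m+n≡0⇒n≡0 (𝟙 ⌊ z Fin.≟ u ⌋) zeroBall
      z≢u : z ≢ u
      z≢u e = contradiction (trans (cong 𝟙 (sym (true-⌊⌋ {P? = z Fin.≟ u} e))) (ℕ.m+n≡0⇒m≡0 _ zeroBall)) λ ()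
      uz : A u z ≡ false
      uz with A u z | ℕ.m+n≡0⇒m≡0 (𝟙 (A u z)) rest0
      ... | false | _ = refl
      bigNbr : ∀ x → A z x ≡ true → A u x ≡ true → isB x ≡ true
      bigNbr x p q with isB x in e
      ... | true  = refl
      ... | false = contradiction (∑-zero⇒ (λ w → 𝟙 (isL w) * 𝟙 (A u w) * 𝟙 (A w z)) (Mem.∈-allFin x)
                      (ℕ.m+n≡0⇒n≡0 (𝟙 (A u z)) rest0)) nonzero
        where
        nonzero : 𝟙 (isL x) * 𝟙 (A u x) * 𝟙 (A x z) ≢ 0
        nonzero rewrite e | q | trans (sA x z) p = λ ()
      inB : ∀ x → A z x ≡ true → A u x ≡ true → x ∈ₗ NB z
      inB x p q = ∈NB (bigNbr x p q) p
      inB′ : ∀ x → A z x ≡ true → A u x ≡ true → x ∈ₗ NB u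
      inB′ x p q = ∈NB (bigNbr x p q) q
    count : ∀ {y} → isL (φ y) ≡ true → ∑ vs (𝟙 ∘ bad y) ≤ ball≤
    count {y} l = begin
      ∑ vs (𝟙 ∘ bad y) ≤⟨ ∑-mono vs (λ z _ → ind (ball u z)) ⟩
      ∑ vs (ball u) ≡⟨ trans (∑-+ _ _ vs) (cong (∑ vs (λ z → 𝟙 ⌊ z Fin.≟ u ⌋) +_) (∑-+ _ _ vs)) ⟩
      ∑ vs (λ z → 𝟙 ⌊ z Fin.≟ u ⌋) + (d u + ∑ vs (λ z → ∑ vs (λ w → 𝟙 (isL w) * 𝟙 (A u w) * 𝟙 (A w z))))
        ≤⟨ +-mono-≤ one (+-mono-≤ (<⇒≤ (L-deg l)) second) ⟩
      1 + (D + D * D) ≡⟨ ball≡ ⟩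
      ball≤ ∎
      where
      open ℕ.≤-Reasoning
      u = φ y
      ind : ∀ k → 𝟙 ⌊ 1 ≤? k ⌋ ≤ k
      ind zero    = z≤n
      ind (suc k) = ≤-trans (𝟙≤1 _) (s≤s z≤n)
      one : ∑ vs (λ z → 𝟙 ⌊ z Fin.≟ u ⌋) ≤ 1
      one = ≤-trans (≤-reflexive (∑-cong vs (λ z _ → sym (*-identityʳ _)))) (∑-δ Fin._≟_ u (λ _ → 1) (Uniq.allFin⁺ n))
      low : ∀ w → 𝟙 (isL w) * 𝟙 (A u w) * d w ≤ D * 𝟙 (A u w)
      low w with isL w in e
      ... | false = z≤n
      ... | true  = ≤-trans (≤-reflexive (lem (𝟙 (A u w)) (d w))) (*-monoˡ-≤ (𝟙 (A u w)) (<⇒≤ (L-deg e)))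
        where
        lem : ∀ a b → (a + 0) * b ≡ b * a
        lem = solve-∀
      second : ∑ vs (λ z → ∑ vs (λ w → 𝟙 (isL w) * 𝟙 (A u w) * 𝟙 (A w z))) ≤ D * D
      second = begin
        ∑ vs (λ z → ∑ vs (λ w → 𝟙 (isL w) * 𝟙 (A u w) * 𝟙 (A w z))) ≡⟨ ∑-swap _ vs vs ⟩
        ∑ vs (λ w → ∑ vs (λ z → 𝟙 (isL w) * 𝟙 (A u w) * 𝟙 (A w z))) ≡⟨ ∑-cong vs (λ w _ → ∑-* (𝟙 (isL w) * 𝟙 (A u w)) (𝟙 ∘ A w) vs) ⟩
        ∑ vs (λ w → 𝟙 (isL w) * 𝟙 (A u w) * d w) ≤⟨ ∑-mono vs (λ w _ → low w) ⟩
        ∑ vs (λ w → D * 𝟙 (A u w)) ≡⟨ ∑-* D (𝟙 ∘ A u) vs ⟩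
        D * d u ≤⟨ *-monoʳ-≤ D (<⇒≤ (L-deg l)) ⟩
        D * D ∎

  -- A redistribution of the degree sum: an edge between a big and a small vertex counts twice at
  -- the small end and not at the big one. A vertex of `I` receives exactly 2t.
  w : Fin n → ℕ
  w v = 𝟙 (isB v) * dIn isB v + 𝟙 (isL v) * (2 * dIn isB v + dIn isL v)

  ∑w≡∑d : ∑ vs w ≡ ∑ vs d
  ∑w≡∑d = ℕ.+-cancelʳ-≡ (∑ vs (λ v → 𝟙 (isB v) * dIn isL v)) _ _ (begin
    ∑ vs w + ∑ vs (λ v → 𝟙 (isB v) * dIn isL v) ≡⟨ ∑-+ _ _ vs ⟨
    ∑ vs (λ v → w v + 𝟙 (isB v) * dIn isL v) ≡⟨ ∑-cong vs (λ v _ → trans (lem (isB v) _ _) (cong (_+ 𝟙 (isL v) * dIn isB v) (sym (d-split v)))) ⟩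
    ∑ vs (λ v → d v + 𝟙 (isL v) * dIn isB v) ≡⟨ ∑-+ _ _ vs ⟩
    ∑ vs d + ∑ vs (λ v → 𝟙 (isL v) * dIn isB v) ≡⟨ cong (∑ vs d +_) (dIn-swap isL isB) ⟩
    ∑ vs d + ∑ vs (λ v → 𝟙 (isB v) * dIn isL v) ∎)
    where
    open ≡-Reasoning
    onB : ∀ b l → (b + 0) + 0 + (l + 0) ≡ b + l + 0
    onB = solve-∀
    onL : ∀ b l → (b + (b + 0)) + l + 0 + 0 ≡ b + l + (b + 0)
    onL = solve-∀
    lem : ∀ p b l → (𝟙 p * b + 𝟙 (not p) * (2 * b + l)) + 𝟙 p * l ≡ b + l + 𝟙 (not p) * b
    lem true  b l = onB b l
    lem false b l = onL b l

  private
    -- The term κ, paid for each vertex of `Y`, covers the base 4t(t+1), the extra 1 and the at most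
    -- D cross terms of a small vertex.
    deficient : ∀ v → isB v ≡ false → 4 * (t * suc t) + 1 + (dIn is3 v + 0) ≤
      2 * suc t * (2 * dIn isB v + dIn isL v + 0) + κ * 1 + κ * 0 + 0
    deficient v eB = begin
      4 * (t * suc t) + 1 + (dIn is3 v + 0) ≡⟨ lem₁ (4 * (t * suc t)) (dIn is3 v) ⟩
      suc (4 * (t * suc t)) + dIn is3 v ≤⟨ +-monoʳ-≤ (suc (4 * (t * suc t))) (≤-trans (dIn≤d is3 v) (<⇒≤ (L-deg (cong not eB)))) ⟩
      suc (4 * (t * suc t)) + D ≡⟨ κ≡ ⟩
      κ ≤⟨ m≤n+m (κ) (2 * suc t * (2 * dIn isB v + dIn isL v + 0)) ⟩
      _ + κ ≡⟨ lem₂ (2 * suc t * (2 * dIn isB v + dIn isL v + 0)) (κ) ⟩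
      2 * suc t * (2 * dIn isB v + dIn isL v + 0) + κ * 1 + κ * 0 + 0 ∎
      where
      open ℕ.≤-Reasoning
      lem₁ : ∀ a f → a + 1 + (f + 0) ≡ suc a + f
      lem₁ = solve-∀
      lem₂ : ∀ a κ → a + κ ≡ a + κ * 1 + κ * 0 + 0
      lem₂ = solve-∀

    -- Each unit of degree beyond t is worth 2(t+1), which must cover the extra 1 and at most d(v)
    -- cross terms. At degree t + 1 this amounts to t + 2 ≤ 2(t+1), and the choice of scale leaves
    -- this room.
    rich : ∀ v → t < d v → t ≤ dIn isB v → 4 * (t * suc t) + 1 + (dIn is3 v + 0) ≤
      2 * suc t * (2 * dIn isB v + dIn isL v + 0) + κ * 0 + κ * 0 + 0
    rich v t<d t≤b with ℕ.m≤n⇒∃[o]m+o≡n t<d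
    ... | e , eq = begin
      4 * (t * suc t) + 1 + (dIn is3 v + 0) ≤⟨ +-monoʳ-≤ (4 * (t * suc t) + 1) (+-monoˡ-≤ 0 (≤-trans (dIn≤d is3 v) (≤-reflexive (sym eq)))) ⟩
      4 * (t * suc t) + 1 + (suc t + e + 0) ≤⟨ m≤m+n _ (t + e + 2 * t * e) ⟩
      4 * (t * suc t) + 1 + (suc t + e + 0) + (t + e + 2 * t * e) ≡⟨ lem₁ t e ⟩
      2 * suc t * (t + (suc t + e)) ≤⟨ *-monoʳ-≤ (2 * suc t) (+-mono-≤ t≤b (≤-reflexive (trans eq (d-split v)))) ⟩
      2 * suc t * (dIn isB v + (dIn isB v + dIn isL v)) ≡⟨ lem₂ t (dIn isB v) (dIn isL v) (κ) ⟩
      2 * suc t * (2 * dIn isB v + dIn isL v + 0) + κ * 0 + κ * 0 + 0 ∎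
      where
      open ℕ.≤-Reasoning
      lem₁ : ∀ t e → 4 * (t * suc t) + 1 + (suc t + e + 0) + (t + e + 2 * t * e) ≡ 2 * suc t * (t + (suc t + e))
      lem₁ = solve-∀
      lem₂ : ∀ t b l κ → 2 * suc t * (b + (b + l)) ≡ 2 * suc t * (2 * b + l + 0) + κ * 0 + κ * 0 + 0
      lem₂ = solve-∀

    touching : ∀ v → 4 * (t * suc t) + 1 + 0 ≤ 2 * suc t * (dIn isB v + 0 + 0) + κ * 0 + κ * 1 + 0
    touching v = begin
      4 * (t * suc t) + 1 + 0 ≡⟨ lem₁ (4 * (t * suc t)) ⟩
      suc (4 * (t * suc t)) ≤⟨ m≤m+n _ D ⟩
      suc (4 * (t * suc t)) + D ≡⟨ κ≡ ⟩
      κ ≤⟨ m≤n+m κ (2 * suc t * (dIn isB v + 0 + 0)) ⟩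
      2 * suc t * (dIn isB v + 0 + 0) + κ ≡⟨ lem₂ (2 * suc t * (dIn isB v + 0 + 0)) κ ⟩
      2 * suc t * (dIn isB v + 0 + 0) + κ * 0 + κ * 1 + 0 ∎
      where
      open ℕ.≤-Reasoning
      lem₁ : ∀ a → a + 1 + 0 ≡ suc a
      lem₁ = solve-∀
      lem₂ : ∀ a κ → a + κ ≡ a + κ * 0 + κ * 1 + 0
      lem₂ = solve-∀

    -- One big neighbour more than 2t is worth 2(t+1) and pays the extra 1, hence the value of `D′`.
    many : ∀ v → D′ ≤ dIn isB v →
      4 * (t * suc t) + 1 + 0 ≤ 2 * suc t * (dIn isB v + 0 + 0) + κ * 0 + κ * 0 + 0
    many v le = begin
      4 * (t * suc t) + 1 + 0 ≤⟨ m≤m+n _ (suc (2 * t)) ⟩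
      4 * (t * suc t) + 1 + 0 + suc (2 * t) ≡⟨ lem₁ t ⟩
      2 * suc t * suc (2 * t) ≡⟨ cong (2 * suc t *_) D′≡ ⟩
      2 * suc t * D′ ≤⟨ *-monoʳ-≤ (2 * suc t) le ⟩
      2 * suc t * dIn isB v ≡⟨ lem₂ t (dIn isB v) (κ) ⟩
      2 * suc t * (dIn isB v + 0 + 0) + κ * 0 + κ * 0 + 0 ∎
      where
      open ℕ.≤-Reasoning
      lem₁ : ∀ t → 4 * (t * suc t) + 1 + 0 + suc (2 * t) ≡ 2 * suc t * suc (2 * t)
      lem₁ = solve-∀
      lem₂ : ∀ t b κ → 2 * suc t * b ≡ 2 * suc t * (b + 0 + 0) + κ * 0 + κ * 0 + 0
      lem₂ = solve-∀

    -- A big vertex with fewer than D′ big neighbours and none in `I` has at least D - D′ = 4t(t+1)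
    -- + 1 neighbours in `R`. Its cross terms alone pay for it, hence the value of `D`.
    poor : ∀ v → isB v ≡ true → dIn isB v < D′ → dIn isI v ≡ 0 →
      4 * (t * suc t) + 1 + 0 ≤ 2 * suc t * (dIn isB v + 0 + 0) + κ * 0 + κ * 0 + (dIn isR v + 0)
    poor v eB b< i≡0 = ≤-trans (ℕ.+-cancelʳ-≤ D′ _ _ (begin
      4 * (t * suc t) + 1 + 0 + D′ ≡⟨ trans (lem (4 * (t * suc t)) D′) D≡ ⟩
      D ≤⟨ B-deg {v} eB ⟩
      d v ≡⟨ trans (∑-cong vs (λ z _ → cover (isB z) (isI z) (I⇒L z) (𝟙 (A v z)))) (trans (∑-+ _ _ vs) (cong (dIn isB v +_) (∑-+ _ _ vs))) ⟩
      dIn isB v + (dIn isI v + dIn isR v) ≤⟨ +-mono-≤ (<⇒≤ b<) (≤-reflexive (cong (_+ dIn isR v) i≡0)) ⟩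
      D′ + dIn isR v ≡⟨ ℕ.+-comm D′ (dIn isR v) ⟩
      dIn isR v + D′ ∎))
      (≤-trans (≤-reflexive (sym (+-identityʳ _))) (m≤n+m (dIn isR v + 0) (2 * suc t * (dIn isB v + 0 + 0) + κ * 0 + κ * 0)))
      where
      open ℕ.≤-Reasoning
      lem : ∀ a b → a + 1 + 0 + b ≡ suc a + b
      lem = solve-∀
      I⇒L : ∀ z → isI z ≡ true → isB z ≡ false
      I⇒L z e = 𝔹.not-injective (proj₁ (I-facts {z} e))
      cover : ∀ b i → (i ≡ true → b ≡ false) → ∀ x → x ≡ 𝟙 b * x + (𝟙 i * x + 𝟙 (not b ∧ not i) * x)
      cover true  true  h x = contradiction (h refl) λ ()
      cover true  false h x = sym (trans (+-identityʳ _) (+-identityʳ x))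
      cover false true  h x = sym (trans (+-identityʳ _) (+-identityʳ x))
      cover false false h x = sym (+-identityʳ x)

  -- Summed over all v, the cross terms 𝟙 (isR v) * dIn is3 v and 𝟙 (is3 v) * dIn isR v cancel.
  weight : ∀ v → 4 * (t * suc t) + 𝟙 (not (isI v)) + 𝟙 (isR v) * dIn is3 v ≤
    2 * suc t * w v + κ * 𝟙 (isY v) + κ * 𝟙 (isZ v) + 𝟙 (is3 v) * dIn isR v
  weight v with isB v in eB
  weight v | false with d v ℕ.≟ t | dIn isB v ℕ.≟ t | dIn isB v <? t
  ... | yes _ | yes b≡t | yes b<t = contradiction b≡t (ℕ.<⇒≢ b<t)
  ... | yes _ | yes b≡t | no _ = subst (λ b → 4 * (t * suc t) + 0 + 0 ≤ 2 * suc t * (2 * b + dIn isL v + 0) + κ * 0 + κ * 0 + 0)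
          (sym b≡t) (≤-trans (m≤m+n _ (2 * suc t * dIn isL v)) (≤-reflexive (lem t (dIn isL v) (κ))))
    where
    lem : ∀ t l κ → 4 * (t * suc t) + 0 + 0 + 2 * suc t * l ≡ 2 * suc t * (2 * t + l + 0) + κ * 0 + κ * 0 + 0
    lem = solve-∀
  ... | yes d≡t | no b≢t | no b≮t =
    contradiction (ℕ.≤-antisym (≤-trans (dIn≤d isB v) (≤-reflexive d≡t)) (≮⇒≥ b≮t)) b≢t
  ... | yes _   | no _ | yes _   = deficient v eB
  ... | no _    | _    | yes _   = deficient v eB
  ... | no d≢t  | _    | no b≮t  = rich v (ℕ.≤∧≢⇒< (d≥t v) (d≢t ∘ sym)) (≮⇒≥ b≮t)
  weight v | true with dIn isB v <? D′ | 1 ≤? dIn isI v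
  ... | no b≮   | _     = many v (≮⇒≥ b≮)
  ... | yes _   | yes _ = touching v
  ... | yes b<  | no i≮ = poor v eB b< (ℕ.n<1⇒n≡0 (≰⇒> i≮))

  hs is : List (Fin n)
  hs = sel (not ∘ isI) vs
  is = sel isI vs

  partition : length hs + length is ≡ n
  partition = trans (ℕ.+-comm (length hs) (length is)) (trans (length-sel-not isI vs) (List.length-tabulate id))

  -- The two cross sums agree by double counting the edges between `R` and `is3`, and cancel. What
  -- is left bounds the number of vertices outside `I` by a multiple of m - tn plus a constant, m
  -- being the number of edges.
  excess : 4 * (t * suc t) * n + length hs ≤ 2 * suc t * (2 * edges G) + 2 * (κ * bound)
  excess = ℕ.+-cancelʳ-≤ X _ _ (begin
    4 * (t * suc t) * n + length hs + X
      ≡⟨ cong₂ (λ a b → a + b + X) const (length-sel (not ∘ isI) vs) ⟩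
    ∑ vs (λ _ → 4 * (t * suc t)) + ∑ vs (λ v → 𝟙 (not (isI v))) + X
      ≡⟨ cong (_+ X) (sym (∑-+ _ _ vs)) ⟩
    ∑ vs (λ v → 4 * (t * suc t) + 𝟙 (not (isI v))) + X
      ≡⟨ ∑-+ _ _ vs ⟨
    ∑ vs (λ v → 4 * (t * suc t) + 𝟙 (not (isI v)) + 𝟙 (isR v) * dIn is3 v)
      ≤⟨ ∑-mono vs (λ v _ → weight v) ⟩
    ∑ vs (λ v → 2 * suc t * w v + κ * 𝟙 (isY v) + κ * 𝟙 (isZ v) + 𝟙 (is3 v) * dIn isR v)
      ≡⟨ trans (∑-+ _ _ vs) (cong₂ _+_ (trans (∑-+ _ _ vs) (cong₂ _+_ (trans (∑-+ _ _ vs)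
          (cong₂ _+_ (∑-* (2 * suc t) w vs) (∑-* κ (𝟙 ∘ isY) vs))) (∑-* κ (𝟙 ∘ isZ) vs))) (dIn-swap is3 isR)) ⟩
    2 * suc t * ∑ vs w + κ * ∑ vs (𝟙 ∘ isY) + κ * ∑ vs (𝟙 ∘ isZ) + X
      ≤⟨ +-monoˡ-≤ X (+-mono-≤ (+-mono-≤ (≤-reflexive (cong (2 * suc t *_) (trans ∑w≡∑d (sym (handshake G)))))
          (*-monoʳ-≤ κ (subst (_≤ bound) (length-sel isY vs) |Y|≤))) (*-monoʳ-≤ κ (subst (_≤ bound) (length-sel isZ vs) |Z|≤))) ⟩
    2 * suc t * (2 * edges G) + κ * bound + κ * bound + X
      ≡⟨ cong (_+ X) (double (2 * suc t * (2 * edges G)) (κ * bound)) ⟩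
    2 * suc t * (2 * edges G) + 2 * (κ * bound) + X ∎)
    where
    open ℕ.≤-Reasoning
    X = ∑ vs (λ v → 𝟙 (isR v) * dIn is3 v)
    const : 4 * (t * suc t) * n ≡ ∑ vs (λ _ → 4 * (t * suc t))
    const = sym (trans (∑-const (4 * (t * suc t)) vs) (trans (cong (_* (4 * (t * suc t))) (List.length-tabulate {n = n} id)) (ℕ.*-comm n (4 * (t * suc t)))))
    double : ∀ a b → a + b + b ≡ a + 2 * b
    double = solve-∀

  split : SplitGraph c t A hs is
  split = record
    { symm = sA ; irre = iA
    ; uniqH = sel-unique (not ∘ isI) (Uniq.allFin⁺ n) ; uniqI = sel-unique isI (Uniq.allFin⁺ n)
    ; disj = λ p q → true≢false (inI q) (𝔹.not-injective (inH p))
    ; noK = noK₂ ∘ K-mono (2 + c) (λ _ _ → tt)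
    ; sat = λ {x} {y} _ _ ne a → K-mono c (λ z (_ , p) → anywhere z , p) (satG x y ne a)
    ; indep = indep′
    ; degI = λ {x} x∈ → trans (∑-sel (not ∘ isI) (𝟙 ∘ A x) vs)
        (trans (∑-cong vs (λ z _ → outside x z (inI x∈))) (proj₁ (proj₂ (I-facts {x} (inI x∈)))))
    ; dist = dist′ }
    where
    inI : ∀ {x} → x ∈ₗ is → isI x ≡ true
    inI x∈ = proj₂ (∈-sel⁻ {p = isI} {xs = vs} x∈)
    inH : ∀ {x} → x ∈ₗ hs → not (isI x) ≡ true
    inH x∈ = proj₂ (∈-sel⁻ {p = not ∘ isI} {xs = vs} x∈)
    anywhere : ∀ z → In hs is z
    anywhere z with isI z in e
    ... | true  = inj₂ (∈-sel⁺ {p = isI} (Mem.∈-allFin z) e)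
    ... | false = inj₁ (∈-sel⁺ {p = not ∘ isI} (Mem.∈-allFin z) (cong not e))
    indep′ : ∀ {x y} → x ∈ₗ is → y ∈ₗ is → A x y ≡ false
    indep′ {x} {y} x∈ y∈ with A x y in a
    ... | false = refl
    ... | true  = contradiction (𝔹.not-injective (proj₁ (I-facts {y} (inI y∈)))) (true≢false (I-nbr {x} {y} (inI x∈) a))
    outside : ∀ x z → isI x ≡ true → 𝟙 (not (isI z)) * 𝟙 (A x z) ≡ 𝟙 (A x z)
    outside x z e with A x z in a
    ... | false = ℕ.*-zeroʳ (𝟙 (not (isI z)))
    ... | true with isI z in i
    ...   | false = refl
    ...   | true  = contradiction (𝔹.not-injective (proj₁ (I-facts {z} i))) (true≢false (I-nbr {x} {z} e a))
    dist′ : ∀ {x y} → x ∈ₗ is → y ∈ₗ is → x ≢ y → ∃ λ h → h ∈ₗ hs × A x h ≢ A y h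
    dist′ {x} {y} x∈ y∈ ne with Fin.any? (λ z → ¬? (A x z ≟ᵇ A y z))
    ... | yes (z , differ) = z , inHs , differ
      where
      inHs : z ∈ₗ hs
      inHs with anywhere z
      ... | inj₁ p = p
      ... | inj₂ q = contradiction (trans (indep′ x∈ q) (sym (indep′ y∈ q))) differ
    -- Equal neighbourhoods make `x` and `y` twins. Their common neighbour of degree t would be big,
    -- as all neighbours of `I` are, contradicting t < D.
    ... | no same with proj₂ (proj₂ adm) x y (ne , λ z → decidable-stable (_ ≟ᵇ _) (λ differ → same (z , differ)))
    ...   | z , xz , _ , dz = contradiction (≤-trans (B-deg {z} (I-nbr {x} {z} (inI x∈) xz)) (≤-reflexive (trans (sym (deg≡∑ G z)) dz)))
                                (<⇒≱ t<D)

-- Assembly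

∑-sel-not : (p : V → Bool) (f : V → ℕ) (xs : List V) → ∑ (sel (not ∘ p) xs) f + ∑ (sel p xs) f ≡ ∑ xs f
∑-sel-not p f xs = trans (cong₂ _+_ (∑-sel (not ∘ p) f xs) (∑-sel p f xs))
  (trans (sym (∑-+ _ _ xs)) (∑-cong xs (λ x _ → lem (p x) (f x))))
  where
  lem : ∀ b y → 𝟙 (not b) * y + 𝟙 b * y ≡ y
  lem true  y = +-identityʳ y
  lem false y = trans (+-identityʳ _) (+-identityʳ y)

-- Without edges the core has at most t vertices, and these have only 2^t subsets. Positivity allows
-- additive constants to be absorbed into multiples of the edge number.
edges≥1 : ∀ {ρ t s m} → 2 ^ t < s → SystemWith (3 + ρ) t s m → 1 ≤ m
edges≥1 {m = suc m} _ _ = s≤s z≤n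
edges≥1 {ρ} {t} {s} {zero} big sys@(v , H , F , M , len , _) = contradiction
  (subst₂ _≤_ (trans length-is len) (cong (2 ^_) length-hs) (length-is≤ split))
  (<⇒≱ (ℕ.≤-<-trans (ℕ.^-monoʳ-≤ 2 (subst (v ≤_) (+-identityʳ t) (vertices≤ (≤-trans (s≤s z≤n) big) sys))) big))
  where open FromSystem {suc ρ} {t} {v} {H} {F} M

-- Cleaning may cost t sets per core vertex, and the hypothesis on s provides for this. What exceeds
-- n vertices afterwards, at most s + v - n, is trimmed at bounded cost each.
buildGraph : ∀ {ρ t s e n} → 1 ≤ t → (sys : SystemWith (3 + ρ) t s e) →
  n + proj₁ sys * t ≤ s → proj₁ sys + proj₁ sys * t ≤ n →
  Σ (Graph n) λ G → TsatAdmissible (3 + ρ) t G ×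
    2 * edges G ≤ 2 * (t * n) + (2 * e + proj₁ sys * cleanCost t + (s + proj₁ sys ∸ n) * (2 * (t * t)))
buildGraph {ρ} {t} {s} {e} {n} 1≤t (v , H , F , M , len , eq) n+vt≤s room =
  subst (λ k → Σ (Graph k) λ G → TsatAdmissible (3 + ρ) t G × 2 * edges G ≤ total)
    (trans (List.length-++ hs′) Tr.total)
    (proj₁ G , proj₁ (proj₂ G) , bound)
  where
  open FromSystem {suc ρ} {t} {v} {H} {F} M using (_≟ⱽ_; joined; hs; is; split; length-hs; length-is; E-hs)
  open ℕ.≤-Reasoning
  total = 2 * (t * n) + (2 * e + v * cleanCost t + (s + v ∸ n) * (2 * (t * t)))
  module Cl = CleanedUp (cleanUp _≟ⱽ_ (length hs) refl split)
  hs′ = Cl.hs′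
  is≥n : n ≤ length Cl.is′
  is≥n = ℕ.+-cancelʳ-≤ (v * t) _ _ (≤-trans n+vt≤s
    (subst₂ _≤_ (trans length-is len) (cong (λ k → length Cl.is′ + k * t) length-hs) Cl.is≥))
  d = length hs′ + length Cl.is′ ∸ n
  d≡ : length hs′ + length Cl.is′ ≡ n + d
  d≡ = sym (ℕ.m+[n∸m]≡n (≤-trans is≥n (m≤n+m _ _)))
  hs′≤v : length hs′ ≤ v
  hs′≤v = subst (length hs′ ≤_) length-hs Cl.hs≤
  d≤ : d ≤ s + v ∸ n
  d≤ = ℕ.∸-monoˡ-≤ n (≤-trans (+-mono-≤ hs′≤v (subst (length Cl.is′ ≤_) (trans length-is len) Cl.is≤)) (≤-reflexive (ℕ.+-comm v s)))
  module Tr = Trimmed (trim _≟ⱽ_ d 1≤t Cl.splitC Cl.clean d≡ (≤-trans (+-mono-≤ hs′≤v (*-monoˡ-≤ t hs′≤v)) room))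
  G = admissible Tr.splitT Tr.cleanT
  js≤n : length Tr.js ≤ n
  js≤n = ≤-trans (m≤n+m _ (length hs′)) (≤-reflexive Tr.total)
  bound : 2 * edges (proj₁ G) ≤ total
  bound = begin
    2 * edges (proj₁ G) ≡⟨ proj₂ (proj₂ G) ⟩
    E hs′ Tr.B + 2 * (t * length Tr.js) ≤⟨ +-mono-≤ Tr.ET (*-monoʳ-≤ 2 (*-monoʳ-≤ t js≤n)) ⟩
    E hs′ Cl.B + d * (2 * (t * t)) + 2 * (t * n)
      ≤⟨ +-monoˡ-≤ (2 * (t * n)) (+-mono-≤ Cl.EC (*-monoˡ-≤ (2 * (t * t)) d≤)) ⟩
    E hs joined + length hs * cleanCost t + (s + v ∸ n) * (2 * (t * t)) + 2 * (t * n)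
      ≡⟨ cong₂ (λ a b → a + b * cleanCost t + (s + v ∸ n) * (2 * (t * t)) + 2 * (t * n)) (trans E-hs (cong (2 *_) eq)) length-hs ⟩
    2 * e + v * cleanCost t + (s + v ∸ n) * (2 * (t * t)) + 2 * (t * n)
      ≡⟨ ℕ.+-comm _ (2 * (t * n)) ⟩
    total ∎

-- Used with P s = (s ≥ n + t (t + 2 e(s))): since e is not monotone, the first such s₀ is compared with
-- s₀ - 1, which bounds s₀ - n by O(e(s₀ - 1)); b(n) is whichever of the two has the larger e.
firstStep : {P : ℕ → Set} → (∀ m → Dec (P m)) → ∀ n j → ¬ P n → P (n + j) →
  ∃ λ s → n ≤ s × s < n + j × ¬ P s × P (suc s)
firstStep {P} P? n zero    ¬pn p = contradiction (subst P (+-identityʳ n) p) ¬pn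
firstStep {P} P? n (suc j) ¬pn p with P? (n + j)
... | yes p′ = let s , n≤s , s< , r = firstStep P? n j ¬pn p′ in s , n≤s , ≤-trans s< (+-monoʳ-≤ n (n≤1+n j)) , r
... | no ¬p  = n + j , m≤m+n n j , ≤-reflexive (sym (+-suc n j)) , ¬p , subst P (+-suc n j) p

excessEdges : ∀ t M {e₀ v g c x} → e₀ ≤ M → v ≤ (t + 2) * M → g ≤ t * (t + 2) * M + (t + 2) * M →
  2 * e₀ + v * c + g * x ≤ (2 + (t + 2) * c + (t * (t + 2) + (t + 2)) * x) * M
excessEdges t M {c = c} {x} e₀≤ v≤ g≤ = ≤-trans
  (+-mono-≤ (+-mono-≤ (*-monoʳ-≤ 2 e₀≤) (*-monoˡ-≤ c v≤)) (*-monoˡ-≤ x g≤))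
  (≤-reflexive (arith t M c x))
  where
  arith : ∀ t M c x → 2 * M + (t + 2) * M * c + (t * (t + 2) * M + (t + 2) * M) * x ≡
    (2 + (t + 2) * c + (t * (t + 2) + (t + 2)) * x) * M
  arith = solve-∀

Bounds : ℕ → ℕ → Set
Bounds r t = Σ (ℕ → ℕ) λ a → Σ (ℕ → ℕ) λ b →
  IsNPlusLittleO a × IsNPlusLittleO b ×
  Σ ℕ λ cp → Σ ℕ λ cq → Σ ℕ λ Cp → Σ ℕ λ Cq →
  1 ≤ cp × 1 ≤ cq × 1 ≤ Cp × 1 ≤ Cq ×
  Σ ℕ λ N → ∀ n → N ≤ n →
  Σ ℕ λ m → Σ ℕ λ ea → Σ ℕ λ eb →
  IsTsat n r t m × IsE' r t (a n) ea × IsE' r t (b n) eb ×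
  cq * (t * n) + cp * ea ≤ cq * m ×
  Cq * m ≤ Cq * (t * n) + Cp * eb

module EdgeMinimum (r t N₁ : ℕ) (e′ : ∀ s → N₁ ≤ s → ∃ (IsE' r t s))
  (small : ∀ j → ∃ λ N → ∀ s → N ≤ s → ∃ λ m → SystemWith r t s m × j * m ≤ s) where

  -- The value 0 below N₁ is junk.
  e : ℕ → ℕ
  e s with N₁ ≤? s
  ... | yes le = proj₁ (e′ s le)
  ... | no _   = 0

  e-spec : ∀ {s} → N₁ ≤ s → IsE' r t s (e s)
  e-spec {s} le with N₁ ≤? s
  ... | yes le′ = proj₂ (e′ s le′)
  ... | no ¬le  = contradiction le ¬le

  e-small : ∀ j → ∃ λ N → ∀ s → N ≤ s → j * e s ≤ s
  e-small j = let N , sys = small j in N + N₁ , λ s le →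
    let m , S , jm≤s = sys s (≤-trans (m≤m+n N N₁) le)
    in ≤-trans (*-monoʳ-≤ j (proj₂ (e-spec (≤-trans (m≤n+m N₁ N) le)) m S)) jm≤s

-- The constants are parameters with defining equations, so that they stay opaque in the estimates;
-- they are supplied by `refl` at the end.
module Main (ρ t : ℕ) (1≤t : 1 ≤ t) (N₁ : ℕ) (e : ℕ → ℕ)
  (e-spec : ∀ {s} → N₁ ≤ s → IsE' (3 + ρ) t s (e s))
  (e-small : ∀ j → ∃ λ N → ∀ s → N ≤ s → j * e s ≤ s)
  (Cp C₃ C₄ D′ D κ ball≤ : ℕ)
  (Cp≡ : 2 + (t + 2) * cleanCost t + (t * (t + 2) + (t + 2)) * (2 * (t * t)) ≡ Cp)
  (C₄≡ : 4 * suc t * Cp ≡ C₄) (D′≡ : suc (2 * t) ≡ D′) (D≡ : suc (4 * (t * suc t)) + D′ ≡ D)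
  (κ≡ : suc (4 * (t * suc t)) + D ≡ κ) (ball≡ : suc D + D * D ≡ ball≤)
  (C₃≡ : 2 * (κ * (ball≤ * skewBound (D ^ suc ρ) (D ^ suc ρ))) ≡ C₃) where

  r : ℕ
  r = 3 + ρ

  smallFrom : ℕ → ℕ
  smallFrom j = proj₁ (e-small j)

  -- The summands ensure in turn that `e` is a genuine minimum, that it is positive by `edges≥1`,
  -- and that `room` holds.
  upperFrom : ℕ
  upperFrom = N₁ + (suc (2 ^ t) + (2 * (suc t * t) + smallFrom (8 * suc t)))

  record Upper (n : ℕ) : Set where
    field
      b    : ℕ
      n≤b  : n ≤ b
      b≤2n : b ≤ n + n
      b-n≤ : b ∸ n ≤ t * (t + 2) * e b
      G    : Graph n
      adm  : TsatAdmissible r t G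
      2m≤  : 2 * edges G ≤ 2 * (t * n) + Cp * e b

  upper : ∀ n → upperFrom ≤ n → Upper n
  upper n big = result
    where
    open ℕ.≤-Reasoning
    n≥N₁ : N₁ ≤ n
    n≥N₁ = ≤-trans (m≤m+n N₁ _) big
    rest : suc (2 ^ t) + (2 * (suc t * t) + smallFrom (8 * suc t)) ≤ n
    rest = ≤-trans (m≤n+m _ N₁) big
    n>2^t : 2 ^ t < n
    n>2^t = ≤-trans (m≤m+n (suc (2 ^ t)) _) rest
    rest′ : 2 * (suc t * t) + smallFrom (8 * suc t) ≤ n
    rest′ = ≤-trans (m≤n+m _ (suc (2 ^ t))) rest
    -- Because e(s) = o(s), the core together with t sets for each of its vertices fits into n. This
    -- makes 2n a good size and satisfies the hypothesis of `trim`.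
    room : ∀ s → n ≤ s → s ≤ n + n → suc t * (t + 2 * e s) ≤ n
    room s n≤s s≤2n = ℕ.*-cancelˡ-≤ 4 (begin
      4 * (suc t * (t + 2 * e s)) ≡⟨ arith₁ t (e s) ⟩
      2 * (2 * (suc t * t)) + 8 * suc t * e s ≤⟨ +-mono-≤ (*-monoʳ-≤ 2 (≤-trans (m≤m+n (2 * (suc t * t)) _) rest′))
          (proj₂ (e-small (8 * suc t)) s (≤-trans (≤-trans (m≤n+m _ (2 * (suc t * t))) rest′) n≤s)) ⟩
      2 * n + s ≤⟨ +-monoʳ-≤ (2 * n) s≤2n ⟩
      2 * n + (n + n) ≡⟨ arith₂ n ⟩
      4 * n ∎)
      where
      arith₁ : ∀ t e → 4 * (suc t * (t + 2 * e)) ≡ 2 * (2 * (suc t * t)) + 8 * suc t * e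
      arith₁ = solve-∀
      arith₂ : ∀ n → 2 * n + (n + n) ≡ 4 * n
      arith₂ = solve-∀
    Good : ℕ → Set
    Good s = n + (t + 2 * e s) * t ≤ s
    good? : ∀ s → Dec (Good s)
    good? s = _ ≤? s
    bad-n : ¬ Good n
    bad-n g = <⇒≱ (ℕ.m<m+n n (*-mono-≤ {1} {t + 2 * e n} {1} {t} (≤-trans 1≤t (m≤m+n t _)) 1≤t)) g
    good-2n : Good (n + n)
    good-2n = +-monoʳ-≤ n (≤-trans (≤-trans (≤-reflexive (ℕ.*-comm (t + 2 * e (n + n)) t)) (m≤n+m _ (t + 2 * e (n + n))))
      (room (n + n) (m≤m+n n n) ≤-refl))
    step = firstStep good? n n bad-n good-2n
    s₁ = proj₁ step
    s₀ = suc s₁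
    n≤s₁ : n ≤ s₁
    n≤s₁ = proj₁ (proj₂ step)
    s₀≤2n : s₀ ≤ n + n
    s₀≤2n = proj₁ (proj₂ (proj₂ step))
    n≤s₀ : n ≤ s₀
    n≤s₀ = ≤-trans n≤s₁ (n≤1+n s₁)
    s₀≤ : s₀ ≤ n + (t + 2 * e s₁) * t
    s₀≤ = ≰⇒> (proj₁ (proj₂ (proj₂ (proj₂ step))))
    good₀ : Good s₀
    good₀ = proj₂ (proj₂ (proj₂ (proj₂ step)))
    E₀ : IsE' r t s₀ (e s₀)
    E₀ = e-spec (≤-trans n≥N₁ n≤s₀)
    sys = proj₁ E₀
    v = proj₁ sys
    v≤ : v ≤ t + 2 * e s₀
    v≤ = vertices≤ (s≤s z≤n) sys
    built = buildGraph {n = n} 1≤t sys (≤-trans (+-monoʳ-≤ n (*-monoˡ-≤ t v≤)) good₀)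
      (≤-trans (≤-reflexive (arith v t)) (≤-trans (*-monoʳ-≤ (suc t) v≤) (room s₀ n≤s₀ s₀≤2n)))
      where
      arith : ∀ v t → v + v * t ≡ suc t * v
      arith = solve-∀
    choose : Σ (Graph n) (λ G → TsatAdmissible r t G ×
        2 * edges G ≤ 2 * (t * n) + (2 * e s₀ + v * cleanCost t + (s₀ + v ∸ n) * (2 * (t * t)))) →
      ∀ b → n ≤ b → b ≤ s₀ → e s₀ ≤ e b → e s₁ ≤ e b → Upper n
    choose (G , adm , 2m≤) b n≤b b≤s₀ e₀≤ e₁≤ = record
      { b = b ; n≤b = n≤b ; b≤2n = ≤-trans b≤s₀ s₀≤2n
      ; b-n≤ = ≤-trans (ℕ.∸-monoˡ-≤ n b≤s₀) gap
      ; G = G ; adm = adm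
      ; 2m≤ = ≤-trans 2m≤ (+-monoʳ-≤ (2 * (t * n))
          (subst (λ C → 2 * e s₀ + v * cleanCost t + (s₀ + v ∸ n) * (2 * (t * t)) ≤ C * M) Cp≡ (excessEdges t M e₀≤ v≤M both))) }
      where
      M = e b
      1≤M : 1 ≤ M
      1≤M = edges≥1 (≤-trans n>2^t n≤b) (proj₁ (e-spec (≤-trans n≥N₁ n≤b)))
      lin : ∀ {x} → x ≤ M → t + 2 * x ≤ (t + 2) * M
      lin {x} x≤M = begin
        t + 2 * x ≤⟨ +-mono-≤ (≤-trans (≤-reflexive (sym (*-identityʳ t))) (*-monoʳ-≤ t 1≤M)) (*-monoʳ-≤ 2 x≤M) ⟩
        t * M + 2 * M ≡⟨ ℕ.*-distribʳ-+ M t 2 ⟨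
        (t + 2) * M ∎
      v≤M : v ≤ (t + 2) * M
      v≤M = ≤-trans v≤ (lin e₀≤)
      gap : s₀ ∸ n ≤ t * (t + 2) * M
      gap = begin
        s₀ ∸ n ≤⟨ ℕ.∸-monoˡ-≤ n s₀≤ ⟩
        n + (t + 2 * e s₁) * t ∸ n ≡⟨ ℕ.m+n∸m≡n n _ ⟩
        (t + 2 * e s₁) * t ≤⟨ *-monoˡ-≤ t (lin e₁≤) ⟩
        (t + 2) * M * t ≡⟨ arith′ t M ⟩
        t * (t + 2) * M ∎
        where
        arith′ : ∀ t M → (t + 2) * M * t ≡ t * (t + 2) * M
        arith′ = solve-∀
      both : s₀ + v ∸ n ≤ t * (t + 2) * M + (t + 2) * M
      both = begin
        s₀ + v ∸ n ≡⟨ ℕ.+-∸-comm v n≤s₀ ⟩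
        s₀ ∸ n + v ≤⟨ +-mono-≤ gap v≤M ⟩
        t * (t + 2) * M + (t + 2) * M ∎
    result : Upper n
    result = [ (λ le → choose built s₁ n≤s₁ (n≤1+n s₁) le ≤-refl)
             , (λ ge → choose built s₀ n≤s₀ ≤-refl ≤-refl ge) ]′ (ℕ.≤-total (e s₀) (e s₁))

  -- A core of fewer than 2 C₃ vertices has fewer than 2^(2 C₃) subsets to serve as neighbourhoods.
  -- From here on the core is large enough for one of two copies of its size to absorb the constant
  -- of `excess`.
  lowerFrom : ℕ
  lowerFrom = 2 * C₃ + 2 ^ (2 * C₃)

  record CoreOf {n} (G : Graph n) : Set where
    field
      a h mR  : ℕ
      h+a≡n   : h + a ≡ n
      deficit : 8 * suc t * (t * n) + h ≤ 8 * suc t * edges G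
      sysR    : SystemWith r t a mR
      count   : t * n + mR ≡ t * h + edges G

  lower : ∀ {n} (G : Graph n) → TsatAdmissible r t G → lowerFrom ≤ n → CoreOf G
  lower {n} G adm big = record
    { a = length is ; h = length hs ; mR = edges coreG ; h+a≡n = partition ; deficit = deficit
    ; sysR = _ , coreG , family split , maximalSystem split , List.length-map (trace split) is , refl
    ; count = count }
    where
    open Lower {suc ρ} {t} D′ D κ ball≤ D′≡ D≡ κ≡ ball≡ G adm
    open ℕ.≤-Reasoning
    coreG = core split
    hs-large : 2 * C₃ ≤ length hs
    hs-large with 2 * C₃ ≤? length hs
    ... | yes le = le
    ... | no ¬le = contradiction big (<⇒≱ (begin-strict
      n ≡⟨ partition ⟨
      length hs + length is ≤⟨ +-monoʳ-≤ (length hs) (length-is≤ split) ⟩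
      length hs + 2 ^ length hs <⟨ ℕ.+-mono-<-≤ (≰⇒> ¬le) (ℕ.^-monoʳ-≤ 2 (<⇒≤ (≰⇒> ¬le))) ⟩
      lowerFrom ∎))
    deficit : 8 * suc t * (t * n) + length hs ≤ 8 * suc t * edges G
    deficit = ℕ.+-cancelʳ-≤ (length hs) _ _ (begin
      8 * suc t * (t * n) + length hs + length hs ≡⟨ arith₁ t n (length hs) ⟩
      2 * (4 * (t * suc t) * n + length hs) ≤⟨ *-monoʳ-≤ 2 (≤-trans excess (≤-reflexive (cong (2 * suc t * (2 * edges G) +_) C₃≡))) ⟩
      2 * (2 * suc t * (2 * edges G) + C₃) ≡⟨ arith₂ t (edges G) C₃ ⟩
      8 * suc t * edges G + 2 * C₃ ≤⟨ +-monoʳ-≤ _ hs-large ⟩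
      8 * suc t * edges G + length hs ∎)
      where
      arith₁ : ∀ t n h → 8 * suc t * (t * n) + h + h ≡ 2 * (4 * (t * suc t) * n + h)
      arith₁ = solve-∀
      arith₂ : ∀ t m c → 2 * (2 * suc t * (2 * m) + c) ≡ 8 * suc t * m + 2 * c
      arith₂ = solve-∀
    total : E (hs ++ is) A ≡ E vs A
    total = trans (both (λ x → ∑ (hs ++ is) (𝟙 ∘ A x))) (∑-cong vs (λ x _ → both (𝟙 ∘ A x)))
      where
      both : ∀ f → ∑ (hs ++ is) f ≡ ∑ vs f
      both f = trans (∑-++ f hs is) (∑-sel-not isI f vs)
    count : t * n + edges coreG ≡ t * length hs + edges G
    count = ℕ.*-cancelˡ-≡ _ _ 2 (begin-equality
      2 * (t * n + edges coreG) ≡⟨ cong (λ k → 2 * (t * k + edges coreG)) (sym partition) ⟩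
      2 * (t * (length hs + length is) + edges coreG) ≡⟨ arith t (length hs) (length is) (edges coreG) ⟩
      2 * (t * length hs) + (2 * edges coreG + 2 * (t * length is))
        ≡⟨ cong (λ k → 2 * (t * length hs) + (k + 2 * (t * length is))) (edges-induce sA iA hs) ⟩
      2 * (t * length hs) + (E hs A + 2 * (t * length is))
        ≡⟨ cong (2 * (t * length hs) +_) (trans (sym (splitEdges split)) (trans total (sym (handshake G)))) ⟩
      2 * (t * length hs) + 2 * edges G ≡⟨ ℕ.*-distribˡ-+ 2 (t * length hs) (edges G) ⟨
      2 * (t * length hs + edges G) ∎)
      where
      arith : ∀ t h i e → 2 * (t * (h + i) + e) ≡ 2 * (t * h) + (2 * e + 2 * (t * i))
      arith = solve-∀

  -- By `count` the core has (m - tn) + th edges, and `deficit` gives h ≤ 8(t+1)(m - tn); together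
  -- at most cq (m - tn).
  cq : ℕ
  cq = suc (8 * suc t * t)

  N : ℕ
  N = upperFrom + (lowerFrom + (2 * N₁ + smallFrom (4 * C₄)))

  record Both (n : ℕ) : Set where
    field
      a b m ea : ℕ
      n≤b      : n ≤ b
      b≤2n     : b ≤ n + n
      a-close  : ∣ a - n ∣ ≤ C₄ * e b
      b-close  : ∣ b - n ∣ ≤ t * (t + 2) * e b
      tsat     : IsTsat n r t m
      isEa     : IsE' r t a ea
      isEb     : IsE' r t b (e b)
      lowerB   : cq * (t * n) + 1 * ea ≤ cq * m
      upperB   : 2 * m ≤ 2 * (t * n) + Cp * e b

  both : ∀ n → N ≤ n → Both n
  both n big = record
    { a = a ; b = b ; m = m ; ea = e a ; n≤b = n≤b ; b≤2n = b≤2n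
    ; a-close = subst (_≤ C₄ * e b) (sym (dist-a)) h≤
    ; b-close = subst (_≤ t * (t + 2) * e b) (sym (trans (ℕ.∣-∣-comm b n) (ℕ.m≤n⇒∣m-n∣≡n∸m n≤b))) b-n≤
    ; tsat = isT ; isEa = isEa ; isEb = e-spec (≤-trans n≥N₁ n≤b)
    ; lowerB = lowerB ; upperB = upperB }
    where
    open ℕ.≤-Reasoning
    open Upper (upper n (≤-trans (m≤m+n upperFrom _) big)) renaming (G to G₁; adm to adm₁)
    rest : lowerFrom + (2 * N₁ + smallFrom (4 * C₄)) ≤ n
    rest = ≤-trans (m≤n+m _ upperFrom) big
    rest′ : 2 * N₁ + smallFrom (4 * C₄) ≤ n
    rest′ = ≤-trans (m≤n+m _ lowerFrom) rest
    n≥2N₁ : 2 * N₁ ≤ n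
    n≥2N₁ = ≤-trans (m≤m+n (2 * N₁) _) rest′
    n≥N₁ : N₁ ≤ n
    n≥N₁ = ≤-trans (ℕ.m≤n*m N₁ 2) n≥2N₁
    T = tsatExists (G₁ , adm₁)
    m = proj₁ T
    isT : IsTsat n r t m
    isT = proj₂ T
    G = proj₁ (proj₁ isT)
    edges≡m : edges G ≡ m
    edges≡m = proj₂ (proj₂ (proj₁ isT))
    open CoreOf (lower G (proj₁ (proj₂ (proj₁ isT))) (≤-trans (m≤m+n lowerFrom _) rest))
      renaming (deficit to deficitG; count to countG)
    deficit : 8 * suc t * (t * n) + h ≤ 8 * suc t * m
    deficit = subst (λ k → 8 * suc t * (t * n) + h ≤ 8 * suc t * k) edges≡m deficitG
    count : t * n + mR ≡ t * h + m
    count = subst (λ k → t * n + mR ≡ t * h + k) edges≡m countG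
    upperB : 2 * m ≤ 2 * (t * n) + Cp * e b
    upperB = ≤-trans (*-monoʳ-≤ 2 (proj₂ isT (edges G₁) (G₁ , adm₁ , refl))) 2m≤
    -- The two bounds meet: m - tn is at least a multiple of h and at most a multiple of e(b). Since
    -- n - a = h, this is what brings a within o(n) of n.
    h≤ : h ≤ C₄ * e b
    h≤ = ℕ.+-cancelˡ-≤ (8 * suc t * (t * n)) _ _ (begin
      8 * suc t * (t * n) + h ≤⟨ deficit ⟩
      8 * suc t * m ≡⟨ arith₁ t m ⟩
      4 * suc t * (2 * m) ≤⟨ *-monoʳ-≤ (4 * suc t) upperB ⟩
      4 * suc t * (2 * (t * n) + Cp * e b) ≡⟨ arith₂ t n Cp (e b) ⟩
      8 * suc t * (t * n) + 4 * suc t * Cp * e b ≡⟨ cong (λ x → 8 * suc t * (t * n) + x * e b) C₄≡ ⟩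
      8 * suc t * (t * n) + C₄ * e b ∎)
      where
      arith₁ : ∀ t m → 8 * suc t * m ≡ 4 * suc t * (2 * m)
      arith₁ = solve-∀
      arith₂ : ∀ t n c x → 4 * suc t * (2 * (t * n) + c * x) ≡ 8 * suc t * (t * n) + 4 * suc t * c * x
      arith₂ = solve-∀
    -- This keeps a at least n/2, and so in the range where `e` is a genuine minimum.
    2h≤n : 2 * h ≤ n
    2h≤n = ℕ.*-cancelˡ-≤ 2 (begin
      2 * (2 * h) ≡⟨ ℕ.*-assoc 2 2 h ⟨
      4 * h ≤⟨ *-monoʳ-≤ 4 h≤ ⟩
      4 * (C₄ * e b) ≡⟨ ℕ.*-assoc 4 C₄ (e b) ⟨
      4 * C₄ * e b ≤⟨ proj₂ (e-small (4 * C₄)) b (≤-trans (≤-trans (m≤n+m _ (2 * N₁)) rest′) n≤b) ⟩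
      b ≤⟨ b≤2n ⟩
      n + n ≡⟨ cong (n +_) (sym (+-identityʳ n)) ⟩
      2 * n ∎)
    a≥N₁ : N₁ ≤ a
    a≥N₁ = ℕ.*-cancelˡ-≤ 2 (ℕ.+-cancelˡ-≤ n _ _ (begin
      n + 2 * N₁ ≤⟨ +-monoʳ-≤ n n≥2N₁ ⟩
      n + n ≡⟨ cong₂ _+_ (sym h+a≡n) (sym h+a≡n) ⟩
      (h + a) + (h + a) ≡⟨ arith h a ⟩
      2 * h + 2 * a ≤⟨ +-monoˡ-≤ (2 * a) 2h≤n ⟩
      n + 2 * a ∎))
      where
      arith : ∀ h a → (h + a) + (h + a) ≡ 2 * h + 2 * a
      arith = solve-∀
    isEa : IsE' r t a (e a)
    isEa = e-spec a≥N₁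
    dist-a : ∣ a - n ∣ ≡ h
    dist-a = trans (cong (∣ a -_∣) (sym h+a≡n)) (trans (ℕ.m≤n⇒∣m-n∣≡n∸m (m≤n+m a h)) (ℕ.m+n∸n≡m h a))
    lowerB : cq * (t * n) + 1 * e a ≤ cq * m
    lowerB = begin
      cq * (t * n) + 1 * e a ≤⟨ +-monoʳ-≤ (cq * (t * n)) (*-monoʳ-≤ 1 (proj₂ isEa mR sysR)) ⟩
      cq * (t * n) + 1 * mR ≡⟨ arith₁ t n mR ⟩
      8 * suc t * t * (t * n) + (t * n + mR) ≡⟨ cong (8 * suc t * t * (t * n) +_) count ⟩
      8 * suc t * t * (t * n) + (t * h + m) ≡⟨ arith₂ t n h m ⟩
      t * (8 * suc t * (t * n) + h) + m ≤⟨ +-monoˡ-≤ m (*-monoʳ-≤ t deficit) ⟩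
      t * (8 * suc t * m) + m ≡⟨ arith₃ t m ⟩
      cq * m ∎
      where
      arith₁ : ∀ t n x → suc (8 * suc t * t) * (t * n) + 1 * x ≡ 8 * suc t * t * (t * n) + (t * n + x)
      arith₁ = solve-∀
      arith₂ : ∀ t n h m → 8 * suc t * t * (t * n) + (t * h + m) ≡ t * (8 * suc t * (t * n) + h) + m
      arith₂ = solve-∀
      arith₃ : ∀ t m → t * (8 * suc t * m) + m ≡ suc (8 * suc t * t) * m
      arith₃ = solve-∀

  -- The value 0 below N is junk.
  a b : ℕ → ℕ
  a n with N ≤? n
  ... | yes le = Both.a (both n le)
  ... | no _   = 0
  b n with N ≤? n
  ... | yes le = Both.b (both n le)
  ... | no _   = 0

  littleO : (f : ℕ → ℕ) (C : ℕ) →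
    (∀ n → N ≤ n → ∃ λ b → n ≤ b × b ≤ n + n × ∣ f n - n ∣ ≤ C * e b) → IsNPlusLittleO f
  littleO f C close k _ = N + smallFrom (2 * (k * C)) , λ n le →
    let b , n≤b , b≤2n , f≤ = close n (≤-trans (m≤m+n N _) le) in ℕ.*-cancelˡ-≤ 2 (begin
      2 * (k * ∣ f n - n ∣) ≤⟨ *-monoʳ-≤ 2 (*-monoʳ-≤ k f≤) ⟩
      2 * (k * (C * e b)) ≡⟨ arith k C (e b) ⟩
      2 * (k * C) * e b ≤⟨ proj₂ (e-small (2 * (k * C))) b (≤-trans (≤-trans (m≤n+m _ N) le) n≤b) ⟩
      b ≤⟨ b≤2n ⟩
      n + n ≡⟨ cong (n +_) (sym (+-identityʳ n)) ⟩
      2 * n ∎)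
    where
    open ℕ.≤-Reasoning
    arith : ∀ k C x → 2 * (k * (C * x)) ≡ 2 * (k * C) * x
    arith = solve-∀

  close-a : ∀ n → N ≤ n → ∃ λ s → n ≤ s × s ≤ n + n × ∣ a n - n ∣ ≤ C₄ * e s
  close-a n le with N ≤? n
  ... | yes p  = Both.b (both n p) , Both.n≤b (both n p) , Both.b≤2n (both n p) , Both.a-close (both n p)
  ... | no ¬le = contradiction le ¬le

  close-b : ∀ n → N ≤ n → ∃ λ s → n ≤ s × s ≤ n + n × ∣ b n - n ∣ ≤ t * (t + 2) * e s
  close-b n le with N ≤? n
  ... | yes p  = Both.b (both n p) , Both.n≤b (both n p) , Both.b≤2n (both n p) , Both.b-close (both n p)
  ... | no ¬le = contradiction le ¬le

  main : ∀ n → N ≤ n → Σ ℕ λ m → Σ ℕ λ ea → Σ ℕ λ eb →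
    IsTsat n r t m × IsE' r t (a n) ea × IsE' r t (b n) eb ×
    cq * (t * n) + 1 * ea ≤ cq * m × 2 * m ≤ 2 * (t * n) + Cp * eb
  main n le with N ≤? n
  ... | yes p  = Bn.m , Bn.ea , e Bn.b , Bn.tsat , Bn.isEa , Bn.isEb , Bn.lowerB , Bn.upperB
    where module Bn = Both (both n p)
  ... | no ¬le = contradiction le ¬le

  bounds : Bounds r t
  bounds = a , b , littleO a C₄ close-a , littleO b (t * (t + 2)) close-b ,
    1 , cq , Cp , 2 , s≤s z≤n , s≤s z≤n , subst (1 ≤_) Cp≡ (s≤s z≤n) , s≤s z≤n , N , main

bounds : ∀ ρ t → 1 ≤ t → (∀ j → ∃ λ N → ∀ s → N ≤ s → ∃ λ m → SystemWith (3 + ρ) t s m × j * m ≤ s) → Bounds (3 + ρ) t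
bounds ρ t 1≤t small = Main.bounds ρ t 1≤t N₁ e e-spec e-small _ _ _ _ _ _ _ refl refl refl refl refl refl refl
  where
  N₁ = suc (proj₁ (small 1))
  e′ : ∀ s → N₁ ≤ s → ∃ (IsE' (3 + ρ) t s)
  e′ s le = e′Exists (≤-trans (s≤s z≤n) le) (proj₁ (proj₂ (proj₂ (small 1) s (<⇒≤ le))))
  open EdgeMinimum (3 + ρ) t N₁ e′ small

theorem16 : ∀ (r t : ℕ) → 3 ≤ r → r + 3 ≤ t →
    Σ (ℕ → ℕ) λ a → Σ (ℕ → ℕ) λ b →
    IsNPlusLittleO a × IsNPlusLittleO b ×
    Σ ℕ λ cp → Σ ℕ λ cq → Σ ℕ λ Cp → Σ ℕ λ Cq →
    1 ≤ cp × 1 ≤ cq × 1 ≤ Cp × 1 ≤ Cq ×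
    Σ ℕ λ N → ∀ n → N ≤ n →
    Σ ℕ λ m → Σ ℕ λ ea → Σ ℕ λ eb →
    IsTsat n r t m × IsE' r t (a n) ea × IsE' r t (b n) eb ×
    cq * (t * n) + cp * ea ≤ cq * m ×
    Cq * m ≤ Cq * (t * n) + Cp * eb
theorem16 r t 3≤r r+3≤t with ℕ.m≤n⇒∃[o]m+o≡n 3≤r | ℕ.m≤n⇒∃[o]m+o≡n r+3≤t
... | ρ , refl | q , refl = bounds ρ (3 + ρ + 3 + q) (s≤s z≤n) (smallSystems ρ q (3 + ρ + 3 + q) (arith ρ q))
  where
  arith : ∀ ρ q → ρ + (6 + q) ≡ 3 + ρ + 3 + q
  arith = solve-∀
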